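{- Let $n$ be a nonnegative integer. Then there is an extremal square-free word of length $n$ over the alphabet $\Gamma=\{\mathtt{a},\mathtt{b},\mathtt{c}\}$ if and only if \[ n\in\{25,41,48,50,63,71,72,77,79,81,83,84,85\}\cup\{m\colon m\geq 87\}. \]
   Context: A word is square-free if it contains no factor (contiguous subword) of the form $xx$ with $x$ a nonempty word. For a word $w$ over an alphabet $\Sigma$, an extension of $w$ is any word of the form $w'aw''$ where $a\in\Sigma$ and $w'w''=w$ (so $w'$ or $w''$ may be empty). A word $w$ over $\Sigma$ is extremal square-free if $w$ is square-free and no extension of $w$ over $\Sigma$ is square-free. -}

module Defs where

open import Data.Nat using (ℕ; _≥_)
open import Data.Fin using (Fin)
open import Data.List using (List; []; _∷_; _++_)
open import Data.Product using (Σ; _×_; ∃; ∃-syntax)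
open import Data.Sum using (_⊎_)
open import Relation.Nullary using (¬_)
open import Relation.Binary.PropositionalEquality using (_≡_; _≢_)

Word : Set → Set
Word A = List A

HasSquare : {A : Set} → Word A → Set
HasSquare {A} w = ∃[ u ] ∃[ x ] ∃[ v ] (x ≢ []) × (w ≡ u ++ (x ++ (x ++ v)))

SquareFree : {A : Set} → Word A → Set
SquareFree w = ¬ HasSquare w

IsExtension : {A : Set} → Word A → Word A → Set
IsExtension {A} w e = ∃[ w' ] ∃[ w'' ] Σ A λ a → (w' ++ w'' ≡ w) × (e ≡ w' ++ (a ∷ w''))

ExtremalSquareFree : {A : Set} → Word A → Set
ExtremalSquareFree {A} w = SquareFree w × (∀ (e : Word A) → IsExtension w e → ¬ SquareFree e)

Γ : Set
Γ = Fin 3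

ExceptionalLength : ℕ → Set
ExceptionalLength n =
  n ≡ 25 ⊎ n ≡ 41 ⊎ n ≡ 48 ⊎ n ≡ 50 ⊎ n ≡ 63 ⊎ n ≡ 71 ⊎ n ≡ 72 ⊎
  n ≡ 77 ⊎ n ≡ 79 ⊎ n ≡ 81 ⊎ n ≡ 83 ⊎ n ≡ 84 ⊎ n ≡ 85 ⊎ n ≥ 87

-- Necessity. In an extremal word w, inserting the third letter into a gap creates a square through
-- that gap. Extend a prefix of w letter by letter and keep, for each gap without such a square in
-- the prefix, the periods its square may still have, together with a bound for where it ends. A
-- prefix is given up when a gap has no period left, or when no choice of periods for all these gaps
-- is consistent, since each period forces letters beyond the prefix. What remains of the search
-- through the words of length at most 86 is evaluated by the type checker.
--
-- Sufficiency. Lengths below 250 are realised by explicit words. For the others, take the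
-- 54-uniform morphism hom whose blocks arise from one of them by adding constants modulo 3. It
-- preserves square-freeness, for two blocks differ at every position, so a square whose period is
-- a multiple of 54 comes from a square in the preimage, and no block occurs off the block
-- boundaries. Inside hom u every gap is closed by a short square, and suitable end words p and s
-- make p ++ hom u ++ s extremal. Each end word contains, next to the part it shares with a block,
-- a marker that occurs nowhere else; this excludes long squares that reach into the end words. The
-- lengths of p ++ s represent all residues modulo 54.
module Submission where

open import Defs
open import Data.Bool using (Bool; true; false; if_then_else_; _∧_; _∨_; not)
open import Data.Bool.ListAction using (all; any)
open import Data.Bool.Properties using (T-≡; ∧-conicalˡ; ∧-conicalʳ)
open import Data.Empty using (⊥; ⊥-elim)
open import Data.Fin using (zero; suc)
open import Data.List using (List; []; _∷_; _++_; length; take; drop; map; reverse; upTo; applyUpTo; _ʳ++_)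
open import Data.List.Membership.Propositional using (_∈_)
open import Data.List.Membership.Propositional.Properties using (∈-upTo⁺; ∈-applyUpTo⁺)
open import Data.List.Properties
  using (length-++; take++drop≡id; length-ʳ++; length-drop; ++-assoc; length-map; map-id; map-∘; map-cong;
         ʳ++-defn; ++-identityʳ; length-take; ∷-injective; reverse-involutive; length-reverse)
open import Data.List.Relation.Unary.All as All using (All; []; _∷_)
open import Data.List.Relation.Unary.Any using (Any; here; there; any?)
open import Data.Maybe as Maybe using (Maybe; just; nothing)
open import Data.Maybe.Properties using (just-injective)
open import Data.Nat
  using (ℕ; zero; suc; _+_; _∸_; _*_; _/_; _%_; _⊓_; _≤_; _<_; _≤?_; _<?_; _≟_; _<ᵇ_; _≤ᵇ_; _≡ᵇ_; z≤n; s≤s; ⌊_/2⌋; NonZero)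
open import Data.Nat.DivMod using (m≡m%n+[m/n]*n; m%n<n; /-monoˡ-≤)
open import Data.Nat.Properties
open import Data.Nat.Tactic.RingSolver using (solve-∀)
open import Data.Product using (_×_; _,_; ∃-syntax; proj₁; proj₂)
open import Data.Sum using (_⊎_; inj₁; inj₂)
open import Function.Bundles using (Equivalence; _⇔_; mk⇔)
open import Relation.Binary.PropositionalEquality
open import Relation.Nullary using (¬_; yes; no; contradiction; isYes)
open import Relation.Nullary.Decidable using (toWitness)

-- A period p is tested at a gap by comparing letters at distance p. A mismatch before the end of
-- the square moves its start past the left letter: a start beyond the gap refutes p, any other
-- raises the lower bound for the end, and p also dies once this bound exceeds the length limit plus
-- one. Extremality only denies that insertions are square-free, so it yields squares under a double
-- negation; the search concludes a Boolean equation, where the double negation can be removed.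
--
-- In the family of long words the obstacle is the two ends: they must close the outermost gaps
-- without forming squares with a middle of arbitrary length. If the outer half of a square contains
-- a marker, the inner half repeats it where it cannot occur; if not, the square lies in a window of
-- few blocks, which is tested. Each end shares a piece of a block with the middle, so that the
-- middle with both pieces is square-free by the morphism alone.
--
-- The threshold 250 is 142 + 2 * 54: ends of total length at most 142 realise every residue, and
-- the middle needs two blocks.

module _ {A : Set} where

  infixl 20 _!_
  _!_ : List A → ℕ → Maybe A
  []       ! _     = nothing
  (x ∷ xs) ! zero  = just x
  (x ∷ xs) ! suc k = xs ! k

  !-++ˡ : ∀ xs {ys k} → k < length xs → (xs ++ ys) ! k ≡ xs ! k
  !-++ˡ (x ∷ xs) {k = zero}  _         = refl
  !-++ˡ (x ∷ xs) {k = suc k} (s≤s k<n) = !-++ˡ xs k<n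

  !-++ʳ : ∀ xs {ys} k → (xs ++ ys) ! (length xs + k) ≡ ys ! k
  !-++ʳ []       k = refl
  !-++ʳ (x ∷ xs) k = !-++ʳ xs k

  !-drop : ∀ n xs k → drop n xs ! k ≡ xs ! (n + k)
  !-drop zero    xs       k = refl
  !-drop (suc n) []       k = refl
  !-drop (suc n) (x ∷ xs) k = !-drop n xs k

  !-< : ∀ xs {k x} → xs ! k ≡ just x → k < length xs
  !-< (x ∷ xs) {zero}  _  = s≤s z≤n
  !-< (x ∷ xs) {suc k} eq = s≤s (!-< xs eq)

  !-just : ∀ xs {k} → k < length xs → ∃[ x ] xs ! k ≡ just x
  !-just (x ∷ xs) {zero}  _         = x , refl
  !-just (x ∷ xs) {suc k} (s≤s k<n) = !-just xs k<n

  !-ʳ++ʳ : ∀ xs {ys} k → (xs ʳ++ ys) ! (length xs + k) ≡ ys ! k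
  !-ʳ++ʳ []       k = refl
  !-ʳ++ʳ (x ∷ xs) {ys} k =
    trans (cong ((xs ʳ++ (x ∷ ys)) !_) (sym (+-suc (length xs) k))) (!-ʳ++ʳ xs (suc k))

  !-ʳ++ˡ : ∀ xs {ys} {i j} → suc (i + j) ≡ length xs → (xs ʳ++ ys) ! j ≡ xs ! i
  !-ʳ++ˡ (x ∷ xs) {ys} {zero} {j} eq =
    trans (cong ((xs ʳ++ (x ∷ ys)) !_) (trans (suc-injective eq) (sym (+-identityʳ _)))) (!-ʳ++ʳ xs 0)
  !-ʳ++ˡ (x ∷ xs) {i = suc i} eq = !-ʳ++ˡ xs (suc-injective eq)

  take-cong-! : ∀ p {xs ys} → (∀ {k} → k < p → xs ! k ≡ ys ! k) → take p xs ≡ take p ys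
  take-cong-! zero eq = refl
  take-cong-! (suc p) {[]}     {[]}     eq = refl
  take-cong-! (suc p) {[]}     {y ∷ ys} eq with () ← eq {0} (s≤s z≤n)
  take-cong-! (suc p) {x ∷ xs} {[]}     eq with () ← eq {0} (s≤s z≤n)
  take-cong-! (suc p) {x ∷ xs} {y ∷ ys} eq =
    cong₂ _∷_ (just-injective (eq (s≤s z≤n))) (take-cong-! p (λ k<p → eq (s≤s k<p)))

  -- Start and period appear as numbers, because the search works with bounds on both; the two
  -- conversions below link this form to `HasSquare`.
  record Square (w : Word A) (s p : ℕ) : Set where
    constructor square
    field
      positive : 1 ≤ p
      fits     : s + (p + p) ≤ length w
      repeats  : ∀ {j} → s ≤ j → j < s + p → w ! j ≡ w ! (j + p)

  open Square public

  hasSquare⇒square : ∀ {w} → HasSquare w → ∃[ s ] ∃[ p ] Square w s p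
  hasSquare⇒square (u , []       , v , x≢[] , refl) = ⊥-elim (x≢[] refl)
  hasSquare⇒square (u , x@(c ∷ x′) , v , x≢[] , refl) =
    length u , length x , square (s≤s z≤n) len rep
    where
    w : Word A
    w = u ++ (x ++ (x ++ v))
    len : length u + (length x + length x) ≤ length w
    len = begin
      length u + (length x + length x)             ≤⟨ +-monoʳ-≤ (length u) (+-monoʳ-≤ (length x) (m≤m+n (length x) (length v))) ⟩
      length u + (length x + (length x + length v)) ≡⟨ cong (λ n → length u + (length x + n)) (length-++ x) ⟨
      length u + (length x + length (x ++ v))      ≡⟨ cong (length u +_) (length-++ x) ⟨
      length u + length (x ++ (x ++ v))            ≡⟨ length-++ u ⟨
      length w                                     ∎
      where open ≤-Reasoning
    rep : ∀ {j} → length u ≤ j → j < length u + length x → w ! j ≡ w ! (j + length x)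
    rep {j} u≤j j<u+x with k , refl ← m≤n⇒∃[o]m+o≡n u≤j = begin
      w ! (length u + k)                ≡⟨ !-++ʳ u k ⟩
      (x ++ (x ++ v)) ! k               ≡⟨ !-++ˡ x k<x ⟩
      x ! k                             ≡⟨ !-++ˡ x k<x ⟨
      (x ++ v) ! k                      ≡⟨ !-++ʳ x k ⟨
      (x ++ (x ++ v)) ! (length x + k)  ≡⟨ !-++ʳ u (length x + k) ⟨
      w ! (length u + (length x + k))   ≡⟨ cong (λ n → w ! (length u + n)) (+-comm (length x) k) ⟩
      w ! (length u + (k + length x))   ≡⟨ cong (w !_) (+-assoc (length u) k (length x)) ⟨
      w ! (length u + k + length x)     ∎
      where
      open ≡-Reasoning
      k<x : k < length x
      k<x = +-cancelˡ-< (length u) k (length x) j<u+x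

  square⇒hasSquare : ∀ {w s p} → Square w s p → HasSquare w
  square⇒hasSquare {w} {s} {suc p′} (square _ fit rep) =
    take s w , take p (drop s w) , drop p (drop p (drop s w)) , ne , sym eq
    where
    p : ℕ
    p = suc p′
    len : p + p ≤ length (drop s w)
    len = begin
      p + p              ≡⟨ m+n∸m≡n s (p + p) ⟨
      s + (p + p) ∸ s    ≤⟨ ∸-monoˡ-≤ s fit ⟩
      length w ∸ s       ≡⟨ length-drop s w ⟨
      length (drop s w)  ∎
      where open ≤-Reasoning
    ne : take p (drop s w) ≢ []
    ne with c ∷ _ ← drop s w | _ ← len = λ ()
    same : take p (drop p (drop s w)) ≡ take p (drop s w)
    same = take-cong-! p λ {k} k<p → begin
      drop p (drop s w) ! k  ≡⟨ !-drop p (drop s w) k ⟩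
      drop s w ! (p + k)     ≡⟨ !-drop s w (p + k) ⟩
      w ! (s + (p + k))      ≡⟨ cong (λ n → w ! (s + n)) (+-comm p k) ⟩
      w ! (s + (k + p))      ≡⟨ cong (w !_) (+-assoc s k p) ⟨
      w ! (s + k + p)        ≡⟨ rep (m≤m+n s k) (+-monoʳ-< s k<p) ⟨
      w ! (s + k)            ≡⟨ !-drop s w k ⟨
      drop s w ! k           ∎
      where open ≡-Reasoning
    eq : take s w ++ (take p (drop s w) ++ (take p (drop s w) ++ drop p (drop p (drop s w)))) ≡ w
    eq = begin
      take s w ++ (take p (drop s w) ++ (take p (drop s w) ++ drop p (drop p (drop s w))))
        ≡⟨ cong (λ l → take s w ++ (take p (drop s w) ++ (l ++ drop p (drop p (drop s w))))) same ⟨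
      take s w ++ (take p (drop s w) ++ (take p (drop p (drop s w)) ++ drop p (drop p (drop s w))))
        ≡⟨ cong (λ l → take s w ++ (take p (drop s w) ++ l)) (take++drop≡id p (drop p (drop s w))) ⟩
      take s w ++ (take p (drop s w) ++ drop p (drop s w))
        ≡⟨ cong (take s w ++_) (take++drop≡id p (drop s w)) ⟩
      take s w ++ drop s w
        ≡⟨ take++drop≡id s w ⟩
      w ∎
      where open ≡-Reasoning

  squareFree⇒¬square : ∀ {w s p} → SquareFree w → ¬ Square w s p
  squareFree⇒¬square sf sq = sf (square⇒hasSquare sq)

  -- Insertion of a letter and the squares through it

  insert : ℕ → A → Word A → Word A
  insert zero    z w       = z ∷ w
  insert (suc i) z []      = z ∷ []
  insert (suc i) z (x ∷ w) = x ∷ insert i z w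

  insert-take-drop : ∀ i z w → i ≤ length w → insert i z w ≡ take i w ++ z ∷ drop i w
  insert-take-drop zero    z w       _         = refl
  insert-take-drop (suc i) z (x ∷ w) (s≤s i≤n) = cong (x ∷_) (insert-take-drop i z w i≤n)

  insert-ʳ++ : ∀ v {r} k z → insert (length v + k) z (v ʳ++ r) ≡ v ʳ++ insert k z r
  insert-ʳ++ []          k z = refl
  insert-ʳ++ (x ∷ v) {r} k z =
    trans (cong (λ i → insert i z (v ʳ++ (x ∷ r))) (sym (+-suc (length v) k))) (insert-ʳ++ v (suc k) z)

  length-insert : ∀ i z w → length (insert i z w) ≡ suc (length w)
  length-insert zero    z w       = refl
  length-insert (suc i) z []      = refl
  length-insert (suc i) z (x ∷ w) = cong suc (length-insert i z w)

  insert-!-< : ∀ {i z} w {j} → i ≤ length w → j < i → insert i z w ! j ≡ w ! j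
  insert-!-< {suc i} (x ∷ w) {zero}  _         _         = refl
  insert-!-< {suc i} (x ∷ w) {suc j} (s≤s i≤n) (s≤s j<i) = insert-!-< w i≤n j<i

  insert-!-≡ : ∀ {i z} w → i ≤ length w → insert i z w ! i ≡ just z
  insert-!-≡ {zero}  w       _         = refl
  insert-!-≡ {suc i} (x ∷ w) (s≤s i≤n) = insert-!-≡ w i≤n

  insert-!-> : ∀ {i z} w {j} → i ≤ j → insert i z w ! suc j ≡ w ! j
  insert-!-> {zero}  w       _         = refl
  insert-!-> {suc i} []      {suc j} _ = refl
  insert-!-> {suc i} (x ∷ w) {suc j} (s≤s i≤j) = insert-!-> w i≤j

  Covered : Word A → ℕ → A → Set
  Covered w i z = ∃[ s ] ∃[ p ] Square (insert i z w) s p × s ≤ i × i < s + (p + p)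

  -- A square of the extended word that misses the inserted letter survives its removal: to the
  -- right of the letter it shifts by one, to the left it stays, and either way `w` would contain
  -- it.
  square-insert⇒covered : ∀ {w i z s p} → SquareFree w → i ≤ length w →
                          Square (insert i z w) s p → Covered w i z
  square-insert⇒covered {w} {i} {z} {s} {p} sf i≤n sq@(square p≥1 fit rep) = s , p , sq , s≤i , i<
    where
    e : Word A
    e = insert i z w
    s≤i : s ≤ i
    s≤i with s ≤? i
    ... | yes q = q
    ... | no q with s≤s {n = s′} i≤s′ ← ≰⇒> q =
      contradiction (square p≥1 fit′ rep′) (squareFree⇒¬square sf)
      where
      fit′ : s′ + (p + p) ≤ length w
      fit′ = ≤-pred (subst (suc (s′ + (p + p)) ≤_) (length-insert i z w) fit)
      rep′ : ∀ {j} → s′ ≤ j → j < s′ + p → w ! j ≡ w ! (j + p)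
      rep′ {j} l h = begin
        w ! j            ≡⟨ insert-!-> w (≤-trans i≤s′ l) ⟨
        e ! suc j        ≡⟨ rep (s≤s l) (s≤s h) ⟩
        e ! (suc j + p)  ≡⟨ insert-!-> w (≤-trans i≤s′ (≤-trans l (m≤m+n j p))) ⟩
        w ! (j + p)      ∎
        where open ≡-Reasoning
    i< : i < s + (p + p)
    i< with i <? s + (p + p)
    ... | yes q = q
    ... | no q = contradiction (square p≥1 (≤-trans end≤i i≤n) rep′) (squareFree⇒¬square sf)
      where
      end≤i : s + (p + p) ≤ i
      end≤i = ≮⇒≥ q
      rep′ : ∀ {j} → s ≤ j → j < s + p → w ! j ≡ w ! (j + p)
      rep′ {j} l h = begin
        w ! j        ≡⟨ insert-!-< w i≤n (<-≤-trans (≤-<-trans (m≤m+n j p) j+p<) end≤i) ⟨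
        e ! j        ≡⟨ rep l h ⟩
        e ! (j + p)  ≡⟨ insert-!-< w i≤n (<-≤-trans j+p< end≤i) ⟩
        w ! (j + p)  ∎
        where
        open ≡-Reasoning
        j+p< : j + p < s + (p + p)
        j+p< = subst (j + p <_) (+-assoc s p p) (+-monoˡ-< p h)

  -- The double negation is all that extremality gives, since it only denies square-freeness of each
  -- extension. `stable` removes it where the goal is an equation with `true`.
  AllCovered : Word A → Set
  AllCovered w = ∀ {i} z → i ≤ length w → ¬ ¬ Covered w i z

  extremal⇒allCovered : ∀ {w} → ExtremalSquareFree w → AllCovered w
  extremal⇒allCovered {w} (sf , ext) {i} z i≤n ¬cov =
    ext (insert i z w) (take i w , drop i w , z , take++drop≡id i w , insert-take-drop i z w i≤n)
      λ sq → ¬cov (square-insert⇒covered sf i≤n (proj₂ (proj₂ (hasSquare⇒square sq))))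

-- The ternary alphabet and tests for a square at an end of a word

pattern 𝕒 = zero
pattern 𝕓 = suc zero
pattern 𝕔 = suc (suc zero)

infix 4 _==_
_==_ : Γ → Γ → Bool
𝕒 == 𝕒 = true
𝕓 == 𝕓 = true
𝕔 == 𝕔 = true
_ == _ = false

==-refl : ∀ x → (x == x) ≡ true
==-refl 𝕒 = refl
==-refl 𝕓 = refl
==-refl 𝕔 = refl

==⇒≡ : ∀ x y → (x == y) ≡ true → x ≡ y
==⇒≡ 𝕒 𝕒 _ = refl
==⇒≡ 𝕓 𝕓 _ = refl
==⇒≡ 𝕔 𝕔 _ = refl

≢⇒== : ∀ {x y} → (x == y) ≡ false → x ≢ y
≢⇒== {x} eq refl with () ← trans (sym eq) (==-refl x)

third : Γ → Γ → Γ
third 𝕒 𝕓 = 𝕔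
third 𝕓 𝕒 = 𝕔
third 𝕒 𝕔 = 𝕓
third 𝕔 𝕒 = 𝕓
third 𝕓 𝕔 = 𝕒
third 𝕔 𝕓 = 𝕒
third x _ = x

<ᵇ-true⇒< : ∀ m n → (m <ᵇ n) ≡ true → m < n
<ᵇ-true⇒< m n eq = <ᵇ⇒< m n (Equivalence.from T-≡ eq)

prefixᵇ : ℕ → List Γ → List Γ → Bool
prefix′ : Bool → ℕ → List Γ → List Γ → Bool
prefixᵇ zero    xs       ys       = true
prefixᵇ (suc n) []       ys       = false
prefixᵇ (suc n) (x ∷ xs) []       = false
prefixᵇ (suc n) (x ∷ xs) (y ∷ ys) = prefix′ (x == y) n xs ys
prefix′ true  n xs ys = prefixᵇ n xs ys
prefix′ false n xs ys = false

prefixᵇ-sound : ∀ n xs ys → prefixᵇ n xs ys ≡ true →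
                n ≤ length ys × (∀ {k} → k < n → xs ! k ≡ ys ! k)
prefixᵇ-sound zero    xs       ys       _ = z≤n , λ ()
prefixᵇ-sound (suc n) (x ∷ xs) (y ∷ ys) h with x == y in eq
... | true with l , same ← prefixᵇ-sound n xs ys h = s≤s l , agree
  where
  agree : ∀ {k} → k < suc n → (x ∷ xs) ! k ≡ (y ∷ ys) ! k
  agree {zero}  _         = cong just (==⇒≡ x y eq)
  agree {suc k} (s≤s k<n) = same k<n

prefixᵇ-complete : ∀ n xs ys → n ≤ length xs → (∀ {k} → k < n → xs ! k ≡ ys ! k) →
                   prefixᵇ n xs ys ≡ true
prefixᵇ-complete zero    xs       ys       _ _ = refl
prefixᵇ-complete (suc n) (x ∷ xs) []       _ h with () ← h {0} (s≤s z≤n)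
prefixᵇ-complete (suc n) (x ∷ xs) (y ∷ ys) (s≤s l) h
  with refl ← just-injective (h {0} (s≤s z≤n)) rewrite ==-refl x =
  prefixᵇ-complete n xs ys l λ k<n → h (s≤s k<n)

-- The list `d` keeps pace with the period: it equals `drop (p ∸ 1) v`, so that each new period
-- costs one tail instead of a new `drop`. The first argument counts the periods still to be tried.
headSquare : ℕ → ℕ → List Γ → List Γ → Bool
headSquare′ : Bool → ℕ → ℕ → List Γ → List Γ → Bool
headSquare zero    p v d       = false
headSquare (suc f) p v []      = false
headSquare (suc f) p v (_ ∷ d) = headSquare′ (prefixᵇ p v d) f p v d
headSquare′ true  f p v d = true
headSquare′ false f p v d = headSquare f (suc p) v d

drop-∷ : ∀ {A : Set} n (xs : List A) {y d} → drop n xs ≡ y ∷ d → d ≡ drop (suc n) xs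
drop-∷ zero    (x ∷ xs) refl = refl
drop-∷ (suc n) (x ∷ xs) eq   = drop-∷ n xs eq

headSquare-sound : ∀ f p v d → d ≡ drop p v → headSquare f (suc p) v d ≡ true →
                   ∃[ q ] 1 ≤ q × q + q ≤ length v × (∀ {k} → k < q → v ! k ≡ v ! (q + k))
headSquare-sound (suc f) p v (y ∷ d) eq h with prefixᵇ (suc p) v d in eqb | drop-∷ p v (sym eq)
... | false | eq′ = headSquare-sound f (suc p) v d eq′ h
... | true  | refl with l , same ← prefixᵇ-sound (suc p) v (drop (suc p) v) eqb =
  suc p , s≤s z≤n , len , λ {k} k<q → trans (same k<q) (!-drop (suc p) v k)
  where
  len : suc p + suc p ≤ length v
  len with k , eq″ ← !-just (drop (suc p) v) l =
    subst (_≤ length v) (sym (+-suc (suc p) p)) (!-< v (trans (sym (!-drop (suc p) v p)) eq″))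

headSquare-complete : ∀ f p v d q → d ≡ drop p v → suc p ≤ q → q < suc p + f → q + q ≤ length v →
                      (∀ {k} → k < q → v ! k ≡ v ! (q + k)) → headSquare f (suc p) v d ≡ true
headSquare-complete zero p v d q eq p<q q< _ _ =
  contradiction q< (≤⇒≯ (subst (_≤ q) (sym (+-identityʳ (suc p))) p<q))
headSquare-complete (suc f) p v [] q eq p<q q< len same
  with x , eqx ← !-just v {p + 0} (≤-trans (s≤s (≤-reflexive (+-identityʳ p))) (≤-trans p<q (≤-trans (m≤m+n q q) len)))
  with () ← trans (sym (trans (!-drop p v 0) eqx)) (cong (_! 0) (sym eq))
headSquare-complete (suc f) p v (y ∷ d) q eq p<q q< len same
  with prefixᵇ (suc p) v d in eqb | drop-∷ p v (sym eq)
... | true  | _ = refl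
... | false | eq′ = headSquare-complete f (suc p) v d q eq′ (≤∧≢⇒< p<q ne)
                      (subst (q <_) (+-suc (suc p) f) q<) len same
  where
  ne : suc p ≢ q
  ne refl with () ← trans (sym eqb) (trans (cong (prefixᵇ (suc p) v) eq′)
    (prefixᵇ-complete (suc p) v (drop (suc p) v) (≤-trans (m≤m+n (suc p) (suc p)) len)
      λ {k} k<q → trans (same k<q) (sym (!-drop (suc p) v k))))

n+n≤m⇒n≤⌊m/2⌋ : ∀ n {m} → n + n ≤ m → n ≤ ⌊ m /2⌋
n+n≤m⇒n≤⌊m/2⌋ n n+n≤m = subst (_≤ _) (sym (n≡⌊n+n/2⌋ n)) (⌊n/2⌋-mono n+n≤m)

-- Here v is a word of length n read backwards.
endsWithSquare : ℕ → List Γ → Bool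
endsWithSquare n v = headSquare ⌊ n /2⌋ 1 v v

reflect : ∀ v {r : List Γ} {k j} → suc (k + j) ≡ length v → (v ʳ++ r) ! j ≡ v ! k
reflect v = !-ʳ++ˡ v

endsWithSquare-sound : ∀ v {r} n → endsWithSquare n v ≡ true → ∃[ s ] ∃[ p ] Square (v ʳ++ r) s p
endsWithSquare-sound v {r} n h with headSquare-sound ⌊ n /2⌋ 0 v v refl h
... | q@(suc q′) , _ , len , same with s , eq ← m≤n⇒∃[o]m+o≡n len = s , q , square (s≤s z≤n) fit rep
  where
  fit : s + (q + q) ≤ length (v ʳ++ r)
  fit = begin
    s + (q + q)            ≡⟨ +-comm s (q + q) ⟩
    q + q + s              ≡⟨ eq ⟩
    length v               ≤⟨ m≤m+n (length v) (length r) ⟩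
    length v + length r    ≡⟨ length-ʳ++ v ⟨
    length (v ʳ++ r)       ∎
    where open ≤-Reasoning
  rep : ∀ {j} → s ≤ j → j < s + q → (v ʳ++ r) ! j ≡ (v ʳ++ r) ! (j + q)
  rep {j} s≤j j< with i , refl ← m≤n⇒∃[o]m+o≡n s≤j
    with k , eqk ← m≤n⇒∃[o]m+o≡n (+-cancelˡ-< s i q j<) = begin
    (v ʳ++ r) ! (s + i)      ≡⟨ reflect v {k = q + k} e₁ ⟩
    v ! (q + k)              ≡⟨ same k<q ⟨
    v ! k                    ≡⟨ reflect v {k = k} e₂ ⟨
    (v ʳ++ r) ! (s + i + q)  ∎
    where
    open ≡-Reasoning
    k<q : k < q
    k<q = ≤-trans (s≤s (m≤n+m k i)) (≤-reflexive eqk)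
    e₁ : suc (q + k + (s + i)) ≡ length v
    e₁ = begin
      suc (q + k + (s + i))     ≡⟨ cong suc (+-assoc q k (s + i)) ⟩
      suc (q + (k + (s + i)))   ≡⟨ cong (λ n → suc (q + n)) (trans (+-comm k (s + i)) (trans (+-assoc s i k) (+-comm s (i + k)))) ⟩
      suc (q + (i + k + s))     ≡⟨ +-suc q (i + k + s) ⟨
      q + (suc (i + k) + s)     ≡⟨ cong (λ n → q + (n + s)) eqk ⟩
      q + (q + s)               ≡⟨ +-assoc q q s ⟨
      q + q + s                 ≡⟨ eq ⟩
      length v                  ∎
    e₂ : suc (k + (s + i + q)) ≡ length v
    e₂ = begin
      suc (k + (s + i + q))     ≡⟨ cong suc (trans (cong (k +_) (+-comm (s + i) q)) (trans (sym (+-assoc k q (s + i))) (cong (_+ (s + i)) (+-comm k q)))) ⟩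
      suc (q + k + (s + i))     ≡⟨ e₁ ⟩
      length v                  ∎

endsWithSquare-complete : ∀ v {s p} → s + (p + p) ≡ length v → Square (v ʳ++ []) s p →
                          endsWithSquare (length v) v ≡ true
endsWithSquare-complete v {s} {p} eq (square p≥1 _ rep) =
  headSquare-complete ⌊ length v /2⌋ 0 v v p refl p≥1 (s≤s (n+n≤m⇒n≤⌊m/2⌋ p len)) len same
  where
  len : p + p ≤ length v
  len = subst (p + p ≤_) eq (m≤n+m (p + p) s)
  same : ∀ {k} → k < p → v ! k ≡ v ! (p + k)
  same {k} k<p with o , eqo ← m≤n⇒∃[o]m+o≡n k<p = begin
    v ! k                     ≡⟨ reflect v {k = k} e₂ ⟨
    (v ʳ++ []) ! (s + o + p)  ≡⟨ rep (m≤m+n s o) (+-monoʳ-< s o<p) ⟨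
    (v ʳ++ []) ! (s + o)      ≡⟨ reflect v {k = p + k} e₁ ⟩
    v ! (p + k)               ∎
    where
    open ≡-Reasoning
    o<p : o < p
    o<p = ≤-trans (s≤s (m≤n+m o k)) (≤-reflexive eqo)
    e₁ : suc (p + k + (s + o)) ≡ length v
    e₁ = begin
      suc (p + k + (s + o))    ≡⟨ cong suc (trans (+-assoc p k (s + o)) (cong (p +_) (trans (+-comm k (s + o)) (+-assoc s o k)))) ⟩
      suc (p + (s + (o + k)))  ≡⟨ cong (λ n → suc (p + (s + n))) (+-comm o k) ⟩
      suc (p + (s + (k + o)))  ≡⟨ +-suc p (s + (k + o)) ⟨
      p + suc (s + (k + o))    ≡⟨ cong (p +_) (+-suc s (k + o)) ⟨
      p + (s + suc (k + o))    ≡⟨ cong (λ n → p + (s + n)) eqo ⟩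
      p + (s + p)              ≡⟨ trans (sym (+-assoc p s p)) (trans (cong (_+ p) (+-comm p s)) (+-assoc s p p)) ⟩
      s + (p + p)              ≡⟨ eq ⟩
      length v                 ∎
    e₂ : suc (k + (s + o + p)) ≡ length v
    e₂ = begin
      suc (k + (s + o + p))    ≡⟨ cong suc (trans (cong (k +_) (+-comm (s + o) p)) (trans (sym (+-assoc k p (s + o))) (cong (_+ (s + o)) (+-comm k p)))) ⟩
      suc (p + k + (s + o))    ≡⟨ e₁ ⟩
      length v                 ∎

-- Exhaustive search

-- The candidate periods 1, 2, … for a square through an inserted letter: a period has been
-- refuted, or comes with a lower bound for the position where its square ends.
data Cells : Set where
  nil  : Cells
  skip : Cells → Cells
  cell : ℕ → Cells → Cells

data At : Cells → ℕ → ℕ → Set where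
  here  : ∀ {t cs} → At (cell t cs) 0 t
  skip  : ∀ {cs q t} → At cs q t → At (skip cs) (suc q) t
  there : ∀ {u cs q t} → At cs q t → At (cell u cs) (suc q) t

-- Collapses a tail of refuted periods, so that a gap without candidates is literally `nil`, the
-- case in which `enqueue` gives up.
skip⁺ : Cells → Cells
skip⁺ nil = nil
skip⁺ cs  = skip cs

skip⁺-At : ∀ {cs q t} → At cs q t → At (skip⁺ cs) (suc q) t
skip⁺-At at@here      = skip at
skip⁺-At at@(skip _)  = skip at
skip⁺-At at@(there _) = skip at

covered : ℕ → Cells → Bool
covered′ : Bool → ℕ → Cells → Bool
covered m nil         = false
covered m (skip cs)   = covered m cs
covered m (cell t cs) = covered′ (m <ᵇ t) m cs
covered′ true  m cs = covered m cs
covered′ false m cs = true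

-- Forgetting a gap only drops a condition, so a positive answer of `covered` needs no
-- justification. What the search relies on is the negative answer: all bounds exceed `m`, hence the
-- actual square is still unfinished after `m` letters.
covered-sound : ∀ m {cs q t} → covered m cs ≡ false → At cs q t → m < t
covered-sound m {cell t _} h here with m <ᵇ t in eq
... | true = <ᵇ-true⇒< m t eq
covered-sound m h (skip at) = covered-sound m h at
covered-sound m {cell u _} h (there at) with m <ᵇ u
... | true = covered-sound m h at

record Gap : Set where
  constructor gap
  field
    pos     : ℕ
    letter  : Γ
    before  : List Γ
    periods : Cells

Template : Set
Template = List (Maybe Γ)

tail⁺ : Template → Template
tail⁺ []      = []
tail⁺ (_ ∷ T) = T

clash : ℕ → List Γ → Template → Bool
clash′ : Bool → ℕ → List Γ → Template → Bool
clash zero    F       T             = false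
clash (suc n) []      T             = false
clash (suc n) (y ∷ F) []            = false
clash (suc n) (y ∷ F) (nothing ∷ T) = clash n F T
clash (suc n) (y ∷ F) (just x ∷ T)  = clash′ (x == y) n F T
clash′ true  n F T = clash n F T
clash′ false n F T = true

-- Overwrites entries without comparing them, since `clash` has been consulted before.
merge : ℕ → ℕ → List Γ → Template → Template
merge (suc k) n       F       []      = nothing ∷ merge k n F []
merge (suc k) n       F       (x ∷ T) = x ∷ merge k n F T
merge zero    zero    F       T       = T
merge zero    (suc n) []      T       = T
merge zero    (suc n) (y ∷ F) []      = just y ∷ merge zero n F []
merge zero    (suc n) (y ∷ F) (_ ∷ T) = just y ∷ merge zero n F T

-- Whether periods can be chosen for all gaps so that the letters they force from position m ∸ 1
-- on agree; m is the length of the known part w with one inserted letter. A square with period p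
-- through a gap at i repeats what follows the gap. If p ≤ m ∸ i (try₁), this forces letters at
-- once, and otherwise (try₂) only after o letters.
sat : List Γ → ℕ → List Gap → Template → Bool
try₁ : List Γ → ℕ → ℕ → ℕ → ℕ → List Γ → Cells → List Gap → Template → Bool
try₁′ : List Γ → ℕ → ℕ → ℕ → ℕ → List Γ → Cells → List Gap → Template → ℕ → List Γ → Bool
try₁″ : Bool → List Γ → ℕ → ℕ → ℕ → ℕ → List Γ → Cells → List Gap → Template → ℕ → List Γ → Bool
try₂ : List Γ → ℕ → ℕ → ℕ → ℕ → List Γ → Cells → List Gap → Template → Template → Bool
try₂′ : List Γ → ℕ → ℕ → ℕ → ℕ → List Γ → Cells → List Gap → Template → Template → ℕ → Bool
try₂″ : Bool → List Γ → ℕ → ℕ → ℕ → ℕ → List Γ → Cells → List Gap → Template → Template → ℕ → Bool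
sat w m []                  T = true
sat w m (gap i z _ cs ∷ gs) T = try₁ w m 1 i (m ∸ i) (z ∷ drop i w) cs gs T
try₁ w m p i zero    F cs          gs T = try₂ w m p i 1 F cs gs T (tail⁺ T)
try₁ w m p i (suc k) F nil         gs T = false
try₁ w m p i (suc k) F (skip cs)   gs T = try₁ w m (suc p) i k F cs gs T
try₁ w m p i (suc k) F (cell t cs) gs T = try₁′ w m p i k F cs gs T (t ∸ p ∸ (i + k)) (drop k F)
try₁′ w m p i k F cs gs T n F′ = try₁″ (clash n F′ T) w m p i k F cs gs T n F′
try₁″ true  w m p i k F cs gs T n F′ = try₁ w m (suc p) i k F cs gs T
try₁″ false w m p i k F cs gs T n F′ =
  if sat w m gs (merge 0 n F′ T) then true else try₁ w m (suc p) i k F cs gs T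
try₂ w m p i o F nil         gs T T′ = false
try₂ w m p i o F (skip cs)   gs T T′ = try₂ w m (suc p) i (suc o) F cs gs T (tail⁺ T′)
try₂ w m p i o F (cell t cs) gs T T′ = try₂′ w m p i o F cs gs T T′ (t ∸ p ∸ i)
try₂′ w m p i o F cs gs T T′ n = try₂″ (clash n F T′) w m p i o F cs gs T T′ n
try₂″ true  w m p i o F cs gs T T′ n = try₂ w m (suc p) i (suc o) F cs gs T (tail⁺ T′)
try₂″ false w m p i o F cs gs T T′ n =
  if sat w m gs (merge o n F T) then true else try₂ w m (suc p) i (suc o) F cs gs T (tail⁺ T′)

-- The k-th entry of a template describes the letter of w at position n + k.
Fits : Word Γ → ℕ → Template → Set
Fits w n T = ∀ {k y} → T ! k ≡ just (just y) → w ! (n + k) ≡ just y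

Forced : Word Γ → ℕ → ℕ → List Γ → Set
Forced w n c F = ∀ {k y} → k < c → F ! k ≡ just y → w ! (n + k) ≡ just y

Fits-tail : ∀ {w n} T → Fits w n T → Fits w (suc n) (tail⁺ T)
Fits-tail {w} {n} (_ ∷ T) fit {k} h = trans (cong (w !_) (sym (+-suc n k))) (fit {suc k} h)

Forced-tail : ∀ {w n c y F} → Forced w n (suc c) (y ∷ F) → Forced w (suc n) c F
Forced-tail {w} {n} for {k} k<c h = trans (cong (w !_) (sym (+-suc n k))) (for {suc k} (s≤s k<c) h)

-- The letters recorded so far and the newly forced ones are letters of the one word `w`, so they
-- cannot disagree.
clash-false : ∀ {w n} c F T → Fits w n T → Forced w n c F → clash c F T ≡ false
clash-false zero    F       T             fit for = refl
clash-false (suc c) []      T             fit for = refl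
clash-false (suc c) (y ∷ F) []            fit for = refl
clash-false {w} {n} (suc c) (y ∷ F) (nothing ∷ T) fit for =
  clash-false {w} c F T (Fits-tail {w} {n} (_ ∷ T) fit) (Forced-tail {w} {n} for)
clash-false {w} {n} (suc c) (y ∷ F) (just x ∷ T) fit for
  with refl ← just-injective (trans (sym (fit {0} refl)) (for {0} (s≤s z≤n) refl)) rewrite ==-refl x =
  clash-false {w} c F T (Fits-tail {w} {n} (_ ∷ T) fit) (Forced-tail {w} {n} for)

merge-Fits : ∀ {w n} o c F T → Fits w n T → Forced w (n + o) c F → Fits w n (merge o c F T)
merge-Fits {w} {n} (suc o) c F [] fit for {suc k} h =
  trans (cong (w !_) (+-suc n k))
    (merge-Fits {w} {suc n} o c F [] (λ ()) (subst (λ j → Forced w j c F) (+-suc n o) for) {k} h)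
merge-Fits (suc o) c F (x ∷ T) fit for {zero} h = fit {0} h
merge-Fits {w} {n} (suc o) c F (x ∷ T) fit for {suc k} h =
  trans (cong (w !_) (+-suc n k))
    (merge-Fits {w} {suc n} o c F T (Fits-tail {w} {n} (_ ∷ T) fit) (subst (λ j → Forced w j c F) (+-suc n o) for) {k} h)
merge-Fits zero zero    F       T       fit for h = fit h
merge-Fits zero (suc c) []      T       fit for h = fit h
merge-Fits {w} {n} zero (suc c) (y ∷ F) [] fit for {zero} refl =
  subst (λ j → w ! (j + 0) ≡ just y) (+-identityʳ n) (for {0} (s≤s z≤n) refl)
merge-Fits {w} {n} zero (suc c) (y ∷ F) [] fit for {suc k} h =
  trans (cong (w !_) (+-suc n k))
    (merge-Fits {w} {suc n} zero c F [] (λ ()) (Forced-tail {w} {n + 0} for) {k} h)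
merge-Fits {w} {n} zero (suc c) (y ∷ F) (_ ∷ T) fit for {zero} refl =
  subst (λ j → w ! (j + 0) ≡ just y) (+-identityʳ n) (for {0} (s≤s z≤n) refl)
merge-Fits {w} {n} zero (suc c) (y ∷ F) (_ ∷ T) fit for {suc k} h =
  trans (cong (w !_) (+-suc n k))
    (merge-Fits {w} {suc n} zero c F T (Fits-tail {w} {n} (_ ∷ T) fit) (Forced-tail {w} {n + 0} for) {k} h)

-- The invariant of the search for one open gap. There is an actual square through it, of period
-- `suc q` as cells are counted from 0; this period has not been refuted, its recorded bound `t` is
-- at most the true end, and that end lies beyond the known prefix.
record Pending (w : Word Γ) (n : ℕ) (g : Gap) : Set where
  constructor pending
  open Gap g
  field
    {after}  : List Γ
    {s q t}  : ℕ
    pos≤     : pos ≤ n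
    pos≤len  : pos ≤ length w
    split    : insert pos letter w ≡ before ʳ++ after
    len      : length before ≡ suc n
    sq       : Square (insert pos letter w) s (suc q)
    s≤pos    : s ≤ pos
    open′    : suc n < s + (suc q + suc q)
    at       : At periods q t
    t≤       : t ≤ s + (suc q + suc q)

m<n∸o⇒o+m<n : ∀ o {m n} → m < n ∸ o → o + m < n
m<n∸o⇒o+m<n zero            lt = lt
m<n∸o⇒o+m<n (suc o) {n = suc n} lt = s≤s (m<n∸o⇒o+m<n o lt)

module _ {w : Word Γ} {n : ℕ} {wp : List Γ} (agree : ∀ {k y} → wp ! k ≡ just y → w ! k ≡ just y) where

  module _ {i z s p} (i≤n : i ≤ n) (i≤w : i ≤ length w)
           (sq : Square (insert i z w) s p) (s≤i : s ≤ i) where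

    -- Only `s ≤ i` is known of the start, so the letters certain to lie in the first half begin at
    -- the gap; those before `t ∸ p` belong to it because `t` does not exceed the true end. Shifted
    -- by the period they give letters of `w`, one position lower because the insertion lies before
    -- them.
    forced : ∀ {t k o} → t ≤ s + (p + p) → i + k + p ≡ suc (n + o) →
             Forced w (n + o) (t ∸ p ∸ (i + k)) (drop k (z ∷ drop i wp))
    forced {t} {k} {o} t≤ eq {c} {y} c< h = begin
      w ! (n + o + c)                 ≡⟨ insert-!-> w (≤-trans i≤n (≤-trans (m≤m+n n o) (m≤m+n (n + o) c))) ⟨
      insert i z w ! suc (n + o + c)  ≡⟨ cong (insert i z w !_) e₁ ⟨
      insert i z w ! (j + p)          ≡⟨ repeats sq (≤-trans s≤i (≤-trans (m≤m+n i k) (m≤m+n (i + k) c))) j< ⟨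
      insert i z w ! j                ≡⟨ cong (insert i z w !_) (+-assoc i k c) ⟩
      insert i z w ! (i + (k + c))    ≡⟨ known (k + c) (trans (sym (!-drop k (z ∷ drop i wp) c)) h) ⟩
      just y                          ∎
      where
      open ≡-Reasoning
      j : ℕ
      j = i + k + c
      e₁ : j + p ≡ suc (n + o + c)
      e₁ = trans (trans (+-assoc (i + k) c p) (trans (cong (i + k +_) (+-comm c p)) (sym (+-assoc (i + k) p c)))) (cong (_+ c) eq)
      j< : j < s + p
      j< = +-cancelʳ-< p j (s + p) (<-≤-trans (subst (_< t) (+-comm p j) j<t) (≤-trans t≤ (≤-reflexive (sym (+-assoc s p p)))))
        where
        j<t : p + j < t
        j<t = m<n∸o⇒o+m<n p (m<n∸o⇒o+m<n (i + k) c<)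
      known : ∀ a → (z ∷ drop i wp) ! a ≡ just y → insert i z w ! (i + a) ≡ just y
      known zero    refl = trans (cong (insert i z w !_) (+-identityʳ i)) (insert-!-≡ w i≤w)
      known (suc a) h′   = begin
        insert i z w ! (i + suc a)  ≡⟨ cong (insert i z w !_) (+-suc i a) ⟩
        insert i z w ! suc (i + a)  ≡⟨ insert-!-> w (m≤m+n i a) ⟩
        w ! (i + a)                 ≡⟨ agree (trans (sym (!-drop i wp a)) h′) ⟩
        just y                      ∎

    module _ {gs : List Gap} (rest : ∀ {T} → Fits w n T → sat wp (suc n) gs T ≡ true) where

      now₂ : ∀ {p o c F cs T T′} → Fits w n T → Fits w (n + o) T′ → Forced w (n + o) c F →
             try₂′ wp (suc n) p i o F cs gs T T′ c ≡ true
      now₂ {o = o} {c} {F} {T = T} {T′} fit fit′ for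
        rewrite clash-false {w} {n + o} c F T′ fit′ for | rest {merge o c F T} (merge-Fits {w} {n} o c F T fit for) = refl

      now₁ : ∀ {p k c F F′ cs T} → Fits w n T → Forced w (n + 0) c F′ →
             try₁′ wp (suc n) p i k F cs gs T c F′ ≡ true
      now₁ {c = c} {F′ = F′} {T = T} fit for
        rewrite clash-false {w} {n} c F′ T fit (subst (λ j → Forced w j c F′) (+-identityʳ n) for)
              | rest {merge 0 c F′ T} (merge-Fits {w} {n} 0 c F′ T fit for) = refl

      -- The walk may succeed early with a wrong period, which is harmless. Otherwise it arrives at
      -- the actual period `p`, where the forced letters fit `w` and `rest` handles the remaining
      -- gaps.
      try₂-true : ∀ {p₀ o cs q t T T′} → At cs q t → p ≡ p₀ + q → t ≤ s + (p + p) →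
                  i + p₀ ≡ suc (n + o) → Fits w n T → Fits w (n + o) T′ →
                  try₂ wp (suc n) p₀ i o (z ∷ drop i wp) cs gs T T′ ≡ true
      try₂-true {p₀} {o} {cell t cs} {T = T} {T′} here eqp t≤ eq fit fit′
        with refl ← trans eqp (+-identityʳ p₀)
        = now₂ fit fit′
            (subst (λ j → Forced w (n + o) (t ∸ p ∸ j) (z ∷ drop i wp)) (+-identityʳ i)
              (forced {t} {0} {o} t≤ (trans (cong (_+ p) (+-identityʳ i)) eq)))
      try₂-true {p₀} {o} {skip cs} {T′ = T′} (skip at) eqp t≤ eq fit fit′ =
        try₂-true at (trans eqp (+-suc p₀ _)) t≤
          (trans (+-suc i p₀) (trans (cong suc eq) (cong suc (sym (+-suc n o))))) fit
          (subst (λ j → Fits w j (tail⁺ T′)) (sym (+-suc n o)) (Fits-tail {w} {n + o} T′ fit′))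
      try₂-true {p₀} {o} {cell u cs} {T = T} {T′} (there at) eqp t≤ eq fit fit′
        with clash (u ∸ p₀ ∸ i) (z ∷ drop i wp) T′
           | try₂-true {T = T} {tail⁺ T′} at (trans eqp (+-suc p₀ _)) t≤
               (trans (+-suc i p₀) (trans (cong suc eq) (cong suc (sym (+-suc n o))))) fit
               (subst (λ j → Fits w j (tail⁺ T′)) (sym (+-suc n o)) (Fits-tail {w} {n + o} T′ fit′))
      ... | true  | ih = ih
      ... | false | ih with sat wp (suc n) gs (merge o (u ∸ p₀ ∸ i) (z ∷ drop i wp) T)
      ...   | true  = refl
      ...   | false = ih

      try₁-true : ∀ {p₀ k cs q t T} → At cs q t → p ≡ p₀ + q → t ≤ s + (p + p) →
                  i + k + p₀ ≡ suc (suc n) → Fits w n T →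
                  try₁ wp (suc n) p₀ i k (z ∷ drop i wp) cs gs T ≡ true
      try₁-true {p₀} {zero} {T = T} at eqp t≤ eq fit =
        try₂-true at eqp t≤
          (trans (cong (_+ p₀) (sym (+-identityʳ i))) (trans eq (cong suc (sym (+-comm n 1))))) fit
          (subst (λ j → Fits w j (tail⁺ T)) (+-comm 1 n) (Fits-tail {w} {n} T fit))
      try₁-true {p₀} {suc k} {cell t cs} {T = T} here eqp t≤ eq fit
        with refl ← trans eqp (+-identityʳ p₀)
        = now₁ fit
            (forced {t} {k} {0} t≤
              (trans (suc-injective (trans (cong (_+ p) (sym (+-suc i k))) eq)) (cong suc (sym (+-identityʳ n)))))
      try₁-true {p₀} {suc k} {skip cs} (skip at) eqp t≤ eq fit =
        try₁-true at (trans eqp (+-suc p₀ _)) t≤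
          (trans (+-suc (i + k) p₀) (trans (cong (_+ p₀) (sym (+-suc i k))) eq)) fit
      try₁-true {p₀} {suc k} {cell u cs} {T = T} (there at) eqp t≤ eq fit
        with clash (u ∸ p₀ ∸ (i + k)) (drop k (z ∷ drop i wp)) T
           | try₁-true {T = T} at (trans eqp (+-suc p₀ _)) t≤
               (trans (+-suc (i + k) p₀) (trans (cong (_+ p₀) (sym (+-suc i k))) eq)) fit
      ... | true  | ih = ih
      ... | false | ih with sat wp (suc n) gs (merge 0 (u ∸ p₀ ∸ (i + k)) (drop k (z ∷ drop i wp)) T)
      ...   | true  = refl
      ...   | false = ih

  -- Taking for each gap the period of its actual square is a consistent choice, so no prefix of an
  -- extremal word is rejected.
  sat-true : ∀ {gs T} → All (Pending w n) gs → Fits w n T → sat wp (suc n) gs T ≡ true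
  sat-true []         fit = refl
  sat-true {gap i z E cs ∷ gs} (g ∷ gs✓) fit =
    try₁-true pos≤ pos≤len sq s≤pos (sat-true gs✓) at refl t≤
      (trans (+-comm (i + (suc n ∸ i)) 1) (cong suc (m+[n∸m]≡n (m≤n⇒m≤1+n pos≤)))) fit
    where open Pending g

data Outcome : Set where
  dead : Outcome
  live : List Gap → Outcome

module _ (w : Word Γ) where

  Possible : ℕ → Outcome → Set
  Possible n dead      = ⊥
  Possible n (live gs) = All (Pending w n) gs

enqueue : ℕ → ℕ → Γ → List Γ → Cells → Outcome → Outcome
enqueue m i z E nil r         = dead
enqueue m i z E cs  dead      = dead
enqueue m i z E cs  (live gs) = if covered m cs then live gs else live (gap i z E cs ∷ gs)

enqueue-possible : ∀ {w n i z E cs r after s q t} → i ≤ n → i ≤ length w →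
  insert i z w ≡ E ʳ++ after → length E ≡ suc n → Square (insert i z w) s (suc q) → s ≤ i →
  At cs q t → t ≤ s + (suc q + suc q) → Possible w n r → Possible w n (enqueue (suc n) i z E cs r)
enqueue-possible {cs = nil}   {live gs} _ _ _ _ _ _ () _ _
enqueue-possible {n = n} {cs = skip cs} {live gs} a b c d e f at t≤ ps with covered (suc n) (skip cs) in eq
... | true  = ps
... | false = pending a b c d e f (<-≤-trans (covered-sound (suc n) eq at) t≤) at t≤ ∷ ps
enqueue-possible {n = n} {cs = cell u cs} {live gs} a b c d e f at t≤ ps with covered (suc n) (cell u cs) in eq
... | true  = ps
... | false = pending a b c d e f (<-≤-trans (covered-sound (suc n) eq at) t≤) at t≤ ∷ ps

-- With ys = drop p xs and t = length xs + p, this is the earliest end of a square of period p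
-- that is still possible in a word whose prefix is xs read backwards.
run : ℕ → List Γ → List Γ → ℕ
run′ : Bool → ℕ → List Γ → List Γ → ℕ
run t xs       []       = t
run t []       (y ∷ ys) = t
run t (x ∷ xs) (y ∷ ys) = run′ (x == y) t xs ys
run′ true  t xs ys = run (t ∸ 1) xs ys
run′ false t xs ys = t

-- Every mismatch at depth `k` bounds `t` by `T + k`. The function `run` subtracts one for each
-- agreement and stops at the first mismatch, or when the earlier part is exhausted and the start
-- can move no further left.
run-≤ : ∀ {t T} xs ys → (∀ {k x y} → xs ! k ≡ just x → ys ! k ≡ just y → x ≢ y → t ≤ T + k) →
        t ≤ T + length ys → length ys ≤ length xs → run t xs ys ≤ T
run-≤ xs [] _ t≤ _ = subst (_ ≤_) (+-identityʳ _) t≤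
run-≤ {t} {T} (x ∷ xs) (y ∷ ys) diff t≤ (s≤s len) with x == y in eq
... | true  = run-≤ xs ys
                (λ {k} hx hy x≢y → ∸-monoˡ-≤ 1 (subst (t ≤_) (+-suc T k) (diff {suc k} hx hy x≢y)))
                (∸-monoˡ-≤ 1 (subst (t ≤_) (+-suc T (length ys)) t≤)) len
... | false = subst (t ≤_) (+-identityʳ T) (diff {0} refl refl (≢⇒== eq))

drop-[] : ∀ p (E : List Γ) → drop p E ≡ [] → drop (suc p) E ≡ []
drop-[] p       []      _ = refl
drop-[] (suc p) (x ∷ E) h = drop-[] p E h

drop-[]-≥ : ∀ p (E : List Γ) → drop p E ≡ [] → length E ≤ p
drop-[]-≥ p       []      _ = z≤n
drop-[]-≥ (suc p) (x ∷ E) h = s≤s (drop-[]-≥ p E h)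

drop-∷-< : ∀ p (E : List Γ) {y d} → drop p E ≡ y ∷ d → p < length E
drop-∷-< zero    (x ∷ E) _ = s≤s z≤n
drop-∷-< (suc p) (x ∷ E) h = s≤s (drop-∷-< p E h)

module Limit (B : ℕ) where

  -- Here the letter compared lies before the gap. A mismatch does not refute the period but moves
  -- the start behind that letter, which raises the bound to `u`; beyond `suc B`, the greatest
  -- length after an insertion, the period dies.
  upd₀ : Γ → ℕ → List Γ → Cells → Cells
  hit₀ : Bool → Γ → ℕ → ℕ → List Γ → Cells → Cells
  miss₀ : Bool → Γ → ℕ → List Γ → Cells → Cells
  upd₀ l u []      cs          = cs
  upd₀ l u (x ∷ E) nil         = nil
  upd₀ l u (x ∷ E) (skip cs)   = skip⁺ (upd₀ l (suc u) E cs)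
  upd₀ l u (x ∷ E) (cell t cs) = hit₀ (x == l) l u t E cs
  hit₀ true  l u t E cs = cell t (upd₀ l (suc u) E cs)
  hit₀ false l u t E cs = miss₀ (suc B <ᵇ u) l u E cs
  miss₀ true  l u E cs = skip⁺ (upd₀ l (suc u) E cs)
  miss₀ false l u E cs = cell u (upd₀ l (suc u) E cs)

  -- The first `k` periods compare `l` with the inserted letter or one behind it. A mismatch there
  -- would make the square start to the right of the gap, so it refutes the period outright.
  upd : Γ → ℕ → ℕ → List Γ → Cells → Cells
  hit : Bool → Γ → ℕ → ℕ → ℕ → List Γ → Cells → Cells
  upd l zero    u E       cs          = upd₀ l u E cs
  upd l (suc k) u []      cs          = cs
  upd l (suc k) u (x ∷ E) nil         = nil
  upd l (suc k) u (x ∷ E) (skip cs)   = skip⁺ (upd l k (suc u) E cs)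
  upd l (suc k) u (x ∷ E) (cell t cs) = hit (x == l) l k u t E cs
  hit true  l k u t E cs = cell t (upd l k (suc u) E cs)
  hit false l k u t E cs = skip⁺ (upd l k (suc u) E cs)

  -- When `d` has run out, the prefix is too short for a comparison at distance `p`. All that is
  -- known then is that the start is at least 0, so the end is at least `p + p`.
  fresh : ℕ → ℕ → ℕ → List Γ → List Γ → Cells
  fresh₁ : ℕ → ℕ → ℕ → ℕ → List Γ → List Γ → Cells
  fresh₂ : Bool → ℕ → ℕ → ℕ → ℕ → List Γ → List Γ → Cells
  fresh zero    p t E d       = nil
  fresh (suc f) p t E []      = cell (p + p) (fresh f (suc p) (suc t) E [])
  fresh (suc f) p t E (y ∷ d) = fresh₁ f p t (run t E (y ∷ d)) E d
  fresh₁ f p t r E d = fresh₂ (suc B <ᵇ r) f p t r E d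
  fresh₂ true  f p t r E d = skip⁺ (fresh f (suc p) (suc t) E d)
  fresh₂ false f p t r E d = cell r (fresh f (suc p) (suc t) E d)

  module _ {T : ℕ} (T≤ : T ≤ suc B) where

    upd₀-At : ∀ {l u E cs q t} → At cs q t → t ≤ T →
              (∀ {x} → E ! q ≡ just x → x ≢ l → u + q ≤ T) →
              ∃[ t′ ] At (upd₀ l u E cs) q t′ × t′ ≤ T
    upd₀-At {E = []} at t≤ _ = _ , at , t≤
    upd₀-At {l} {u} {x ∷ E} {cell t cs} here t≤ bound with x == l in eq
    ... | true  = t , here , t≤
    ... | false with u≤ ← subst (_≤ T) (+-identityʳ u) (bound refl (≢⇒== eq)) | suc B <ᵇ u in eq′
    ...   | true  = contradiction (≤-trans u≤ T≤) (<⇒≱ (<ᵇ-true⇒< (suc B) u eq′))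
    ...   | false = u , here , u≤
    upd₀-At {u = u} {x ∷ E} (skip {q = q} at) t≤ bound
      with t′ , at′ , t′≤ ← upd₀-At {u = suc u} {E} at t≤ (λ h x≢l → subst (_≤ T) (+-suc u q) (bound h x≢l)) =
      t′ , skip⁺-At at′ , t′≤
    upd₀-At {l} {u} {x ∷ E} (there {q = q} at) t≤ bound
      with t′ , at′ , t′≤ ← upd₀-At {u = suc u} {E} at t≤ (λ h x≢l → subst (_≤ T) (+-suc u q) (bound h x≢l)) | x == l
    ... | true  = t′ , there at′ , t′≤
    ... | false with suc B <ᵇ u
    ...   | true  = t′ , skip⁺-At at′ , t′≤
    ...   | false = t′ , there at′ , t′≤

    upd-At : ∀ {l k u E cs q t} → At cs q t → t ≤ T →
             (∀ {x} → E ! q ≡ just x → x ≢ l → k ≤ q × u + q ≤ T) →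
             ∃[ t′ ] At (upd l k u E cs) q t′ × t′ ≤ T
    upd-At {k = zero} {E = E} at t≤ bound = upd₀-At {E = E} at t≤ λ h x≢l → proj₂ (bound h x≢l)
    upd-At {k = suc k} {E = []} at t≤ _ = _ , at , t≤
    upd-At {l} {suc k} {u} {x ∷ E} {cell t cs} here t≤ bound with x == l in eq
    ... | true  = t , here , t≤
    ... | false with () ← proj₁ (bound refl (≢⇒== eq))
    upd-At {k = suc k} {u} {x ∷ E} (skip {q = q} at) t≤ bound
      with t′ , at′ , t′≤ ← upd-At {k = k} {suc u} {E} at t≤ (λ h x≢l → let a , b = bound h x≢l in ≤-pred a , subst (_≤ T) (+-suc u q) b) =
      t′ , skip⁺-At at′ , t′≤
    upd-At {l} {suc k} {u} {x ∷ E} (there {q = q} at) t≤ bound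
      with t′ , at′ , t′≤ ← upd-At {k = k} {suc u} {E} at t≤ (λ h x≢l → let a , b = bound h x≢l in ≤-pred a , subst (_≤ T) (+-suc u q) b) | x == l
    ... | true  = t′ , there at′ , t′≤
    ... | false = t′ , skip⁺-At at′ , t′≤

    fresh-At : ∀ f {p t E} d q → d ≡ drop p E → q < f →
               (length E ≤ p + q → (p + q) + (p + q) ≤ T) →
               (p + q < length E → run (t + q) E (drop (p + q) E) ≤ T) →
               ∃[ t′ ] At (fresh f p t E d) q t′ × t′ ≤ T
    fresh-At (suc f) {p} {t} {E} [] zero eq _ long _ =
      p + p , here , subst (λ n → n + n ≤ T) (+-identityʳ p) (long (subst (length E ≤_) (sym (+-identityʳ p)) (drop-[]-≥ p E (sym eq))))
    fresh-At (suc f) {p} {t} {E} [] (suc q) eq (s≤s q<f) long short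
      with t′ , at′ , t′≤ ← fresh-At f {suc p} {suc t} {E} [] q (sym (drop-[] p E (sym eq))) q<f
             (λ h → subst (λ n → n + n ≤ T) (+-suc p q) (long (subst (length E ≤_) (sym (+-suc p q)) h)))
             (λ h → subst₂ (λ a b → run a E (drop b E) ≤ T) (+-suc t q) (+-suc p q) (short (subst (_< length E) (sym (+-suc p q)) h))) =
      t′ , there at′ , t′≤
    fresh-At (suc f) {p} {t} {E} (y ∷ d) zero eq _ _ short
      with r≤ ← subst (_≤ T) (cong₂ (λ a b → run a E b) (+-identityʳ t) (trans (cong (λ n → drop n E) (+-identityʳ p)) (sym eq)))
                  (short (subst (_< length E) (sym (+-identityʳ p)) (drop-∷-< p E (sym eq))))
         | suc B <ᵇ run t E (y ∷ d) in eq′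
    ... | true  = contradiction (≤-trans r≤ T≤) (<⇒≱ (<ᵇ-true⇒< (suc B) _ eq′))
    ... | false = _ , here , r≤
    fresh-At (suc f) {p} {t} {E} (y ∷ d) (suc q) eq (s≤s q<f) long short
      with t′ , at′ , t′≤ ← fresh-At f {suc p} {suc t} {E} d q (drop-∷ p E (sym eq)) q<f
             (λ h → subst (λ n → n + n ≤ T) (+-suc p q) (long (subst (length E ≤_) (sym (+-suc p q)) h)))
             (λ h → subst₂ (λ a b → run a E (drop b E) ≤ T) (+-suc t q) (+-suc p q) (short (subst (_< length E) (sym (+-suc p q)) h)))
         | suc B <ᵇ run t E (y ∷ d)
    ... | true  = t′ , skip⁺-At at′ , t′≤
    ... | false = t′ , there at′ , t′≤

every : (Γ → Bool) → Bool
every f = f 𝕒 ∧ f 𝕓 ∧ f 𝕔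

every-true : ∀ f → every f ≡ true → ∀ x → f x ≡ true
every-true f h x with f 𝕒 in eqa | f 𝕓 in eqb | f 𝕔 in eqc
every-true f h 𝕒 | true | true | true = eqa
every-true f h 𝕓 | true | true | true = eqb
every-true f h 𝕔 | true | true | true = eqc

lengths : List ℕ
lengths = 25 ∷ 41 ∷ 48 ∷ 50 ∷ 63 ∷ 71 ∷ 72 ∷ 77 ∷ 79 ∷ 81 ∷ 83 ∷ 84 ∷ 85 ∷ []

allowed : ℕ → Bool
allowed n = isYes (any? (n ≟_) lengths)

module Exhaust (B : ℕ) where

  open Limit B

  update : Γ → ℕ → List Gap → Outcome → Outcome
  update l m []                  r = r
  update l m (gap i z E cs ∷ gs) r =
    -- The letter `l` has position `m` in the extended word. A mismatch at distance `q + 1` gives a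
    -- start of at least `m ∸ q`, hence an end of at least `2 + m + q`.
    enqueue (suc m) i z (l ∷ E) (upd l (m ∸ i) (2 + m) E cs) (update l m gs r)

  -- A square ending right after the inserted letter z is invisible to fresh, which looks at the
  -- end of E, so it is tested separately.
  create : Bool → ℕ → Γ → List Γ → List Γ → Outcome → Outcome
  create true  n z v E r = r
  create false n z v E r = enqueue (2 + n) n z E (skip⁺ (fresh ⌊ B ∸ 1 /2⌋ 2 (4 + n) E v)) r

  insertable : ℕ → Γ → List Γ → Γ → Bool
  insertable n l v z = if z == l then false else not (endsWithSquare (suc n) (z ∷ v))

  -- Judges the case that the word ends here. The squares of open gaps would have to go on, so with
  -- an open gap the word is not extremal. If there is none, only the gap after the last letter
  -- remains, and a letter that can be inserted there also excludes extremality.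
  stop : ℕ → Γ → List Γ → List Gap → Bool
  stop n l v (_ ∷ _) = true
  stop n l v []      = allowed n ∨ insertable n l v 𝕒 ∨ insertable n l v 𝕓 ∨ insertable n l v 𝕔

  -- The costly test sat is made at every other letter only.
  even : ℕ → Bool
  even zero          = true
  even (suc zero)    = false
  even (suc (suc n)) = even n

  search : ℕ → ℕ → Γ → List Γ → List Gap → Bool
  child : Bool → ℕ → ℕ → Γ → Γ → List Γ → List Gap → Bool
  child₁ : Bool → ℕ → ℕ → Γ → Γ → List Γ → List Gap → Bool
  child₂ : Bool → ℕ → ℕ → Γ → List Γ → Outcome → Bool
  search zero    n l v gs = stop n l v gs
  search (suc f) n l v gs =
    stop n l v gs ∧ every λ x → child (l == x) f n x l v gs
  child true  f n x l v gs = true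
  child false f n x l v gs = child₁ (endsWithSquare (suc n) (x ∷ v)) f n x (third l x) v gs
  child₁ true  f n x z v gs = true
  child₁ false f n x z v gs =
    child₂ (even n) f n x v
      (update x (suc n) gs (create (endsWithSquare (suc n) (z ∷ v)) n z v (x ∷ z ∷ v) (live [])))
  child₂ _     f n x v dead      = true
  child₂ false f n x v (live gs) = search f (suc n) x (x ∷ v) gs
  child₂ true  f n x v (live gs) =
    if sat (reverse (x ∷ v)) (2 + n) gs [] then search f (suc n) x (x ∷ v) gs else true

  launch : Outcome → Bool
  launch dead      = true
  launch (live gs) = child false (B ∸ 2) 1 𝕓 𝕒 (𝕒 ∷ []) gs

  start : Bool
  start = launch (create (endsWithSquare 1 (𝕓 ∷ [])) 0 𝕓 [] (𝕒 ∷ 𝕓 ∷ [])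
                (create (endsWithSquare 1 (𝕔 ∷ [])) 0 𝕔 [] (𝕒 ∷ 𝕔 ∷ []) (live [])))

  -- The record keeps the equation out of sight: comparing two such types compares `B` and does not
  -- evaluate the search.
  record Exhausted : Set where
    field holds : start ≡ true

-- Soundness of the search

stable : ∀ {b} → ¬ ¬ (b ≡ true) → b ≡ true
stable {true}  _ = refl
stable {false} h = contradiction (λ ()) h

+-shuffle₁ : ∀ j q → 2 + (suc j + q) + q ≡ suc j + (suc q + suc q)
+-shuffle₁ = solve-∀

+-shuffle₂ : ∀ p k j → suc (p + k + j) + p ≡ suc j + (p + p) + k
+-shuffle₂ = solve-∀

+-shuffle₃ : ∀ p k j → 1 + (k + (j + p)) ≡ 1 + (p + k + j)
+-shuffle₃ = solve-∀

+-shuffle₄ : ∀ n q → 4 + n + q ≡ 2 + n + (2 + q)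
+-shuffle₄ = solve-∀

+-shuffle₅ : ∀ q → (2 + q) + (2 + q) ≡ 2 + (suc q + suc q)
+-shuffle₅ = solve-∀

module _ {A : Set} where

  -- The source of all bounds on the start: if the right letter of a mismatch lies before the end of
  -- the square, the left one cannot belong to the first half, so the square begins later.
  mismatch-< : ∀ {e : Word A} {s p j} → Square e s p → e ! j ≢ e ! (j + p) → j + p < s + (p + p) → j < s
  mismatch-< {e} {s} {p} {j} sq ne j< = ≰⇒> λ s≤j →
    ne (repeats sq s≤j (+-cancelʳ-< p j (s + p) (subst (j + p <_) (sym (+-assoc s p p)) j<)))

  square-prefix : ∀ {u v : Word A} {s p} → Square (u ++ v) s p → s + (p + p) ≤ length u → Square u s p
  square-prefix {u} {v} {s} {p} (square p≥1 _ rep) fit = square p≥1 fit λ {j} s≤j j< →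
    let j+p< : j + p < length u
        j+p< = <-≤-trans (+-monoˡ-< p j<) (≤-trans (≤-reflexive (+-assoc s p p)) fit)
    in trans (sym (!-++ˡ u (≤-<-trans (m≤m+n j p) j+p<))) (trans (rep s≤j j<) (!-++ˡ u j+p<))

module Soundness (B : ℕ) {w : Word Γ} (w≤B : length w ≤ B) where

  open Limit B
  open Exhaust B

  fits-B : ∀ {i z s p} → Square (insert i z w) s p → s + (p + p) ≤ suc B
  fits-B {i} {z} sq = ≤-trans (fits sq) (≤-trans (≤-reflexive (length-insert i z w)) (s≤s w≤B))

  update-possible : ∀ {n x gs r} → w ! n ≡ just x → All (Pending w n) gs →
                    Possible w (suc n) r → Possible w (suc n) (update x (suc n) gs r)
  update-possible eq [] ps = ps
  update-possible {n} {x} {gap i z E cs ∷ gs} eq (pending {after} {s} {q} {t} i≤n i≤w split len sq s≤i open′ at t≤ ∷ gs✓) ps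
    = enqueue-possible (m≤n⇒m≤1+n i≤n) i≤w (split′ after split after!) (cong suc len) sq s≤i
        (proj₁ (proj₂ updated)) (proj₂ (proj₂ updated)) (update-possible eq gs✓ ps)
    where
    e : Word Γ
    e = insert i z w
    e!m : e ! suc n ≡ just x
    e!m = trans (insert-!-> w i≤n) eq
    after! : after ! 0 ≡ just x
    after! = begin
      after ! 0                      ≡⟨ !-ʳ++ʳ E 0 ⟨
      (E ʳ++ after) ! (length E + 0) ≡⟨ cong₂ _!_ (sym split) (trans (+-identityʳ _) len) ⟩
      e ! suc n                      ≡⟨ e!m ⟩
      just x                         ∎
      where open ≡-Reasoning
    split′ : ∀ after → e ≡ E ʳ++ after → after ! 0 ≡ just x → e ≡ (x ∷ E) ʳ++ drop 1 after
    split′ (_ ∷ _) eq refl = eq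
    -- A mismatch with the new letter puts the start strictly behind the left letter `j`. Together
    -- with `s ≤ i` this gives the first bound, and adding twice the period to the start gives the
    -- second.
    bound : ∀ {y} → E ! q ≡ just y → y ≢ x → suc n ∸ i ≤ q × 3 + n + q ≤ s + (suc q + suc q)
    bound {y} hy y≢x with j , q+j ← m≤n⇒∃[o]m+o≡n (subst (q <_) len (!-< E hy)) =
      m≤n+o⇒m∸n≤o (suc n) i (≤-trans (≤-reflexive (sym m≡)) (+-monoˡ-≤ q (≤-trans j<s s≤i))) ,
      (begin
        3 + n + q              ≡⟨ cong (λ m → 2 + m + q) (sym m≡) ⟩
        2 + (suc j + q) + q    ≡⟨ +-shuffle₁ j q ⟩
        suc j + (suc q + suc q) ≤⟨ +-monoˡ-≤ (suc q + suc q) j<s ⟩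
        s + (suc q + suc q)    ∎)
      where
      open ≤-Reasoning
      m≡ : suc j + q ≡ suc n
      m≡ = trans (cong suc (+-comm j q)) q+j
      m≡′ : j + suc q ≡ suc n
      m≡′ = trans (+-suc j q) m≡
      e!j : e ! j ≡ just y
      e!j = trans (cong (_! j) split) (trans (!-ʳ++ˡ E (trans q+j (sym len))) hy)
      j<s : j < s
      j<s = mismatch-< sq
        (λ h → y≢x (just-injective (trans (sym e!j) (trans h (trans (cong (e !_) m≡′) e!m)))))
        (subst (_< s + (suc q + suc q)) (sym m≡′) open′)
    updated : ∃[ t′ ] At (upd x (suc n ∸ i) (3 + n) E cs) q t′ × t′ ≤ s + (suc q + suc q)
    updated = upd-At (fits-B sq) at t≤ bound

  create-possible : ∀ {v x z r s p o} → z ≢ x → w ≡ (x ∷ v) ʳ++ r →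
                    Square (insert (length v) z w) s p → s ≤ length v → length v < s + (p + p) →
                    Possible w (suc (length v)) o →
                    Possible w (suc (length v)) (create (endsWithSquare (suc (length v)) (z ∷ v)) (length v) z v (x ∷ z ∷ v) o)
  create-possible {v} {x} {z} {r} {s} {p} z≢x w≡ sq s≤n n< ps
    with endsWithSquare (suc (length v)) (z ∷ v) in ends
  ... | true  = ps
  ... | false = go p sq (≤∧≢⇒< n< not-at-z)
    where
    n : ℕ
    n = length v
    E : List Γ
    E = x ∷ z ∷ v
    e : Word Γ
    e = insert n z w
    split : e ≡ E ʳ++ r
    split = trans (cong₂ (λ i u → insert i z u) (sym (+-identityʳ n)) w≡) (insert-ʳ++ v 0 z)
    -- The test for a square ending right after `z` was negative, so the square also contains `x`,
    -- and every mismatch within `E` counts.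
    not-at-z : suc n ≢ s + (p + p)
    not-at-z eq with () ← trans (sym ends)
      (endsWithSquare-complete (z ∷ v) (sym eq)
        (square-prefix {v = x ∷ r}
          (subst (λ u → Square u s p) (trans split (trans (ʳ++-defn (z ∷ v)) (cong (_++ (x ∷ r)) (sym (trans (ʳ++-defn (z ∷ v)) (++-identityʳ _)))))) sq)
          (≤-reflexive (trans (sym eq) (sym (trans (length-ʳ++ (z ∷ v)) (+-identityʳ _)))))))
    go : ∀ p → Square e s p → suc n < s + (p + p) →
         Possible w (suc n) (enqueue (2 + n) n z E (skip⁺ (fresh ⌊ B ∸ 1 /2⌋ 2 (4 + n) E v)) _)
    go zero (square () _ _) _
    -- With period 1 and an end beyond `z`, the square can only be `z` followed by `x`, and these
    -- letters differ.
    go (suc zero) sq lt = contradiction (just-injective (begin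
        just z      ≡⟨ insert-!-≡ w n≤w ⟨
        e ! n       ≡⟨ repeats sq s≤n (subst (n <_) (+-comm 1 s) (s≤s n≤s)) ⟩
        e ! (n + 1) ≡⟨ cong (e !_) (+-comm n 1) ⟩
        e ! suc n   ≡⟨ trans (cong₂ _!_ split (sym (+-identityʳ (suc n)))) (!-ʳ++ʳ (z ∷ v) {x ∷ r} 0) ⟩
        just x      ∎)) z≢x
      where
      open ≡-Reasoning
      n≤s : n ≤ s
      n≤s = ≤-pred (≤-pred (subst (suc (suc n) ≤_) (+-comm s 2) lt))
      n≤w : n ≤ length w
      n≤w = ≤-trans (m≤m+n n _) (≤-trans (n≤1+n _) (≤-reflexive (sym (trans (cong length w≡) (length-ʳ++ (x ∷ v) {r})))))
    go (suc (suc q)) sq lt =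
      enqueue-possible (n≤1+n n) n≤w split refl sq s≤n (skip⁺-At (proj₁ (proj₂ found))) (proj₂ (proj₂ found)) ps
      where
      p′ : ℕ
      p′ = 2 + q
      n≤w : n ≤ length w
      n≤w = ≤-trans (m≤m+n n _) (≤-trans (n≤1+n _) (≤-reflexive (sym (trans (cong length w≡) (length-ʳ++ (x ∷ v) {r})))))
      -- Twice the period is at most `suc B`, the greatest length of the extended word; counting the
      -- periods from 2 leaves `⌊ B ∸ 1 /2⌋` candidates.
      q<f : q < ⌊ B ∸ 1 /2⌋
      q<f = n+n≤m⇒n≤⌊m/2⌋ (suc q) (begin
        suc q + suc q    ≡⟨ cong (_∸ 2) (+-shuffle₅ q) ⟨
        p′ + p′ ∸ 2      ≤⟨ ∸-monoˡ-≤ 2 (≤-trans (m≤n+m (p′ + p′) s) (fits-B sq)) ⟩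
        B ∸ 1            ∎)
        where
        open ≤-Reasoning
      long : length E ≤ p′ → p′ + p′ ≤ s + (p′ + p′)
      long _ = m≤n+m (p′ + p′) s
      short : p′ < length E → run (4 + n + q) E (drop p′ E) ≤ s + (p′ + p′)
      short p<E = run-≤ E (drop p′ E) diff end (≤-trans (≤-reflexive (length-drop p′ E)) (m∸n≤m (length E) p′))
        where
        open ≤-Reasoning
        end : 4 + n + q ≤ s + (p′ + p′) + length (drop p′ E)
        end = begin
          4 + n + q                             ≡⟨ +-shuffle₄ n q ⟩
          2 + n + p′                            ≤⟨ +-monoˡ-≤ p′ (m≤n+m∸n (2 + n) p′) ⟩
          p′ + (2 + n ∸ p′) + p′                ≡⟨ trans (+-assoc p′ _ p′) (trans (cong (p′ +_) (+-comm _ p′)) (sym (+-assoc p′ p′ _))) ⟩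
          p′ + p′ + (2 + n ∸ p′)                ≤⟨ +-monoˡ-≤ _ (m≤n+m (p′ + p′) s) ⟩
          s + (p′ + p′) + (2 + n ∸ p′)          ≡⟨ cong (s + (p′ + p′) +_) (sym (length-drop p′ E)) ⟩
          s + (p′ + p′) + length (drop p′ E)    ∎
        diff : ∀ {k a b} → E ! k ≡ just a → drop p′ E ! k ≡ just b → a ≢ b → 4 + n + q ≤ s + (p′ + p′) + k
        diff {k} {a} {b} ha hb a≢b
          with hb′ ← trans (sym (!-drop p′ E k)) hb
          with j , eqj ← m≤n⇒∃[o]m+o≡n (!-< E hb′) = begin
            4 + n + q                    ≡⟨ trans (+-shuffle₄ n q) (cong (_+ p′) (sym eqj)) ⟩
            suc (p′ + k + j) + p′        ≡⟨ +-shuffle₂ p′ k j ⟩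
            suc j + (p′ + p′) + k        ≤⟨ +-monoˡ-≤ k (+-monoˡ-≤ (p′ + p′) j<s) ⟩
            s + (p′ + p′) + k            ∎
          where
          e!j : e ! j ≡ just b
          e!j = trans (cong (_! j) split) (trans (!-ʳ++ˡ E {i = p′ + k} eqj) hb′)
          e!j+p : e ! (j + p′) ≡ just a
          e!j+p = trans (cong (_! (j + p′)) split) (trans (!-ʳ++ˡ E {i = k} (trans (+-shuffle₃ p′ k j) eqj)) ha)
          j<s : j < s
          j<s = mismatch-< sq
            (λ h → a≢b (just-injective (trans (sym e!j+p) (trans (sym h) e!j))))
            (≤-trans (≤-trans (s≤s (m≤n+m (j + p′) k)) (≤-reflexive (trans (+-shuffle₃ p′ k j) eqj))) lt)
      found : ∃[ t ] At (fresh ⌊ B ∸ 1 /2⌋ 2 (4 + n) E v) q t × t ≤ s + (p′ + p′)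
      found = fresh-At (fits-B sq) ⌊ B ∸ 1 /2⌋ v q refl q<f long short

third-≢ : ∀ l x → (l == x) ≡ false → third l x ≢ x
third-≢ 𝕒 𝕓 _ ()
third-≢ 𝕒 𝕔 _ ()
third-≢ 𝕓 𝕒 _ ()
third-≢ 𝕓 𝕔 _ ()
third-≢ 𝕔 𝕒 _ ()
third-≢ 𝕔 𝕓 _ ()
third-≢ 𝕔 𝕔 ()

module Complete (B : ℕ) {w : Word Γ} (w≤B : length w ≤ B) (sf : SquareFree w) (ext : AllCovered w) where

  open Exhaust B
  open Soundness B {w} w≤B

  ¬insertable : ∀ {l v} z → w ≡ v ʳ++ [] → insertable (length v) l v z ≡ false
  ¬insertable {l} {v} z w≡ with z == l | endsWithSquare (suc (length v)) (z ∷ v) in ends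
  ... | true  | _     = refl
  ... | false | true  = refl
  ... | false | false = ⊥-elim (ext z n≤w uncovered)
    where
    len : length w ≡ length v
    len = trans (cong length w≡) (trans (length-ʳ++ v) (+-identityʳ _))
    n≤w : length v ≤ length w
    n≤w = ≤-reflexive (sym len)
    split : insert (length v) z w ≡ (z ∷ v) ʳ++ []
    split = trans (cong₂ (λ i u → insert i z u) (sym (+-identityʳ (length v))) w≡) (insert-ʳ++ v 0 z)
    uncovered : ¬ Covered w (length v) z
    uncovered (s , p , sq , _ , n<) with () ← trans (sym ends) (endsWithSquare-complete (z ∷ v)
      (≤-antisym (≤-trans (fits sq) (≤-reflexive (trans (length-insert (length v) z w) (cong suc len)))) n<)
      (subst (λ u → Square u s p) split sq))

  stop-sound : ∀ {l v gs} → stop (length v) l v gs ≡ true → w ≡ v ʳ++ [] → All (Pending w (length v)) gs →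
               allowed (length v) ≡ true
  stop-sound {v = v} {g ∷ gs} _ w≡ (pd ∷ _) = contradiction (Pending.open′ pd)
    (≤⇒≯ (≤-trans (fits (Pending.sq pd)) (≤-reflexive (trans (length-insert (Gap.pos g) (Gap.letter g) w)
      (cong suc (trans (cong length w≡) (trans (length-ʳ++ v) (+-identityʳ _))))))))
  stop-sound {l} {v} {[]} h w≡ [] with allowed (length v)
  ... | true  = refl
  ... | false with () ← trans (sym h) (cong₂ _∨_ (¬insertable {l} {v} 𝕒 w≡) (cong₂ _∨_ (¬insertable {l} {v} 𝕓 w≡) (¬insertable {l} {v} 𝕔 w≡)))

  prefix-agrees : ∀ v {r} → w ≡ v ʳ++ r → ∀ {k y} → reverse v ! k ≡ just y → w ! k ≡ just y
  prefix-agrees v w≡ h = trans (cong (_! _) (trans w≡ (ʳ++-defn v))) (trans (!-++ˡ (reverse v) (!-< (reverse v) h)) h)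

  search-sound : ∀ f {l v gs r} → search f (suc (length v)) l (l ∷ v) gs ≡ true → w ≡ (l ∷ v) ʳ++ r →
                 suc (length v) + f ≡ B → All (Pending w (suc (length v))) gs → allowed (length w) ≡ true
  child-sound : ∀ f {l v gs x r} → child (l == x) f (suc (length v)) x l (l ∷ v) gs ≡ true →
                w ≡ (x ∷ l ∷ v) ʳ++ r → suc (length v) + suc f ≡ B → All (Pending w (suc (length v))) gs →
                allowed (length w) ≡ true
  child₂-sound : ∀ b f {l v x r o} → child₂ b f (suc (length v)) x (l ∷ v) o ≡ true →
                 w ≡ (x ∷ l ∷ v) ʳ++ r → suc (length v) + suc f ≡ B → Possible w (suc (suc (length v))) o →
                 allowed (length w) ≡ true

  search-sound zero {l} {v} {gs} {r = []} h w≡ f≡ gs✓ =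
    trans (cong allowed (trans (cong length w≡) (trans (length-ʳ++ (l ∷ v)) (+-identityʳ _)))) (stop-sound {l} {l ∷ v} {gs} h w≡ gs✓)
  search-sound zero {l} {v} {r = x ∷ r} h w≡ f≡ gs✓ = contradiction
    (begin-strict
      length w                          ≤⟨ w≤B ⟩
      B                                 ≡⟨ f≡ ⟨
      suc (length v) + 0                <⟨ +-monoʳ-< (suc (length v)) (s≤s (z≤n {length r})) ⟩
      suc (length v) + suc (length r)   ≡⟨ trans (cong length w≡) (length-ʳ++ (l ∷ v)) ⟨
      length w                          ∎) (<-irrefl refl)
    where open ≤-Reasoning
  search-sound (suc f) {l} {v} {gs} {r = []} h w≡ f≡ gs✓ =
    trans (cong allowed (trans (cong length w≡) (trans (length-ʳ++ (l ∷ v)) (+-identityʳ _))))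
      (stop-sound {l} {l ∷ v} {gs} (∧-conicalˡ (stop _ l (l ∷ v) gs) _ h) w≡ gs✓)
  search-sound (suc f) {l} {v} {gs} {x ∷ r} h w≡ f≡ gs✓ =
    child-sound f {l} {v} {gs} {x} {r}
      (every-true (λ x → child (l == x) f (suc (length v)) x l (l ∷ v) gs) (∧-conicalʳ (stop (suc (length v)) l (l ∷ v) gs) _ h) x) w≡ f≡ gs✓

  child-sound f {l} {v} {gs} {x} {r} h w≡ f≡ gs✓ with l == x in eq
  ... | true with refl ← ==⇒≡ l x eq =
    contradiction (reverse v , l ∷ [] , r , (λ ()) , trans w≡ (ʳ++-defn v)) sf
  ... | false with endsWithSquare (suc (suc (length v))) (x ∷ l ∷ v) in ends
  ...   | true  with s , p , sq ← endsWithSquare-sound (x ∷ l ∷ v) {r} (suc (suc (length v))) ends =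
    contradiction (subst (λ u → Square u s p) (sym w≡) sq) (squareFree⇒¬square sf)
  -- The square through the new gap is only known not to be absent; the Boolean goal allows it to be
  -- used.
  ...   | false = stable λ ¬done → ext z n≤w λ (s , p , sq , s≤n , n<) → ¬done
          (child₂-sound (even (suc (length v))) f {l} {v} {x} {r} h w≡ f≡
            (update-possible {gs = gs} w!n gs✓ (create-possible {l ∷ v} {x} {z} {r} (third-≢ l x eq) w≡ sq s≤n n< [])))
    where
    z : Γ
    z = third l x
    n≤w : suc (length v) ≤ length w
    n≤w = ≤-trans (≤-trans (m≤m+n (suc (length v)) (length r)) (n≤1+n _)) (≤-reflexive (sym (trans (cong length w≡) (length-ʳ++ (x ∷ l ∷ v)))))
    w!n : w ! suc (length v) ≡ just x
    w!n = trans (cong₂ _!_ w≡ (sym (+-identityʳ _))) (!-ʳ++ʳ (l ∷ v) {x ∷ r} 0)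

  child₂-sound b f {o = dead} h w≡ f≡ ()
  child₂-sound false f {l} {v} {x} {r} {live gs} h w≡ f≡ gs✓ =
    search-sound f {x} {l ∷ v} {gs} {r} h w≡ (trans (sym (+-suc (suc (length v)) f)) f≡) gs✓
  child₂-sound true f {l} {v} {x} {r} {live gs} h w≡ f≡ gs✓
    = search-sound f {x} {l ∷ v} {gs} {r} searched w≡ (trans (sym (+-suc (suc (length v)) f)) f≡) gs✓
    where
    searched : search f (suc (suc (length v))) x (x ∷ l ∷ v) gs ≡ true
    searched = subst (λ b → (if b then search f (suc (suc (length v))) x (x ∷ l ∷ v) gs else true) ≡ true)
      (sat-true {w} {suc (suc (length v))} {reverse (x ∷ l ∷ v)} (prefix-agrees (x ∷ l ∷ v) w≡) {gs} {[]} gs✓ (λ ())) h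

-- Renaming letters, and necessity up to a length bound

module _ {A B : Set} (f : A → B) where

  !-map : ∀ xs k → map f xs ! k ≡ Maybe.map f (xs ! k)
  !-map []       k       = refl
  !-map (x ∷ xs) zero    = refl
  !-map (x ∷ xs) (suc k) = !-map xs k

  square-map : ∀ {w s p} → Square w s p → Square (map f w) s p
  square-map {w} (square p≥1 fit rep) = square p≥1 (≤-trans fit (≤-reflexive (sym (length-map f w)))) λ {j} s≤j j< →
    trans (!-map w j) (trans (cong (Maybe.map f) (rep s≤j j<)) (sym (!-map w _)))

  map-insert : ∀ i z w → map f (insert i z w) ≡ insert i (f z) (map f w)
  map-insert zero    z w       = refl
  map-insert (suc i) z []      = refl
  map-insert (suc i) z (x ∷ w) = cong (f x ∷_) (map-insert i z w)

module _ {A B : Set} {f : A → B} {g : B → A} (gf : ∀ x → g (f x) ≡ x) (fg : ∀ x → f (g x) ≡ x) where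

  squareFree-map : ∀ {w} → SquareFree w → SquareFree (map f w)
  squareFree-map {w} sf h with s , p , sq ← hasSquare⇒square h =
    squareFree⇒¬square sf (subst (λ u → Square u s p)
      (trans (sym (map-∘ w)) (trans (map-cong gf w) (map-id w))) (square-map g sq))

  allCovered-map : ∀ {w} → AllCovered w → AllCovered (map f w)
  allCovered-map {w} cov {i} z i≤n ¬c = cov (g z) (≤-trans i≤n (≤-reflexive (length-map f w)))
    λ (s , p , sq , r) → ¬c (s , p , subst (λ u → Square u s p)
      (trans (map-insert f i (g z) w) (cong (λ y → insert i y (map f w)) (fg z))) (square-map f sq) , r)

module _ (x y : Γ) where

  rename : Γ → Γ
  rename z = if z == x then 𝕒 else if z == y then 𝕓 else 𝕔

  rename⁻¹ : Γ → Γ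
  rename⁻¹ 𝕒 = x
  rename⁻¹ 𝕓 = y
  rename⁻¹ 𝕔 = third x y

every₃-true : ∀ (f : Γ → Γ → Γ → Bool) → every (λ x → every λ y → every λ z → f x y z) ≡ true → ∀ x y z → f x y z ≡ true
every₃-true f h x y z =
  every-true (f x y) (every-true (λ y → every (f x y)) (every-true (λ x → every λ y → every (f x y)) h x) y) z

rename-inverseˡ : ∀ x y → (x == y) ≡ false → ∀ z → rename⁻¹ x y (rename x y z) ≡ z
rename-inverseˡ x y x≠y z = ==⇒≡ _ _ (subst (λ b → (b ∨ (rename⁻¹ x y (rename x y z) == z)) ≡ true) x≠y
  (every₃-true (λ x y z → (x == y) ∨ (rename⁻¹ x y (rename x y z) == z)) refl x y z))

rename-inverseʳ : ∀ x y → (x == y) ≡ false → ∀ z → rename x y (rename⁻¹ x y z) ≡ z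
rename-inverseʳ x y x≠y z = ==⇒≡ _ _ (subst (λ b → (b ∨ (rename x y (rename⁻¹ x y z) == z)) ≡ true) x≠y
  (every₃-true (λ x y z → (x == y) ∨ (rename x y (rename⁻¹ x y z) == z)) refl x y z))

module _ (B : ℕ) where

  open Exhaust (2 + B)

  launch-sound : start ≡ true → ∀ {r} → length (𝕒 ∷ 𝕓 ∷ r) ≤ 2 + B → SquareFree (𝕒 ∷ 𝕓 ∷ r) →
                 AllCovered (𝕒 ∷ 𝕓 ∷ r) → allowed (length (𝕒 ∷ 𝕓 ∷ r)) ≡ true
  launch-sound h {r} w≤B sf ext =
    stable λ ¬done → ext {0} 𝕓 z≤n λ (s₁ , p₁ , sq₁ , s₁≤ , <₁) → ext {0} 𝕔 z≤n λ (s₂ , p₂ , sq₂ , s₂≤ , <₂) →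
      ¬done (go _ h
        (create-possible {[]} {𝕒} {𝕓} {𝕓 ∷ r} (λ ()) refl sq₁ s₁≤ <₁
          (create-possible {[]} {𝕒} {𝕔} {𝕓 ∷ r} {o = live []} (λ ()) refl sq₂ s₂≤ <₂ [])))
    where
    open Soundness (2 + B) {𝕒 ∷ 𝕓 ∷ r} w≤B
    go : ∀ o → launch o ≡ true → Possible (𝕒 ∷ 𝕓 ∷ r) 1 o → allowed (length (𝕒 ∷ 𝕓 ∷ r)) ≡ true
    go (live gs) h gs✓ = Complete.child-sound (2 + B) w≤B sf ext B {𝕒} {[]} {gs} {𝕓} {r} h refl refl gs✓

  -- A square-free word of length at least two starts with two distinct letters, which a renaming
  -- turns into `𝕒` and `𝕓`, the only start that is searched. On a shorter word some insertion has
  -- no room for a square: its result is a single letter, or two distinct ones.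
  necessity : Exhausted → ∀ w → ExtremalSquareFree w → length w ≤ 2 + B → allowed (length w) ≡ true
  necessity _ [] ex _ = ⊥-elim (extremal⇒allCovered ex {0} 𝕒 z≤n λ (s , p , sq , _) →
    contradiction (fits sq) (<⇒≱ (≤-trans (+-mono-≤ (positive sq) (positive sq)) (m≤n+m (p + p) s))))
  necessity _ (x ∷ []) ex _ = ⊥-elim (extremal⇒allCovered ex {0} (other x) z≤n λ (s , p , sq , s≤0 , _) → bad s p s≤0 sq)
    where
    other : Γ → Γ
    other 𝕒 = 𝕓
    other _ = 𝕒
    other-≢ : ∀ x → just (other x) ≢ just x
    other-≢ 𝕒 ()
    other-≢ 𝕓 ()
    other-≢ 𝕔 ()
    bad : ∀ s p → s ≤ 0 → ¬ Square (other x ∷ x ∷ []) s p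
    bad zero (suc zero)    z≤n sq = other-≢ x (repeats sq {0} z≤n (s≤s z≤n))
    bad zero (suc (suc p)) z≤n sq with s≤s (s≤s q) ← fits sq = case (subst (_≤ 0) (+-suc p (suc p)) q)
      where
      case : ∀ {n} → ¬ (suc n ≤ 0)
      case ()
    bad zero zero z≤n sq with () ← positive sq
  necessity h w@(x ∷ y ∷ r) ex@(sf , _) w≤B with x == y in eq
  ... | true with refl ← ==⇒≡ x y eq = contradiction ([] , x ∷ [] , r , (λ ()) , refl) sf
  ... | false = subst (λ n → allowed n ≡ true) (length-map (rename x y) w)
    (renamed (cong₂ _∷_ x↦𝕒 (cong (_∷ map (rename x y) r) y↦𝕓)))
    where
    w′ : Word Γ
    w′ = map (rename x y) w
    x↦𝕒 : rename x y x ≡ 𝕒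
    x↦𝕒 rewrite ==-refl x = refl
    y↦𝕓 : rename x y y ≡ 𝕓
    y↦𝕓 = rename-inverseʳ x y eq 𝕓
    renamed : ∀ {r′} → w′ ≡ 𝕒 ∷ 𝕓 ∷ r′ → allowed (length w′) ≡ true
    renamed w′≡ = subst (λ u → allowed (length u) ≡ true) (sym w′≡)
      (launch-sound (Exhausted.holds h) (subst (λ u → length u ≤ 2 + B) w′≡ (≤-trans (≤-reflexive (length-map (rename x y) w)) w≤B))
        (subst SquareFree w′≡ (squareFree-map {f = rename x y} {rename⁻¹ x y} (rename-inverseˡ x y eq) (rename-inverseʳ x y eq) sf))
        (subst (λ u → AllCovered u) w′≡ (allCovered-map {f = rename x y} {rename⁻¹ x y} (rename-inverseˡ x y eq) (rename-inverseʳ x y eq) (extremal⇒allCovered ex))))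

allowed⇒exceptional : ∀ n → allowed n ≡ true → ExceptionalLength n
allowed⇒exceptional n h = pick (toWitness {a? = any? (n ≟_) lengths} (Equivalence.from T-≡ h))
  where
  pick : Any (n ≡_) lengths → ExceptionalLength n
  pick (here e) = inj₁ e
  pick (there (here e)) = inj₂ (inj₁ e)
  pick (there (there (here e))) = inj₂ (inj₂ (inj₁ e))
  pick (there (there (there (here e)))) = inj₂ (inj₂ (inj₂ (inj₁ e)))
  pick (there (there (there (there (here e))))) = inj₂ (inj₂ (inj₂ (inj₂ (inj₁ e))))
  pick (there (there (there (there (there (here e)))))) = inj₂ (inj₂ (inj₂ (inj₂ (inj₂ (inj₁ e)))))
  pick (there (there (there (there (there (there (here e))))))) = inj₂ (inj₂ (inj₂ (inj₂ (inj₂ (inj₂ (inj₁ e))))))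
  pick (there (there (there (there (there (there (there (here e)))))))) = inj₂ (inj₂ (inj₂ (inj₂ (inj₂ (inj₂ (inj₂ (inj₁ e)))))))
  pick (there (there (there (there (there (there (there (there (here e))))))))) = inj₂ (inj₂ (inj₂ (inj₂ (inj₂ (inj₂ (inj₂ (inj₂ (inj₁ e))))))))
  pick (there (there (there (there (there (there (there (there (there (here e)))))))))) = inj₂ (inj₂ (inj₂ (inj₂ (inj₂ (inj₂ (inj₂ (inj₂ (inj₂ (inj₁ e)))))))))
  pick (there (there (there (there (there (there (there (there (there (there (here e))))))))))) = inj₂ (inj₂ (inj₂ (inj₂ (inj₂ (inj₂ (inj₂ (inj₂ (inj₂ (inj₂ (inj₁ e))))))))))
  pick (there (there (there (there (there (there (there (there (there (there (there (here e)))))))))))) = inj₂ (inj₂ (inj₂ (inj₂ (inj₂ (inj₂ (inj₂ (inj₂ (inj₂ (inj₂ (inj₂ (inj₁ e)))))))))))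
  pick (there (there (there (there (there (there (there (there (there (there (there (there (here e))))))))))))) = inj₂ (inj₂ (inj₂ (inj₂ (inj₂ (inj₂ (inj₂ (inj₂ (inj₂ (inj₂ (inj₂ (inj₂ (inj₁ e))))))))))))

-- Testing explicit words

module _ {A : Set} where

  hasSquare-++ˡ : ∀ (u : Word A) {v} → HasSquare v → HasSquare (u ++ v)
  hasSquare-++ˡ u (t , x , v , x≢[] , refl) = u ++ t , x , v , x≢[] , sym (++-assoc u t (x ++ (x ++ v)))

  hasSquare-++ʳ : ∀ {u : Word A} v → HasSquare u → HasSquare (u ++ v)
  hasSquare-++ʳ v′ (t , x , v , x≢[] , refl) = t , x , v ++ v′ , x≢[] ,
    trans (++-assoc t _ v′) (cong (t ++_) (trans (++-assoc x _ v′) (cong (x ++_) (++-assoc x v v′))))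

  hasSquare-ʳ++ : ∀ (u : Word A) {v} → HasSquare v → HasSquare (u ʳ++ v)
  hasSquare-ʳ++ []      h = h
  hasSquare-ʳ++ (x ∷ u) h = hasSquare-ʳ++ u (hasSquare-++ˡ (x ∷ []) h)

  square-∷⁻ : ∀ {x} {w : Word A} {s p} → Square (x ∷ w) (suc s) p → Square w s p
  square-∷⁻ (square p≥1 fit rep) = square p≥1 (≤-pred fit) λ s≤j j< → rep (s≤s s≤j) (s≤s j<)

startsWithSquare : ℕ → List Γ → Bool
startsWithSquare f v = headSquare f 1 v v

startsWithSquare-sound : ∀ f v → startsWithSquare f v ≡ true → HasSquare v
startsWithSquare-sound f v h with q , q≥1 , len , same ← headSquare-sound f 0 v v refl h =
  square⇒hasSquare {s = 0} (square q≥1 len λ {j} _ j<q → trans (same j<q) (cong (v !_) (+-comm q j)))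

startsWithSquare-complete : ∀ v {p} → Square v 0 p → startsWithSquare ⌊ length v /2⌋ v ≡ true
startsWithSquare-complete v {p} (square p≥1 fit rep) =
  headSquare-complete ⌊ length v /2⌋ 0 v v p refl p≥1 (s≤s (n+n≤m⇒n≤⌊m/2⌋ p fit)) fit
    λ {k} k<p → trans (rep z≤n k<p) (cong (v !_) (+-comm k p))

squareFreeᵇ : List Γ → Bool
squareFreeᵇ []        = true
squareFreeᵇ w@(_ ∷ v) = not (startsWithSquare ⌊ length w /2⌋ w) ∧ squareFreeᵇ v

not-true : ∀ b → not b ≡ true → b ≡ false
not-true false _ = refl

squareFreeᵇ⇒¬square : ∀ w → squareFreeᵇ w ≡ true → ∀ {s p} → ¬ Square w s p
squareFreeᵇ⇒¬square [] h {s} {p} sq =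
  contradiction (≤-trans (≤-trans (positive sq) (m≤m+n p p)) (m≤n+m (p + p) s)) (<⇒≱ (s≤s (fits sq)))
squareFreeᵇ⇒¬square w@(x ∷ v) h {zero} sq
  with () ← trans (sym (startsWithSquare-complete w sq)) (not-true _ (∧-conicalˡ _ (squareFreeᵇ v) h))
squareFreeᵇ⇒¬square w@(x ∷ v) h {suc s} sq =
  squareFreeᵇ⇒¬square v (∧-conicalʳ (not (startsWithSquare ⌊ length w /2⌋ w)) _ h) (square-∷⁻ sq)

squareFreeᵇ-sound : ∀ w → squareFreeᵇ w ≡ true → SquareFree w
squareFreeᵇ-sound w h hs = squareFreeᵇ⇒¬square w h (proj₂ (proj₂ (hasSquare⇒square hs)))

-- Only soundness is asked of it, so the bounds `f` on the period and `d` on how far to the left the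
-- square may start can be chosen for speed.
squareNear : ℕ → ℕ → List Γ → List Γ → Bool
squareNear f zero    l       t = startsWithSquare f t
squareNear f (suc d) []      t = startsWithSquare f t
squareNear f (suc d) (x ∷ l) t = startsWithSquare f t ∨ squareNear f d l (x ∷ t)

squareNear-sound : ∀ f d l t → squareNear f d l t ≡ true → HasSquare (l ʳ++ t)
squareNear-sound f zero    l       t h = hasSquare-ʳ++ l (startsWithSquare-sound f t h)
squareNear-sound f (suc d) []      t h = startsWithSquare-sound f t h
squareNear-sound f (suc d) (x ∷ l) t h with startsWithSquare f t in eq
... | true  = hasSquare-ʳ++ (x ∷ l) (startsWithSquare-sound f t eq)
... | false = squareNear-sound f d l (x ∷ t) h

-- Almost all gaps are covered by squares of small period, so these are tried first.
closed : List Γ → List Γ → Bool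
closed l r = every λ z → squareNear 7 13 l (z ∷ r) ∨ squareNear 50 100 l (z ∷ r)

closed-sound : ∀ l r → closed l r ≡ true → ∀ z → HasSquare (l ʳ++ (z ∷ r))
closed-sound l r h z with squareNear 7 13 l (z ∷ r) in eq | every-true (λ z → squareNear 7 13 l (z ∷ r) ∨ squareNear 50 100 l (z ∷ r)) h z
... | true  | _  = squareNear-sound 7 13 l (z ∷ r) eq
... | false | h′ = squareNear-sound 50 100 l (z ∷ r) h′

-- The gaps tested are those of `m`, including both of its ends; `l`, read backwards, and `r` are
-- context that the squares may use. This lets a long word be tested in overlapping windows.
closedAlong : List Γ → List Γ → List Γ → Bool
closedAlong l []      r = closed l r
closedAlong l (x ∷ m) r = closed l (x ∷ m ++ r) ∧ closedAlong (x ∷ l) m r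

closedAlong-sound : ∀ l m r → closedAlong l m r ≡ true →
                    ∀ m′ {m″} → m ≡ m′ ++ m″ → ∀ z → HasSquare (l ʳ++ (m′ ++ z ∷ (m″ ++ r)))
closedAlong-sound l []      r h [] refl z = closed-sound l r h z
closedAlong-sound l (x ∷ m) r h [] refl z = closed-sound l (x ∷ m ++ r) (∧-conicalˡ _ (closedAlong (x ∷ l) m r) h) z
closedAlong-sound l (x ∷ m) r h (_ ∷ m′) refl z =
  closedAlong-sound (x ∷ l) m r (∧-conicalʳ (closed l (x ∷ m ++ r)) _ h) m′ refl z

extremalᵇ : List Γ → Bool
extremalᵇ w = squareFreeᵇ w ∧ closedAlong [] w []

extremalᵇ-sound : ∀ w → extremalᵇ w ≡ true → ExtremalSquareFree w
extremalᵇ-sound w h = squareFreeᵇ-sound w (∧-conicalˡ _ (closedAlong [] w []) h) , λ where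
  e (w′ , w″ , z , refl , refl) sf → sf (subst (λ v → HasSquare (w′ ++ z ∷ v)) (++-identityʳ w″)
    (closedAlong-sound [] w [] (∧-conicalʳ (squareFreeᵇ w) _ h) w′ refl z))

-- Words are coded by the numbers whose ternary digits are their letters.
decode : (length code : ℕ) → List Γ → List Γ
decode zero    c acc = acc
decode (suc n) c acc = decode n (c / 3) (letter (c % 3) ∷ acc)
  where
  letter : ℕ → Γ
  letter 0 = 𝕒
  letter 1 = 𝕓
  letter _ = 𝕔

length-decode : ∀ n c acc → length (decode n c acc) ≡ n + length acc
length-decode zero    c acc = refl
length-decode (suc n) c acc = trans (length-decode n (c / 3) _) (+-suc n (length acc))

tabulates : List ℕ → List ℕ → Bool
tabulates []       _        = true
tabulates (n ∷ ns) []       = false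
tabulates (n ∷ ns) (c ∷ cs) = extremalᵇ (decode n c []) ∧ tabulates ns cs

HasExtremal : ℕ → Set
HasExtremal n = ∃[ w ] (ExtremalSquareFree {Γ} w × length w ≡ n)

tabulates-sound : ∀ ns cs → tabulates ns cs ≡ true → All HasExtremal ns
tabulates-sound []       _        _ = []
tabulates-sound (n ∷ ns) (c ∷ cs) h =
  (decode n c [] , extremalᵇ-sound _ (∧-conicalˡ _ (tabulates ns cs) h) ,
   trans (length-decode n c []) (+-identityʳ n)) ∷
  tabulates-sound ns cs (∧-conicalʳ (extremalᵇ (decode n c [])) _ h)

-- Uniform morphisms

module _ {A : Set} where

  square-++⁺ : ∀ {w : Word A} {s p} v → Square w s p → Square (w ++ v) s p
  square-++⁺ {w} {s} {p} v (square p≥1 fit rep) =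
    square p≥1 (≤-trans fit (≤-trans (m≤m+n (length w) (length v)) (≤-reflexive (sym (length-++ w))))) λ {j} s≤j j< →
      let j+p< : j + p < length w
          j+p< = <-≤-trans (+-monoˡ-< p j<) (≤-trans (≤-reflexive (+-assoc s p p)) fit)
      in trans (!-++ˡ w (≤-<-trans (m≤m+n j p) j+p<)) (trans (rep s≤j j<) (sym (!-++ˡ w j+p<)))

  square-suffix : ∀ (u : Word A) {v s p} → Square (u ++ v) (length u + s) p → Square v s p
  square-suffix u {v} {s} {p} (square p≥1 fit rep) = square p≥1
    (+-cancelˡ-≤ (length u) _ _ (≤-trans (≤-reflexive (sym (+-assoc (length u) s (p + p)))) (≤-trans fit (≤-reflexive (length-++ u)))))
    λ {j} s≤j j< → trans (sym (!-++ʳ u j))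
      (trans (rep (+-monoʳ-≤ (length u) s≤j) (<-≤-trans (+-monoʳ-< (length u) j<) (≤-reflexive (sym (+-assoc (length u) s p)))))
        (trans (cong ((u ++ v) !_) (+-assoc (length u) j p)) (!-++ʳ u (j + p))))

  squareFree-++⁻ˡ : ∀ (u : Word A) {v} → SquareFree (u ++ v) → SquareFree u
  squareFree-++⁻ˡ u {v} sf h = sf (hasSquare-++ʳ v h)

  squareFree-++⁻ʳ : ∀ (u : Word A) {v} → SquareFree (u ++ v) → SquareFree v
  squareFree-++⁻ʳ u sf h = sf (hasSquare-++ˡ u h)

  -- All that is asked of a preimage extended by one more letter: neighbouring blocks then come from
  -- distinct letters, as `synchronised` demands.
  AdjacentDistinct : Word A → Set
  AdjacentDistinct w = ∀ {i x} → w ! i ≡ just x → w ! suc i ≢ just x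

  squareFree⇒adjacentDistinct : ∀ {w : Word A} → SquareFree w → AdjacentDistinct w
  squareFree⇒adjacentDistinct {w} sf {i} hx hx′ = squareFree⇒¬square {s = i} {p = 1} sf
    (square (s≤s z≤n) (≤-trans (≤-reflexive (+-suc i 1)) (≤-trans (≤-reflexive (cong suc (+-comm i 1))) (!-< w hx′))) rep)
    where
    rep : ∀ {j} → i ≤ j → j < i + 1 → w ! j ≡ w ! (j + 1)
    rep i≤j j<i+1 with refl ← ≤-antisym i≤j (≤-pred (≤-trans j<i+1 (≤-reflexive (+-comm i 1)))) =
      trans hx (trans (sym hx′) (cong (w !_) (+-comm 1 i)))

module Morphism (h : Γ → Word Γ) (L : ℕ) .{{_ : NonZero L}} (length-h : ∀ y → length (h y) ≡ L)
  (apart : ∀ {a b r} → r < L → h a ! r ≡ h b ! r → a ≡ b)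
  (synchronised : ∀ {a b c ρ} → b ≢ c → 0 < ρ → ρ < L →
                  ¬ (∀ {j} → j < L → h a ! j ≡ (h b ++ h c) ! (ρ + j)))
  where

  hom : Word Γ → Word Γ
  hom []      = []
  hom (y ∷ u) = h y ++ hom u

  hom-++ : ∀ u v → hom (u ++ v) ≡ hom u ++ hom v
  hom-++ []      v = refl
  hom-++ (y ∷ u) v = trans (cong (h y ++_) (hom-++ u v)) (sym (++-assoc (h y) (hom u) (hom v)))

  length-hom : ∀ u → length (hom u) ≡ length u * L
  length-hom []      = refl
  length-hom (y ∷ u) = trans (length-++ (h y)) (cong₂ _+_ (length-h y) (length-hom u))

  hom-! : ∀ u {v i r y} → u ! i ≡ just y → r < L → (hom u ++ v) ! (i * L + r) ≡ h y ! r
  hom-! (y ∷ u) {v} {zero} {r} refl r<L = trans (cong (_! r) (++-assoc (h y) (hom u) v))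
    (!-++ˡ (h y) (subst (r <_) (sym (length-h y)) r<L))
  hom-! (y ∷ u) {v} {suc i} {r} hy r<L = begin
    ((h y ++ hom u) ++ v) ! (L + i * L + r)          ≡⟨ cong₂ _!_ (++-assoc (h y) (hom u) v) (+-assoc L (i * L) r) ⟩
    (h y ++ (hom u ++ v)) ! (L + (i * L + r))        ≡⟨ cong (λ n → (h y ++ (hom u ++ v)) ! (n + (i * L + r))) (length-h y) ⟨
    (h y ++ (hom u ++ v)) ! (length (h y) + (i * L + r)) ≡⟨ !-++ʳ (h y) (i * L + r) ⟩
    (hom u ++ v) ! (i * L + r)                       ≡⟨ hom-! u hy r<L ⟩
    _                                                ∎
    where open ≡-Reasoning

  hom-!₂ : ∀ u {i r b c} → u ! i ≡ just b → u ! suc i ≡ just c → r < L + L → hom u ! (i * L + r) ≡ (h b ++ h c) ! r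
  hom-!₂ (b ∷ c ∷ u) {zero} {r} refl refl r< =
    trans (cong (_! r) (sym (++-assoc (h b) (h c) (hom u))))
      (!-++ˡ (h b ++ h c) (<-≤-trans r< (≤-reflexive (sym (trans (length-++ (h b)) (cong₂ _+_ (length-h b) (length-h c)))))))
  hom-!₂ (y ∷ u) {suc i} {r} hb hc r< =
    trans (cong ((h y ++ hom u) !_) (trans (+-assoc L (i * L) r) (cong (_+ (i * L + r)) (sym (length-h y)))))
      (trans (!-++ʳ (h y) (i * L + r)) (hom-!₂ u hb hc r<))

  index : ∀ u {i r} → i * L + r < length (hom u) → ∃[ y ] u ! i ≡ just y
  index u {i} {r} lt = !-just u (*-cancelʳ-< L i (length u) (≤-<-trans (m≤m+n (i * L) r) (subst (_ <_) (length-hom u) lt)))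

  module _ {V : Word Γ} (distinct : AdjacentDistinct V) {s q : ℕ} (sq : Square (hom V) s q) where

    private
      t r c ρ : ℕ
      t = s / L
      r = s % L
      c = q / L
      ρ = q % L

      s≡ : s ≡ t * L + r
      s≡ = trans (m≡m%n+[m/n]*n s L) (+-comm r (t * L))

      q≡ : q ≡ c * L + ρ
      q≡ = trans (m≡m%n+[m/n]*n q L) (+-comm ρ (c * L))

      r<L : r < L
      r<L = m%n<n s L

    -- Otherwise a full block inside the first half reappears in the second half, off the block boundaries.
    period-multiple : L + L ≤ q → ρ ≡ 0
    period-multiple 2L≤q with ρ in eq
    ... | zero    = refl
    ... | suc ρ′  = contradiction
        (λ {j} j<L → let open ≡-Reasoning in begin
          h a ! j                                   ≡⟨ hom-! V {[]} va j<L ⟨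
          (hom V ++ []) ! (suc t * L + j)           ≡⟨ cong (_! (suc t * L + j)) (++-identityʳ (hom V)) ⟩
          hom V ! (suc t * L + j)                   ≡⟨ repeats sq (s≤ j) (j< j<L) ⟩
          hom V ! (suc t * L + j + q)               ≡⟨ cong (hom V !_) (shift j) ⟩
          hom V ! (i * L + (suc ρ′ + j))            ≡⟨ hom-!₂ V vb vc (+-mono-<-≤ ρ<L (<⇒≤ j<L)) ⟩
          (h b ++ h d) ! (suc ρ′ + j)               ∎)
        (synchronised {a} {b} {d} b≢d (s≤s z≤n) ρ<L)
      where
      i : ℕ
      i = suc t + c
      ρ<L : suc ρ′ < L
      ρ<L = subst (_< L) eq (m%n<n q L)
      q≡′ : q ≡ c * L + suc ρ′
      q≡′ = trans q≡ (cong (c * L +_) eq)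
      s≤ : ∀ j → s ≤ suc t * L + j
      s≤ j = ≤-trans (≤-reflexive s≡) (≤-trans (≤-trans (+-monoʳ-≤ (t * L) (<⇒≤ r<L)) (≤-reflexive (+-comm (t * L) L))) (m≤m+n _ j))
      j< : ∀ {j} → j < L → suc t * L + j < s + q
      j< {j} j<L = begin-strict
        L + t * L + j      <⟨ +-monoʳ-< (L + t * L) j<L ⟩
        L + t * L + L      ≡⟨ trans (cong (_+ L) (+-comm L (t * L))) (+-assoc (t * L) L L) ⟩
        t * L + (L + L)    ≤⟨ +-mono-≤ (≤-trans (m≤m+n (t * L) r) (≤-reflexive (sym s≡))) 2L≤q ⟩
        s + q              ∎
        where open ≤-Reasoning
      shift : ∀ j → suc t * L + j + q ≡ i * L + (suc ρ′ + j)
      shift j = begin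
        suc t * L + j + q                      ≡⟨ cong (suc t * L + j +_) q≡′ ⟩
        suc t * L + j + (c * L + suc ρ′)       ≡⟨ +-regroup (suc t * L) j (c * L) (suc ρ′) ⟩
        suc t * L + c * L + (suc ρ′ + j)       ≡⟨ cong (_+ (suc ρ′ + j)) (*-distribʳ-+ L (suc t) c) ⟨
        i * L + (suc ρ′ + j)                   ∎
        where
        open ≡-Reasoning
        +-regroup : ∀ a b c d → a + b + (c + d) ≡ a + c + (d + b)
        +-regroup a b c d = trans (+-assoc a b (c + d)) (trans (cong (a +_) (trans (+-comm b (c + d)) (+-assoc c d b))) (sym (+-assoc a c (d + b))))
      end≤ : i * L + suc ρ′ + L ≤ length (hom V)
      end≤ = begin
        i * L + suc ρ′ + L                 ≡⟨ cong (λ n → n + suc ρ′ + L) (*-distribʳ-+ L (suc t) c) ⟩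
        L + t * L + c * L + suc ρ′ + L     ≡⟨ cong (_+ L) (trans (+-assoc (L + t * L) (c * L) (suc ρ′)) (cong (L + t * L +_) (sym q≡′))) ⟩
        L + t * L + q + L                  ≡⟨ cong (_+ L) (trans (+-assoc L (t * L) q) (+-comm L (t * L + q))) ⟩
        t * L + q + L + L                  ≡⟨ +-assoc (t * L + q) L L ⟩
        t * L + q + (L + L)                ≤⟨ +-mono-≤ (+-monoˡ-≤ q (≤-trans (m≤m+n (t * L) r) (≤-reflexive (sym s≡)))) 2L≤q ⟩
        s + q + q                          ≡⟨ +-assoc s q q ⟩
        s + (q + q)                        ≤⟨ fits sq ⟩
        length (hom V)                     ∎
        where open ≤-Reasoning
      at-c : ∃[ y ] V ! suc i ≡ just y
      at-c = index V {suc i} {suc ρ′ ∸ 1} (<-≤-trans (≤-<-trans (≤-reflexive (trans (cong (_+ ρ′) (+-comm L (i * L))) (trans (+-assoc (i * L) L ρ′) (trans (cong (i * L +_) (+-comm L ρ′)) (sym (+-assoc (i * L) ρ′ L))))))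
        (+-monoˡ-< L (+-monoʳ-< (i * L) (n<1+n ρ′)))) end≤)
      d : Γ
      d = proj₁ at-c
      vc : V ! suc i ≡ just d
      vc = proj₂ at-c
      at-b : ∃[ y ] V ! i ≡ just y
      at-b = !-just V (<-trans (n<1+n i) (!-< V vc))
      b : Γ
      b = proj₁ at-b
      vb : V ! i ≡ just b
      vb = proj₂ at-b
      at-a : ∃[ y ] V ! suc t ≡ just y
      at-a = !-just V (≤-<-trans (m≤m+n (suc t) c) (!-< V vb))
      a : Γ
      a = proj₁ at-a
      va : V ! suc t ≡ just a
      va = proj₂ at-a
      b≢d : b ≢ d
      b≢d b≡d = distinct vb (trans vc (cong just (sym b≡d)))

    -- The period is a number `c` of blocks, so comparing one letter per block, at the offset `r` of
    -- the start, relates the preimages of blocks at distance `c`, and `apart` makes them equal. The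
    -- bound on the end serves words whose last block is incomplete.
    long-square : L + L ≤ q → ∃[ t ] ∃[ c ] Square V t c × (t + (c + c)) * L ≤ s + (q + q)
    long-square 2L≤q = t , c , square c≥1 fit rep , end≤
      where
      q≡′ : q ≡ c * L
      q≡′ = trans q≡ (trans (cong (c * L +_) (period-multiple 2L≤q)) (+-identityʳ (c * L)))
      c≥1 : 1 ≤ c
      c≥1 = ≰⇒> λ c≤0 → <⇒≱ (≤-<-trans z≤n r<L) (≤-trans (m≤m+n L L) (≤-trans 2L≤q (≤-trans (≤-reflexive q≡′) (*-monoˡ-≤ L c≤0))))
      expand : s + (q + q) ≡ (t + (c + c)) * L + r
      expand = begin
        s + (q + q)                          ≡⟨ cong₂ (λ a b → a + (b + b)) s≡ q≡′ ⟩
        t * L + r + (c * L + c * L)          ≡⟨ cong (t * L + r +_) (*-distribʳ-+ L c c) ⟨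
        t * L + r + (c + c) * L              ≡⟨ trans (+-assoc (t * L) r _) (trans (cong (t * L +_) (+-comm r _)) (sym (+-assoc (t * L) _ r))) ⟩
        t * L + (c + c) * L + r              ≡⟨ cong (_+ r) (*-distribʳ-+ L t (c + c)) ⟨
        (t + (c + c)) * L + r                ∎
        where open ≡-Reasoning
      end≤ : (t + (c + c)) * L ≤ s + (q + q)
      end≤ = ≤-trans (m≤m+n _ r) (≤-reflexive (sym expand))
      fit : t + (c + c) ≤ length V
      fit = *-cancelʳ-≤ (t + (c + c)) (length V) L (≤-trans end≤ (≤-trans (fits sq) (≤-reflexive (length-hom V))))
      rep : ∀ {i} → t ≤ i → i < t + c → V ! i ≡ V ! (i + c)
      rep {i} t≤i i<t+c with a , va ← !-just V {i} (<-≤-trans (<-≤-trans i<t+c (+-monoʳ-≤ t (m≤m+n c c))) fit)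
                           | b , vb ← !-just V {i + c} (<-≤-trans (+-monoˡ-< c i<t+c) (≤-trans (≤-reflexive (+-assoc t c c)) fit)) =
        trans va (trans (cong just (apart r<L (begin
          h a ! r                       ≡⟨ hom-! V {[]} va r<L ⟨
          (hom V ++ []) ! (i * L + r)   ≡⟨ cong (_! (i * L + r)) (++-identityʳ (hom V)) ⟩
          hom V ! (i * L + r)           ≡⟨ repeats sq lower upper ⟩
          hom V ! (i * L + r + q)       ≡⟨ cong (hom V !_) shift ⟩
          hom V ! ((i + c) * L + r)     ≡⟨ cong (_! ((i + c) * L + r)) (++-identityʳ (hom V)) ⟨
          (hom V ++ []) ! ((i + c) * L + r) ≡⟨ hom-! V {[]} vb r<L ⟩
          h b ! r                       ∎))) (sym vb))
        where
        open ≡-Reasoning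
        shift : i * L + r + q ≡ (i + c) * L + r
        shift = trans (cong (i * L + r +_) q≡′) (trans (+-assoc (i * L) r _) (trans (cong (i * L +_) (+-comm r _))
          (trans (sym (+-assoc (i * L) _ r)) (cong (_+ r) (sym (*-distribʳ-+ L i c))))))
        lower : s ≤ i * L + r
        lower = ≤-trans (≤-reflexive s≡) (+-monoˡ-≤ r (*-monoˡ-≤ L t≤i))
        upper : i * L + r < s + q
        upper = ≤-trans (+-monoˡ-< r (*-monoˡ-< L i<t+c)) (≤-reflexive (trans (cong (_+ r) (*-distribʳ-+ L t c))
          (trans (+-assoc (t * L) _ r) (trans (cong (t * L +_) (+-comm _ r)) (trans (sym (+-assoc (t * L) r _)) (cong₂ _+_ (sym s≡) (sym q≡′)))))))

lastOf : {A : Set} → A → List A → A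
lastOf y []      = y
lastOf _ (x ∷ v) = lastOf x v

module _ {A : Set} where

  adjacentDistinct-∷ʳ : ∀ {y : A} v {d} → AdjacentDistinct (y ∷ v) → lastOf y v ≢ d → AdjacentDistinct (y ∷ v ++ d ∷ [])
  adjacentDistinct-∷ʳ []      ad ne {zero}        refl refl = ne refl
  adjacentDistinct-∷ʳ []      ad ne {suc zero}    _    ()
  adjacentDistinct-∷ʳ []      ad ne {suc (suc i)} _    ()
  adjacentDistinct-∷ʳ (x ∷ v) ad ne {zero}        hx   hx′ = ad {zero} hx hx′
  adjacentDistinct-∷ʳ (x ∷ v) ad ne {suc i}       hx   hx′ = adjacentDistinct-∷ʳ v (λ {i} → ad {suc i}) ne {i} hx hx′

  adjacentDistinct-suffix : ∀ (u : Word A) {v} → AdjacentDistinct (u ++ v) → AdjacentDistinct v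
  adjacentDistinct-suffix []      ad = ad
  adjacentDistinct-suffix (x ∷ u) ad = adjacentDistinct-suffix u (λ {i} → ad {suc i})

  Occurs : Word A → Word A → ℕ → Set
  Occurs f w k = ∀ {j} → j < length f → w ! (k + j) ≡ f ! j

  Avoids : Word A → Word A → Set
  Avoids f w = ∀ k → ¬ Occurs f w k

  avoids-suffix : ∀ {f} (u : Word A) {v} → Avoids f (u ++ v) → Avoids f v
  avoids-suffix {f} u {v} av k occ = av (length u + k) λ {j} j<f →
    trans (trans (cong ((u ++ v) !_) (+-assoc (length u) k j)) (!-++ʳ u (k + j))) (occ j<f)

  avoids-prefix : ∀ {f} (u : Word A) {v} → Avoids f (u ++ v) → Avoids f u
  avoids-prefix {f} u {v} av k occ = av k λ {j} j<f →
    trans (!-++ˡ u (inside j<f)) (occ j<f)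
    where
    inside : ∀ {j} → j < length f → k + j < length u
    inside j<f = !-< u (trans (occ j<f) (proj₂ (!-just f j<f)))

  -- A square that reaches into P either repeats the occurrence of f at the end of P,
  -- or is so short that it lies in X.
  squareFree-prepend : ∀ {P Z X Y f : Word A} {o} → P ++ Z ≡ X ++ Y → suc o ≡ length P →
    Occurs f (P ++ Z) o → (o + length f) + (o + length f) ≤ length X →
    Avoids f Z → SquareFree X → SquareFree Z → SquareFree (P ++ Z)
  squareFree-prepend {P} {Z} {X} {Y} {f} {o} W≡ o≡ occ short av sfX sfZ hs
    with a , q , sq ← hasSquare⇒square hs = cases (length P ≤? a) (o + length f ≤? a + q)
    where
    cases : _ → _ → ⊥
    cases (yes P≤a) _ with a′ , refl ← m≤n⇒∃[o]m+o≡n P≤a =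
      squareFree⇒¬square sfZ (square-suffix P sq)
    cases (no P≰a) (yes f≤) = av (q ∸ 1) λ {j} j<f → begin
        Z ! (q ∸ 1 + j)                       ≡⟨ !-++ʳ P (q ∸ 1 + j) ⟨
        (P ++ Z) ! (length P + (q ∸ 1 + j))   ≡⟨ cong ((P ++ Z) !_) (position j) ⟩
        (P ++ Z) ! (o + j + q)                ≡⟨ repeats sq (≤-trans a≤o (m≤m+n o j)) (<-≤-trans (+-monoʳ-< o j<f) f≤) ⟨
        (P ++ Z) ! (o + j)                    ≡⟨ occ j<f ⟩
        f ! j                                 ∎
      where
      open ≡-Reasoning
      a≤o : a ≤ o
      a≤o = ≤-pred (subst (a <_) (sym o≡) (≰⇒> P≰a))
      position : ∀ j → length P + (q ∸ 1 + j) ≡ o + j + q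
      position j = begin
        length P + (q ∸ 1 + j)   ≡⟨ cong (_+ (q ∸ 1 + j)) o≡ ⟨
        suc o + (q ∸ 1 + j)      ≡⟨ +-suc o (q ∸ 1 + j) ⟨
        o + (suc (q ∸ 1) + j)    ≡⟨ cong (λ n → o + (n + j)) (m+[n∸m]≡n (positive sq)) ⟩
        o + (q + j)              ≡⟨ cong (o +_) (+-comm q j) ⟩
        o + (j + q)              ≡⟨ +-assoc o j q ⟨
        o + j + q                ∎
    cases (no P≰a) (no f≰) = squareFree⇒¬square sfX (square-prefix (subst (λ w → Square w a q) W≡ sq) (begin
        a + (q + q)                      ≤⟨ m≤n+m (a + (q + q)) a ⟩
        a + (a + (q + q))                ≡⟨ trans (sym (+-assoc a a (q + q))) (interchange a q) ⟩
        (a + q) + (a + q)                ≤⟨ +-mono-≤ (<⇒≤ (≰⇒> f≰)) (<⇒≤ (≰⇒> f≰)) ⟩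
        (o + length f) + (o + length f)  ≤⟨ short ⟩
        length X                         ∎))
      where
      open ≤-Reasoning
      interchange : ∀ a q → a + a + (q + q) ≡ (a + q) + (a + q)
      interchange a q = trans (+-assoc a a (q + q)) (trans (cong (a +_) (trans (sym (+-assoc a q q)) (trans (cong (_+ q) (+-comm a q)) (+-assoc q a q)))) (sym (+-assoc a q (a + q))))

  -- The mirror image: `g` ends with the first letter of `S`, so a square that ends beyond `Z` and
  -- has `g` in its second half repeats `g` inside `Z`. Otherwise `a + q` exceeds `o`; the start is
  -- twice `a + q` minus the end, and the end is at most the length of the word, so the start is at
  -- least `length X` and the square lies in `Y`.
  squareFree-append : ∀ {Z S X Y g : Word A} {o} → Z ++ S ≡ X ++ Y → o + length g ≡ suc (length Z) →
    Occurs g (Z ++ S) o → length X + length (X ++ Y) ≤ suc o + suc o →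
    Avoids g Z → SquareFree Y → SquareFree Z → SquareFree (Z ++ S)
  squareFree-append {Z} {S} {X} {Y} {g} {o} W≡ o≡ occ short av sfY sfZ hs
    with a , q , sq ← hasSquare⇒square hs = cases (a + (q + q) ≤? length Z) (a + q ≤? o)
    where
    cases : _ → _ → ⊥
    cases (yes end≤) _ = squareFree⇒¬square sfZ (square-prefix sq end≤)
    cases (no end≰) (yes a+q≤o) with k , eqk ← m≤n⇒∃[o]m+o≡n (≤-trans (m≤n+m q a) a+q≤o) = av k λ {j} j<g →
      let W!≡ : (Z ++ S) ! (k + j) ≡ g ! j
          W!≡ = trans (repeats sq (≤-trans a≤k (m≤m+n k j)) (upper j<g)) (trans (cong ((Z ++ S) !_) (position j)) (occ j<g))
      in trans (sym (!-++ˡ Z (inside j<g))) W!≡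
      where
      position : ∀ j → k + j + q ≡ o + j
      position j = trans (+-comm (k + j) q) (trans (sym (+-assoc q k j)) (cong (_+ j) eqk))
      a≤k : a ≤ k
      a≤k = +-cancelʳ-≤ q a k (≤-trans a+q≤o (≤-reflexive (trans (sym eqk) (+-comm q k))))
      upper : ∀ {j} → j < length g → k + j < a + q
      upper {j} j<g = +-cancelʳ-< q (k + j) (a + q) (begin-strict
        k + j + q      ≡⟨ position j ⟩
        o + j          <⟨ +-monoʳ-< o j<g ⟩
        o + length g   ≡⟨ o≡ ⟩
        suc (length Z) ≤⟨ ≰⇒> end≰ ⟩
        a + (q + q)    ≡⟨ +-assoc a q q ⟨
        a + q + q      ∎)
        where open ≤-Reasoning
      inside : ∀ {j} → j < length g → k + j < length Z
      inside {j} j<g = ≤-pred (begin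
        suc (suc (k + j))   ≤⟨ s≤s (≤-trans (≤-reflexive (+-comm 1 (k + j))) (+-monoʳ-≤ (k + j) (positive sq))) ⟩
        suc (k + j + q)     ≡⟨ cong suc (position j) ⟩
        suc (o + j)         ≤⟨ +-monoʳ-< o j<g ⟩
        o + length g        ≡⟨ o≡ ⟩
        suc (length Z)      ∎)
        where open ≤-Reasoning
    cases (no end≰) (no a+q≰o) =
      squareFree⇒¬square sfY (square-suffix X (subst₂ (λ w a → Square w a q) W≡ (sym (m+[n∸m]≡n X≤a)) sq))
      where
      interchange : ∀ a q → a + a + (q + q) ≡ (a + q) + (a + q)
      interchange a q = trans (+-assoc a a (q + q)) (trans (cong (a +_) (trans (sym (+-assoc a q q)) (trans (cong (_+ q) (+-comm a q)) (+-assoc q a q)))) (sym (+-assoc a q (a + q))))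
      X≤a : length X ≤ a
      X≤a = +-cancelʳ-≤ (a + (q + q)) (length X) a (begin
        length X + (a + (q + q))      ≤⟨ +-monoʳ-≤ (length X) (≤-trans (fits sq) (≤-reflexive (cong length W≡))) ⟩
        length X + length (X ++ Y)    ≤⟨ short ⟩
        suc o + suc o                 ≤⟨ +-mono-≤ (≰⇒> a+q≰o) (≰⇒> a+q≰o) ⟩
        (a + q) + (a + q)             ≡⟨ interchange a q ⟨
        a + a + (q + q)               ≡⟨ +-assoc a a (q + q) ⟩
        a + (a + (q + q))             ∎)
        where open ≤-Reasoning

module Extension (h : Γ → Word Γ) (L : ℕ) .{{_ : NonZero L}} (length-h : ∀ y → length (h y) ≡ L)
  (apart : ∀ {a b r} → r < L → h a ! r ≡ h b ! r → a ≡ b)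
  (synchronised : ∀ {a b c ρ} → b ≢ c → 0 < ρ → ρ < L →
                  ¬ (∀ {j} → j < L → h a ! j ≡ (h b ++ h c) ! (ρ + j)))
  where

  open Morphism h L length-h apart synchronised

  -- A factor of length at most `suc L` meets no more than two consecutive blocks. Pairs of distinct
  -- letters therefore suffice, apart from the last block with what follows it, for which there is a
  -- separate hypothesis.
  avoids-hom : ∀ {f} → length f ≤ suc L → (∀ {a b} → a ≢ b → Avoids f (h a ++ h b)) →
               ∀ y V {s} → AdjacentDistinct (y ∷ V) → Avoids f (h (lastOf y V) ++ s) → Avoids f (hom (y ∷ V) ++ s)
  avoids-hom {f} f≤ pairs y [] {s} ad end = subst (Avoids f) (cong (_++ s) (sym (++-identityʳ (h y)))) end
  avoids-hom {f} f≤ pairs y (b ∷ V) {s} ad end k occ with k <? L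
  ... | yes k<L = pairs (λ { refl → ad {0} refl refl }) k λ {j} j<f → begin
      (h y ++ h b) ! (k + j)                     ≡⟨ !-++ˡ (h y ++ h b) (inside j<f) ⟨
      ((h y ++ h b) ++ (hom V ++ s)) ! (k + j)   ≡⟨ cong (_! (k + j)) assoc ⟩
      (hom (y ∷ b ∷ V) ++ s) ! (k + j)           ≡⟨ occ j<f ⟩
      f ! j                                      ∎
    where
    open ≡-Reasoning
    assoc : (h y ++ h b) ++ (hom V ++ s) ≡ (h y ++ (h b ++ hom V)) ++ s
    assoc = trans (sym (++-assoc (h y ++ h b) (hom V) s)) (cong (_++ s) (++-assoc (h y) (h b) (hom V)))
    inside : ∀ {j} → j < length f → k + j < length (h y ++ h b)
    inside {j} j<f = ≤-trans (+-mono-≤ k<L (≤-pred (≤-trans j<f f≤)))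
      (≤-reflexive (sym (trans (length-++ (h y)) (cong₂ _+_ (length-h y) (length-h b)))))
  ... | no k≮L with k′ , refl ← m≤n⇒∃[o]m+o≡n (≮⇒≥ k≮L) =
    avoids-hom {f} f≤ pairs b V (λ {i} → ad {suc i}) end k′ λ {j} j<f → begin
      (hom (b ∷ V) ++ s) ! (k′ + j)                           ≡⟨ !-++ʳ (h y) (k′ + j) ⟨
      (h y ++ (hom (b ∷ V) ++ s)) ! (length (h y) + (k′ + j)) ≡⟨ cong₂ _!_ (sym (++-assoc (h y) (hom (b ∷ V)) s)) (trans (cong (_+ (k′ + j)) (length-h y)) (sym (+-assoc L k′ j))) ⟩
      (hom (y ∷ b ∷ V) ++ s) ! (L + k′ + j)                   ≡⟨ occ j<f ⟩
      f ! j                                                   ∎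
    where open ≡-Reasoning

  module _ (short : ∀ u → length u ≤ 5 → SquareFree u → SquareFree (hom u)) {β : ℕ} (β<L : β < L)
           (shortEnd : ∀ u d → length u ≤ 4 → SquareFree u → AdjacentDistinct (u ++ d ∷ []) → SquareFree (hom u ++ take β (h d)))
    where

    -- A square with a period of at least two blocks is pulled back to `U`. Any other square,
    -- counted from the beginning of the block in which it starts, ends within L + 4L letters, so it
    -- lies in five blocks, or in at most four and the incomplete one.
    squareFree-hom : ∀ U d → SquareFree U → AdjacentDistinct (U ++ d ∷ []) → SquareFree (hom U ++ take β (h d))
    squareFree-hom U d sf ad hs with s , q , sq ← hasSquare⇒square hs = cases (L + L ≤? q)
      where
      W : Word Γ
      W = hom U ++ take β (h d)
      length-W : length W < suc (length U) * L
      length-W = begin-strict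
        length W                              ≡⟨ length-++ (hom U) ⟩
        length (hom U) + length (take β (h d)) ≡⟨ cong₂ _+_ (length-hom U) (length-take β (h d)) ⟩
        length U * L + (β ⊓ length (h d))     ≤⟨ +-monoʳ-≤ (length U * L) (m⊓n≤m β _) ⟩
        length U * L + β                      <⟨ +-monoʳ-< (length U * L) β<L ⟩
        length U * L + L                      ≡⟨ +-comm (length U * L) L ⟩
        suc (length U) * L                    ∎
        where open ≤-Reasoning
      full : W ++ drop β (h d) ≡ hom (U ++ d ∷ [])
      full = trans (++-assoc (hom U) (take β (h d)) (drop β (h d)))
        (trans (cong (hom U ++_) (trans (take++drop≡id β (h d)) (sym (++-identityʳ (h d))))) (sym (hom-++ U (d ∷ []))))
      t r : ℕ
      t = s / L
      r = s % L
      s≡ : s ≡ t * L + r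
      s≡ = trans (m≡m%n+[m/n]*n s L) (+-comm r (t * L))
      cases : _ → ⊥
      -- Completing the last block gives an image to which `long-square` applies. Its bound on the
      -- end keeps the square of the preimage off `d`, because the incomplete word is shorter than
      -- `suc (length U)` blocks.
      cases (yes 2L≤q) with t′ , c , sqV , end≤ ← long-square ad (subst (λ w → Square w s q) full (square-++⁺ (drop β (h d)) sq)) 2L≤q =
        squareFree⇒¬square sf (square-prefix sqV (≤-pred (*-cancelʳ-< L _ _ (≤-<-trans (≤-trans end≤ (fits sq)) length-W))))
      cases (no q<2L) = windows (suc (t + 4) ≤? length U)
        where
        t≤U : t ≤ length U
        t≤U = ≤-pred (*-cancelʳ-< L t (suc (length U)) (≤-<-trans (≤-trans (m≤m+n (t * L) r) (≤-trans (≤-reflexive (sym s≡)) (≤-trans (m≤m+n s (q + q)) (fits sq)))) length-W))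
        A D : Word Γ
        A = take t U
        D = drop t U
        AD : A ++ D ≡ U
        AD = take++drop≡id t U
        length-homA : length (hom A) ≡ t * L
        length-homA = trans (length-hom A) (cong (_* L) (trans (length-take t U) (m≤n⇒m⊓n≡m t≤U)))
        W≡ : W ≡ hom A ++ (hom D ++ take β (h d))
        W≡ = trans (cong (_++ take β (h d)) (trans (cong hom (sym AD)) (hom-++ A D))) (++-assoc (hom A) (hom D) (take β (h d)))
        sqD : Square (hom D ++ take β (h d)) r q
        sqD = square-suffix (hom A) (subst₂ (λ w a → Square w a q) W≡ (trans s≡ (cong (_+ r) (sym length-homA))) sq)
        sfD : SquareFree D
        sfD = squareFree-++⁻ʳ A (subst SquareFree (sym AD) sf)
        windows : _ → ⊥
        windows (no few) = squareFree⇒¬square (shortEnd D d length-D sfD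
          (adjacentDistinct-suffix A (subst AdjacentDistinct (trans (cong (_++ d ∷ []) (sym AD)) (++-assoc A D (d ∷ []))) ad))) sqD
          where
          length-D : length D ≤ 4
          length-D = ≤-trans (≤-reflexive (length-drop t U)) (m≤n+o⇒m∸n≤o (length U) t (≤-pred (≰⇒> few)))
        windows (yes many) = squareFree⇒¬square (short E (≤-reflexive length-E) (squareFree-++⁻ˡ E (subst SquareFree (sym (take++drop≡id 5 D)) sfD)))
          (square-prefix (subst (λ w → Square w r q) D≡ sqD) end≤)
          where
          E : Word Γ
          E = take 5 D
          length-E : length E ≡ 5
          length-E = trans (length-take 5 D) (m≤n⇒m⊓n≡m (≤-trans (m+n≤o⇒n≤o∸m′ t (≤-trans (≤-reflexive (+-suc t 4)) many)) (≤-reflexive (sym (length-drop t U)))))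
            where
            m+n≤o⇒n≤o∸m′ : ∀ m {n o} → m + n ≤ o → n ≤ o ∸ m
            m+n≤o⇒n≤o∸m′ m {n} le = subst (_≤ _) (m+n∸m≡n m n) (∸-monoˡ-≤ m le)
          D≡ : hom D ++ take β (h d) ≡ hom E ++ (hom (drop 5 D) ++ take β (h d))
          D≡ = trans (cong (_++ take β (h d)) (trans (cong hom (sym (take++drop≡id 5 D))) (hom-++ E (drop 5 D)))) (++-assoc (hom E) _ _)
          end≤ : r + (q + q) ≤ length (hom E)
          end≤ = begin
            r + (q + q)                ≤⟨ +-mono-≤ (<⇒≤ (m%n<n s L)) (+-mono-≤ (<⇒≤ (≰⇒> q<2L)) (<⇒≤ (≰⇒> q<2L))) ⟩
            L + ((L + L) + (L + L))    ≡⟨ five L ⟩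
            5 * L                      ≡⟨ cong (_* L) length-E ⟨
            length E * L               ≡⟨ length-hom E ⟨
            length (hom E)             ∎
            where
            open ≤-Reasoning
            five : ∀ L → L + ((L + L) + (L + L)) ≡ 5 * L
            five L = cong (L +_) (trans (+-assoc L L (L + L)) (cong (λ n → L + (L + (L + n))) (sym (+-identityʳ L))))

-- Words between two ends

doubled : ∀ x l o → x + (x + (l + l + ((1 + o) + (1 + o)))) ≡ (1 + (x + (l + o))) + (1 + (x + (l + o)))
doubled = solve-∀

-- The piece `inner` continues the middle to the left as the image of a letter `𝕓` before its first
-- letter `𝕒` would, so only `outer` leaves the image of the morphism. The marker begins with the
-- last letter of `outer`: shifted to the right by any period, it lies wholly behind `outer`.
record LeftEnd (h : Γ → Word Γ) (L cut : ℕ) : Set where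
  field
    outer inner lost : Word Γ
    inner-suffix : h 𝕓 ≡ lost ++ inner
    marker : Word Γ
    start : ℕ
    start≡ : suc start ≡ length outer
    marker-≤ : length marker ≤ suc L
    marker-occurs : Occurs marker ((outer ++ inner) ++ h 𝕒) start
    marker-avoided : ∀ {a b} → a ≢ b → Avoids marker (h a ++ h b)
    marker-early : (start + length marker) + (start + length marker) ≤ length (outer ++ inner) + (L + L)
    locally-squareFree : ∀ {y} → 𝕒 ≢ y → SquareFree ((outer ++ inner) ++ (h 𝕒 ++ h y))
    locally-closed : closedAlong [] ((outer ++ inner) ++ take cut (h 𝕒)) (drop cut (h 𝕒)) ≡ true

  word : Word Γ
  word = outer ++ inner

-- The mirror image for a middle that ends in `y`: `inner` begins the block of some letter `next`
-- other than `y`, and the marker ends with the first letter of `outer`. There is one end for each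
-- `y`, as the last letter of the middle is not prescribed.
record RightEnd (h : Γ → Word Γ) (L cut β : ℕ) (y : Γ) : Set where
  field
    next : Γ
    next≢ : y ≢ next
    inner outer lost : Word Γ
    inner-prefix : take β (h next) ≡ inner ++ lost
    marker : Word Γ
    start : ℕ
    start≡ : start + length marker ≡ suc (L + length inner)
    marker-≤ : length marker ≤ suc L
    marker-occurs : Occurs marker (h y ++ (inner ++ outer)) start
    marker-avoided : ∀ {a b} → a ≢ b → Avoids marker (h a ++ h b)
    marker-late : length (inner ++ outer) ≤ suc start + suc start
    locally-squareFree : ∀ {x} → x ≢ y → SquareFree ((h x ++ h y) ++ (inner ++ outer))
    locally-closed : closedAlong (reverse (take cut (h y))) (drop cut (h y) ++ (inner ++ outer)) [] ≡ true

  word : Word Γ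
  word = inner ++ outer

module _ {A : Set} where

  occurs-++ʳ : ∀ {f : Word A} u {v k} → Occurs f v k → Occurs f (u ++ v) (length u + k)
  occurs-++ʳ u {v} {k} occ {j} j<f =
    trans (cong ((u ++ v) !_) (+-assoc (length u) k j)) (trans (!-++ʳ u (k + j)) (occ j<f))

  occurs-++ˡ : ∀ {f : Word A} u {v k} → Occurs f u k → Occurs f (u ++ v) k
  occurs-++ˡ {f} u {v} {k} occ {j} j<f =
    trans (!-++ˡ u (!-< u (trans (occ j<f) (proj₂ (!-just f j<f))))) (occ j<f)

  ++-split : ∀ (m : Word A) {q w′ w″} → m ++ q ≡ w′ ++ w″ →
             (∃[ m″ ] m ≡ w′ ++ m″ × w″ ≡ m″ ++ q) ⊎ (∃[ w‴ ] w′ ≡ m ++ w‴ × q ≡ w‴ ++ w″)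
  ++-split []      {w′ = w′} eq = inj₂ (w′ , refl , eq)
  ++-split (x ∷ m) {w′ = []} eq = inj₁ (x ∷ m , refl , sym eq)
  ++-split (x ∷ m) {w′ = _ ∷ w′} refl-eq with refl , eq ← ∷-injective refl-eq with ++-split m {w′ = w′} eq
  ... | inj₁ (m″ , refl , e) = inj₁ (m″ , refl , e)
  ... | inj₂ (w‴ , refl , e) = inj₂ (w‴ , refl , e)

  lastTwo : ∀ (a b : A) v → ∃[ u ] ∃[ x ] a ∷ b ∷ v ≡ u ++ x ∷ lastOf b v ∷ []
  lastTwo a b []      = [] , a , refl
  lastTwo a b (c ∷ v) with u , x , eq ← lastTwo b c v = a ∷ u , x , cong (a ∷_) eq

module Assembly (h : Γ → Word Γ) (L : ℕ) .{{_ : NonZero L}} (length-h : ∀ y → length (h y) ≡ L)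
  (apart : ∀ {a b r} → r < L → h a ! r ≡ h b ! r → a ≡ b)
  (synchronised : ∀ {a b c ρ} → b ≢ c → 0 < ρ → ρ < L →
                  ¬ (∀ {j} → j < L → h a ! j ≡ (h b ++ h c) ! (ρ + j)))
  where

  open Morphism h L length-h apart synchronised
  open Extension h L length-h apart synchronised

  module _ (short : ∀ u → length u ≤ 5 → SquareFree u → SquareFree (hom u)) {β : ℕ} (β<L : β < L)
           (shortEnd : ∀ u d → length u ≤ 4 → SquareFree u → AdjacentDistinct (u ++ d ∷ []) → SquareFree (hom u ++ take β (h d)))
           {cut : ℕ}
           (closedBetween : ∀ {a b} → a ≢ b →
             closedAlong (reverse (take cut (h a))) (drop cut (h a) ++ take cut (h b)) (drop cut (h b)) ≡ true)
    where

    -- Each window of two blocks closes the gaps from the cut of the first block to the cut of the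
    -- second. Consecutive windows meet at a cut, so no gap is missed and each keeps context on both
    -- sides.
    closed-tail : ∀ y u {s} → AdjacentDistinct (y ∷ u) →
      closedAlong (reverse (take cut (h (lastOf y u)))) (drop cut (h (lastOf y u)) ++ s) [] ≡ true →
      ∀ {w′ w″} z → drop cut (h y) ++ (hom u ++ s) ≡ w′ ++ w″ → HasSquare (take cut (h y) ++ (w′ ++ z ∷ w″))
    closed-tail y [] {s} ad end {w′} {w″} z eq =
      subst HasSquare (trans (ʳ++-defn (reverse (take cut (h y)))) (cong₂ (λ a b → a ++ (w′ ++ z ∷ b)) (reverse-involutive (take cut (h y))) (++-identityʳ w″)))
        (closedAlong-sound (reverse (take cut (h y))) (drop cut (h y) ++ s) [] end w′ eq z)
    closed-tail y (b ∷ u) {s} ad end {w′} {w″} z eq with ++-split (drop cut (h y) ++ take cut (h b)) {w′ = w′} {w″} (trans regroup eq)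
      where
      regroup : (drop cut (h y) ++ take cut (h b)) ++ (drop cut (h b) ++ (hom u ++ s)) ≡ drop cut (h y) ++ ((h b ++ hom u) ++ s)
      regroup = trans (++-assoc (drop cut (h y)) (take cut (h b)) _) (cong (drop cut (h y) ++_)
        (trans (sym (++-assoc (take cut (h b)) (drop cut (h b)) _)) (trans (cong (_++ (hom u ++ s)) (take++drop≡id cut (h b))) (sym (++-assoc (h b) (hom u) s)))))
    ... | inj₁ (m″ , m≡ , refl) =
      subst HasSquare (trans (++-assoc (take cut (h y)) _ (hom u ++ s)) (cong (take cut (h y) ++_)
          (trans (++-assoc w′ _ (hom u ++ s)) (cong (λ v → w′ ++ z ∷ v) (++-assoc m″ (drop cut (h b)) (hom u ++ s))))))
        (hasSquare-++ʳ (hom u ++ s)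
          (subst HasSquare (trans (ʳ++-defn (reverse (take cut (h y)))) (cong (_++ (w′ ++ z ∷ (m″ ++ drop cut (h b)))) (reverse-involutive (take cut (h y)))))
            (closedAlong-sound (reverse (take cut (h y))) (drop cut (h y) ++ take cut (h b)) (drop cut (h b)) (closedBetween (λ { refl → ad {0} refl refl })) w′ m≡ z)))
    ... | inj₂ (w‴ , refl , q≡) =
      subst HasSquare (cong (take cut (h y) ++_) (sym (trans (++-assoc (drop cut (h y) ++ take cut (h b)) w‴ (z ∷ w″))
          (++-assoc (drop cut (h y)) (take cut (h b)) (w‴ ++ z ∷ w″)))))
        (hasSquare-++ˡ (take cut (h y)) (hasSquare-++ˡ (drop cut (h y)) (closed-tail b u (λ {i} → ad {suc i}) end z q≡)))

    -- Of the block of the leading `𝕓` only the left `inner` enters the word; with this letter in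
    -- front the preimage is still square-free, and so is the image. The right end is attached
    -- first, so it too has to avoid the left marker, which is `crossed`.
    module _ (left : LeftEnd h L cut) (right : ∀ y → RightEnd h L cut β y)
             (crossed : ∀ y → Avoids (LeftEnd.marker left) (h y ++ RightEnd.word (right y)))
             {b : Γ} {v : Word Γ} (sfU : SquareFree (𝕓 ∷ 𝕒 ∷ b ∷ v)) where

      private
        u : Word Γ
        u = 𝕒 ∷ b ∷ v
        y : Γ
        y = lastOf b v
        module P = LeftEnd left
        module S = RightEnd (right y)
        s : Word Γ
        s = S.word

        adU : AdjacentDistinct (𝕓 ∷ u)
        adU {i} = squareFree⇒adjacentDistinct sfU {i}

      extremalWord : Word Γ
      extremalWord = P.word ++ (hom u ++ s)

      private
        -- The part that is square-free by the morphism alone: a factor of `hom (𝕓 ∷ u)` followed by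
        -- an incomplete block. The outer parts are attached to it afterwards.
        Z : Word Γ
        Z = P.inner ++ (hom u ++ S.inner)

        adV : AdjacentDistinct (𝕓 ∷ u ++ S.next ∷ [])
        adV {i} = adjacentDistinct-∷ʳ u (λ {i} → adU {i}) S.next≢ {i}

        homU≡ : ∀ t → P.lost ++ (P.inner ++ (hom u ++ t)) ≡ hom (𝕓 ∷ u) ++ t
        homU≡ t = trans (sym (++-assoc P.lost P.inner (hom u ++ t)))
          (trans (cong (_++ (hom u ++ t)) (sym P.inner-suffix)) (sym (++-assoc (h 𝕓) (hom u) t)))

        squareFree-Z : SquareFree Z
        squareFree-Z = squareFree-++⁻ʳ P.lost (squareFree-++⁻ˡ (P.lost ++ Z) (subst SquareFree eq
          (squareFree-hom short β<L shortEnd (𝕓 ∷ u) S.next sfU (λ {i} → adV {i}))))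
          where
          eq : hom (𝕓 ∷ u) ++ take β (h S.next) ≡ (P.lost ++ Z) ++ S.lost
          eq = trans (cong (hom (𝕓 ∷ u) ++_) S.inner-prefix)
            (trans (sym (++-assoc (hom (𝕓 ∷ u)) S.inner S.lost)) (cong (_++ S.lost) (sym (homU≡ S.inner))))

        Z-avoids : Avoids S.marker Z
        Z-avoids = avoids-suffix {f = S.marker} P.lost (avoids-prefix {f = S.marker} (P.lost ++ Z) (subst (Avoids S.marker) eq
          (avoids-hom {S.marker} S.marker-≤ S.marker-avoided 𝕓 (u ++ S.next ∷ []) {[]} (λ {i} → adV {i}) (end _))))
          where
          other : ∀ a → ∃[ c ] a ≢ c
          other 𝕒 = 𝕓 , λ ()
          other 𝕓 = 𝕒 , λ ()
          other 𝕔 = 𝕒 , λ ()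
          end : ∀ a → Avoids S.marker (h a ++ [])
          end a with c , a≢c ← other a = subst (Avoids S.marker) (sym (++-identityʳ (h a))) (avoids-prefix {f = S.marker} (h a) (S.marker-avoided a≢c))
          eq : hom (𝕓 ∷ (u ++ S.next ∷ [])) ++ [] ≡ (P.lost ++ Z) ++ (S.lost ++ drop β (h S.next))
          eq = begin
            hom (𝕓 ∷ (u ++ S.next ∷ [])) ++ []                     ≡⟨ ++-identityʳ _ ⟩
            hom ((𝕓 ∷ u) ++ S.next ∷ [])                           ≡⟨ hom-++ (𝕓 ∷ u) (S.next ∷ []) ⟩
            hom (𝕓 ∷ u) ++ (h S.next ++ [])                        ≡⟨ cong (hom (𝕓 ∷ u) ++_) (++-identityʳ (h S.next)) ⟩
            hom (𝕓 ∷ u) ++ h S.next                                ≡⟨ cong (hom (𝕓 ∷ u) ++_) (take++drop≡id β (h S.next)) ⟨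
            hom (𝕓 ∷ u) ++ (take β (h S.next) ++ drop β (h S.next)) ≡⟨ cong (λ t → hom (𝕓 ∷ u) ++ (t ++ drop β (h S.next))) S.inner-prefix ⟩
            hom (𝕓 ∷ u) ++ ((S.inner ++ S.lost) ++ drop β (h S.next)) ≡⟨ cong (hom (𝕓 ∷ u) ++_) (++-assoc S.inner S.lost _) ⟩
            hom (𝕓 ∷ u) ++ (S.inner ++ (S.lost ++ drop β (h S.next))) ≡⟨ ++-assoc (hom (𝕓 ∷ u)) S.inner _ ⟨
            (hom (𝕓 ∷ u) ++ S.inner) ++ (S.lost ++ drop β (h S.next)) ≡⟨ cong (_++ (S.lost ++ drop β (h S.next))) (homU≡ S.inner) ⟨
            (P.lost ++ Z) ++ (S.lost ++ drop β (h S.next))         ∎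
            where open ≡-Reasoning

        Z+ : Z ++ S.outer ≡ P.inner ++ (hom u ++ s)
        Z+ = trans (++-assoc P.inner (hom u ++ S.inner) S.outer) (cong (P.inner ++_) (++-assoc (hom u) S.inner S.outer))

        -- The window for short squares consists of the last two blocks and the right end; these
        -- blocks exist because `u` has at least two letters.
        squareFree-Z+ : SquareFree (Z ++ S.outer)
        squareFree-Z+ with A , x , u≡ ← lastTwo 𝕒 b v = squareFree-append {X = X} {Y = Y} {g = S.marker} split≡ o≡ occ late Z-avoids
          (S.locally-squareFree λ x≡y → squareFree⇒adjacentDistinct sfxy {0} refl (cong just (sym x≡y))) squareFree-Z
          where
          X Y : Word Γ
          X = P.inner ++ hom A
          Y = (h x ++ h y) ++ s
          sfxy : SquareFree (x ∷ y ∷ [])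
          sfxy = squareFree-++⁻ʳ (𝕓 ∷ A) (subst (λ w → SquareFree (𝕓 ∷ w)) u≡ sfU)
          hom-u : hom u ≡ hom A ++ (h x ++ h y)
          hom-u = trans (cong hom u≡) (trans (hom-++ A (x ∷ y ∷ [])) (cong (λ w → hom A ++ (h x ++ w)) (++-identityʳ (h y))))
          split≡ : Z ++ S.outer ≡ X ++ Y
          split≡ = trans Z+ (trans (cong (λ w → P.inner ++ (w ++ s)) hom-u)
            (trans (cong (P.inner ++_) (++-assoc (hom A) (h x ++ h y) s)) (sym (++-assoc P.inner (hom A) Y))))
          length-Z : length Z ≡ length X + (L + (L + length S.inner))
          length-Z = begin
            length Z                                                   ≡⟨ cong (λ w → length (P.inner ++ (w ++ S.inner))) hom-u ⟩
            length (P.inner ++ ((hom A ++ (h x ++ h y)) ++ S.inner))   ≡⟨ cong length (trans (cong (P.inner ++_) (++-assoc (hom A) (h x ++ h y) S.inner)) (sym (++-assoc P.inner (hom A) _))) ⟩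
            length (X ++ ((h x ++ h y) ++ S.inner))                    ≡⟨ length-++ X ⟩
            length X + length ((h x ++ h y) ++ S.inner)                ≡⟨ cong (λ w → length X + length w) (++-assoc (h x) (h y) S.inner) ⟩
            length X + length (h x ++ (h y ++ S.inner))                ≡⟨ cong (length X +_) (trans (length-++ (h x)) (cong₂ _+_ (length-h x) (trans (length-++ (h y)) (cong (_+ length S.inner) (length-h y))))) ⟩
            length X + (L + (L + length S.inner))                      ∎
            where open ≡-Reasoning
          o≡ : length X + (L + S.start) + length S.marker ≡ suc (length Z)
          o≡ = begin
            length X + (L + S.start) + length S.marker    ≡⟨ trans (+-assoc (length X) (L + S.start) _) (cong (length X +_) (+-assoc L S.start _)) ⟩
            length X + (L + (S.start + length S.marker))  ≡⟨ cong (λ n → length X + (L + n)) S.start≡ ⟩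
            length X + (L + suc (L + length S.inner))     ≡⟨ cong (length X +_) (+-suc L _) ⟩
            length X + suc (L + (L + length S.inner))     ≡⟨ +-suc (length X) _ ⟩
            suc (length X + (L + (L + length S.inner)))   ≡⟨ cong suc length-Z ⟨
            suc (length Z)                                ∎
            where open ≡-Reasoning
          occ : Occurs S.marker (Z ++ S.outer) (length X + (L + S.start))
          occ = subst₂ (Occurs S.marker) (sym (trans split≡ (cong (X ++_) (++-assoc (h x) (h y) s))))
            (cong (λ n → length X + (n + S.start)) (length-h x)) (occurs-++ʳ {f = S.marker} X (occurs-++ʳ {f = S.marker} (h x) S.marker-occurs))
          late : length X + length (X ++ Y) ≤ suc (length X + (L + S.start)) + suc (length X + (L + S.start))
          late = begin
            length X + length (X ++ Y)                                    ≡⟨ cong (length X +_) (length-++ X) ⟩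
            length X + (length X + length Y)                              ≡⟨ cong (λ n → length X + (length X + n)) (trans (length-++ (h x ++ h y)) (cong (_+ length s) (trans (length-++ (h x)) (cong₂ _+_ (length-h x) (length-h y))))) ⟩
            length X + (length X + (L + L + length s))                    ≤⟨ +-monoʳ-≤ (length X) (+-monoʳ-≤ (length X) (+-monoʳ-≤ (L + L) S.marker-late)) ⟩
            length X + (length X + (L + L + (suc S.start + suc S.start))) ≡⟨ doubled (length X) L S.start ⟩
            suc (length X + (L + S.start)) + suc (length X + (L + S.start)) ∎
            where open ≤-Reasoning

        squareFree-W : SquareFree (P.outer ++ (Z ++ S.outer))
        squareFree-W = squareFree-prepend {P = P.outer} {Z = Z ++ S.outer} {X = P.word ++ (h 𝕒 ++ h b)} {Y = hom v ++ s} {f = P.marker} split≡ P.start≡ occ early avoids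
          (P.locally-squareFree λ 𝕒≡b → adU {1} refl (cong just (sym 𝕒≡b))) squareFree-Z+
          where
          whole≡ : P.outer ++ (Z ++ S.outer) ≡ P.word ++ (hom u ++ s)
          whole≡ = trans (cong (P.outer ++_) Z+) (sym (++-assoc P.outer P.inner _))
          split≡ : P.outer ++ (Z ++ S.outer) ≡ (P.word ++ (h 𝕒 ++ h b)) ++ (hom v ++ s)
          split≡ = trans whole≡ (trans (cong (P.word ++_) (trans (++-assoc (h 𝕒) (h b ++ hom v) s)
            (trans (cong (h 𝕒 ++_) (++-assoc (h b) (hom v) s)) (sym (++-assoc (h 𝕒) (h b) (hom v ++ s)))))) (sym (++-assoc P.word (h 𝕒 ++ h b) (hom v ++ s))))
          occ : Occurs P.marker (P.outer ++ (Z ++ S.outer)) P.start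
          occ = subst (λ w → Occurs P.marker w P.start) (sym (trans whole≡ (trans (cong (P.word ++_) (++-assoc (h 𝕒) (hom (b ∷ v)) s)) (sym (++-assoc P.word (h 𝕒) _)))))
            (occurs-++ˡ {f = P.marker} (P.word ++ h 𝕒) P.marker-occurs)
          early : (P.start + length P.marker) + (P.start + length P.marker) ≤ length (P.word ++ (h 𝕒 ++ h b))
          early = ≤-trans P.marker-early (≤-reflexive (sym (trans (length-++ P.word)
            (cong (length P.word +_) (trans (length-++ (h 𝕒)) (cong₂ _+_ (length-h 𝕒) (length-h b)))))))
          avoids : Avoids P.marker (Z ++ S.outer)
          avoids = subst (Avoids P.marker) (sym Z+) (avoids-suffix {f = P.marker} P.lost (subst (Avoids P.marker) (sym (homU≡ s))
            (avoids-hom {P.marker} P.marker-≤ P.marker-avoided 𝕓 u (λ {i} → adU {i}) (crossed y))))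

      -- Gaps up to the cut of the first block are closed by the test of the left end, all others by
      -- `closed-tail`, whose last window reaches the end of the word.
      extremalWord-extremal : ExtremalSquareFree extremalWord
      extremalWord-extremal = subst SquareFree (trans (cong (P.outer ++_) Z+) (sym (++-assoc P.outer P.inner _))) squareFree-W ,
        λ where e (w′ , w″ , z , eq , refl) sf → sf (insertion z w′ (trans split≡ (sym eq)))
        where
        q : Word Γ
        q = drop cut (h 𝕒) ++ (hom (b ∷ v) ++ s)
        split≡ : (P.word ++ take cut (h 𝕒)) ++ q ≡ extremalWord
        split≡ = trans (++-assoc P.word (take cut (h 𝕒)) q) (cong (P.word ++_)
          (trans (sym (++-assoc (take cut (h 𝕒)) (drop cut (h 𝕒)) _)) (trans (cong (_++ (hom (b ∷ v) ++ s)) (take++drop≡id cut (h 𝕒)))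
            (sym (++-assoc (h 𝕒) (hom (b ∷ v)) s)))))
        insertion : ∀ z w′ {w″} → (P.word ++ take cut (h 𝕒)) ++ q ≡ w′ ++ w″ → HasSquare (w′ ++ z ∷ w″)
        insertion z w′ {w″} eq with ++-split (P.word ++ take cut (h 𝕒)) {w′ = w′} eq
        ... | inj₁ (m″ , m≡ , refl) =
          subst HasSquare (trans (++-assoc w′ _ (hom (b ∷ v) ++ s)) (cong (λ t → w′ ++ z ∷ t) (++-assoc m″ (drop cut (h 𝕒)) (hom (b ∷ v) ++ s))))
            (hasSquare-++ʳ (hom (b ∷ v) ++ s) (closedAlong-sound [] _ (drop cut (h 𝕒)) P.locally-closed w′ m≡ z))
        ... | inj₂ (w‴ , refl , q≡) =
          subst HasSquare (sym (trans (++-assoc (P.word ++ take cut (h 𝕒)) w‴ (z ∷ w″)) (++-assoc P.word (take cut (h 𝕒)) (w‴ ++ z ∷ w″))))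
            (hasSquare-++ˡ P.word (closed-tail 𝕒 (b ∷ v) (λ {i} → adU {suc i}) S.locally-closed z q≡))

      length-extremalWord : length extremalWord ≡ length P.word + length u * L + length s
      length-extremalWord = begin
        length extremalWord                            ≡⟨ length-++ P.word ⟩
        length P.word + length (hom u ++ s)            ≡⟨ cong (length P.word +_) (length-++ (hom u)) ⟩
        length P.word + (length (hom u) + length s)    ≡⟨ cong (λ n → length P.word + (n + length s)) (length-hom u) ⟩
        length P.word + (length u * L + length s)      ≡⟨ +-assoc (length P.word) (length u * L) (length s) ⟨
        length P.word + length u * L + length s        ∎
        where open ≡-Reasoning

-- Decidable forms of the hypotheses on the morphism

∨-resolve : ∀ {a b} → a ≡ false → (a ∨ b) ≡ true → b ≡ true
∨-resolve refl h = h

≢⇒==-false : ∀ {x y} → x ≢ y → (x == y) ≡ false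
≢⇒==-false {x} {y} ne with x == y in eq
... | true  = contradiction (==⇒≡ x y eq) ne
... | false = refl

avoidsᵇ : Word Γ → Word Γ → Bool
avoidsᵇ f []          = not (prefixᵇ (length f) f [])
avoidsᵇ f w@(_ ∷ w′) = not (prefixᵇ (length f) f w) ∧ avoidsᵇ f w′

avoidsᵇ-sound : ∀ f w → avoidsᵇ f w ≡ true → Avoids f w
avoidsᵇ-sound f [] ok k occ
  with () ← trans (sym (not-true _ ok)) (prefixᵇ-complete (length f) f [] ≤-refl λ j< → sym (occ j<))
avoidsᵇ-sound f (x ∷ w) ok zero occ
  with () ← trans (sym (not-true _ (∧-conicalˡ _ (avoidsᵇ f w) ok))) (prefixᵇ-complete (length f) f (x ∷ w) ≤-refl λ j< → sym (occ j<))
avoidsᵇ-sound f (x ∷ w) ok (suc k) occ = avoidsᵇ-sound f w (∧-conicalʳ (not (prefixᵇ (length f) f (x ∷ w))) _ ok) k occ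

-- Words grow at the front, and a branch ends as soon as a square starts there; nothing is lost,
-- since suffixes of square-free words are square-free.
forAllSquareFree : ℕ → (Word Γ → Bool) → Word Γ → Bool
forAllSquareFree zero    P u = P u
forAllSquareFree (suc k) P u = P u ∧ every λ x → startsWithSquare ⌊ suc (length u) /2⌋ (x ∷ u) ∨ forAllSquareFree k P (x ∷ u)

forAllSquareFree-sound : ∀ k P u → forAllSquareFree k P u ≡ true → ∀ v → length v ≤ k → SquareFree (v ʳ++ u) → P (v ʳ++ u) ≡ true
forAllSquareFree-sound zero    P u ok []      _ _ = ok
forAllSquareFree-sound (suc k) P u ok []      _ _ = ∧-conicalˡ (P u) _ ok
forAllSquareFree-sound (suc k) P u ok (x ∷ v) (s≤s len) sf = forAllSquareFree-sound k P (x ∷ u)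
  (∨-resolve (no-square refl) (every-true (λ x → startsWithSquare ⌊ suc (length u) /2⌋ (x ∷ u) ∨ forAllSquareFree k P (x ∷ u))
    (∧-conicalʳ (P u) _ ok) x)) v len sf
  where
  no-square : ∀ {b} → b ≡ startsWithSquare ⌊ suc (length u) /2⌋ (x ∷ u) → b ≡ false
  no-square {false} _  = refl
  no-square {true}  eq = contradiction (hasSquare-ʳ++ v (startsWithSquare-sound ⌊ suc (length u) /2⌋ (x ∷ u) (sym eq))) sf

forAllSquareFree⇒ : ∀ k P → forAllSquareFree k P [] ≡ true → ∀ u → length u ≤ k → SquareFree u → P u ≡ true
forAllSquareFree⇒ k P ok u len sf = subst (λ w → P w ≡ true) rev
  (forAllSquareFree-sound k P [] ok (reverse u) (≤-trans (≤-reflexive (length-reverse u)) len) (subst SquareFree (sym rev) sf))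
  where
  rev : reverse u ʳ++ [] ≡ u
  rev = trans (ʳ++-defn (reverse u)) (trans (++-identityʳ _) (reverse-involutive u))

endsIn : Γ → Word Γ → Bool
endsIn d []      = false
endsIn d (x ∷ u) = lastOf x u == d

lastOf-≢ : ∀ {x : Γ} u {d} → AdjacentDistinct (x ∷ u ++ d ∷ []) → lastOf x u ≢ d
lastOf-≢ []      ad eq = ad {0} refl (cong just (sym eq))
lastOf-≢ (y ∷ u) ad eq = lastOf-≢ u (λ {i} → ad {suc i}) eq

module Family (h : Γ → Word Γ) (M : ℕ) (length-h : ∀ y → length (h y) ≡ suc M)
  (apart : ∀ {a b r} → r < suc M → h a ! r ≡ h b ! r → a ≡ b)
  (synchronisedᵇ : every (λ a → every λ b → every λ c → (b == c) ∨ avoidsᵇ (h a) (drop 1 (h b ++ take M (h c)))) ≡ true)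
  where

  -- At the offsets 0 and `suc M` the blocks `h b` and `h c` themselves occur. Removing the first
  -- letter of `h b` and the last one of `h c` keeps exactly these two offsets out of the check.
  synchronised : ∀ {a b c ρ} → b ≢ c → 0 < ρ → ρ < suc M → ¬ (∀ {j} → j < suc M → h a ! j ≡ (h b ++ h c) ! (ρ + j))
  synchronised {a} {b} {c} {suc ρ} b≢c _ ρ< same = avoidsᵇ-sound (h a) (drop 1 w) check ρ λ {j} j< →
      let j<L = ≤-trans j< (≤-reflexive (length-h a)) in
      trans (!-drop 1 w (ρ + j)) (trans (sym (!-++ˡ w (inside j<L)))
        (trans (cong (_! (suc ρ + j)) rejoin) (sym (same j<L))))
    where
    w : Word Γ
    w = h b ++ take M (h c)
    rejoin : w ++ drop M (h c) ≡ h b ++ h c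
    rejoin = trans (++-assoc (h b) (take M (h c)) _) (cong (h b ++_) (take++drop≡id M (h c)))
    inside : ∀ {j} → j < suc M → suc ρ + j < length w
    inside {j} j<L = ≤-trans (+-mono-≤ ρ< (≤-pred j<L)) (≤-reflexive (sym (trans (length-++ (h b))
      (cong₂ _+_ (length-h b) (trans (length-take M (h c)) (trans (cong (M ⊓_) (length-h c)) (m≤n⇒m⊓n≡m (n≤1+n M))))))))
    check : avoidsᵇ (h a) (drop 1 w) ≡ true
    check = ∨-resolve (≢⇒==-false b≢c)
      (every₃-true (λ a b c → (b == c) ∨ avoidsᵇ (h a) (drop 1 (h b ++ take M (h c)))) synchronisedᵇ a b c)

  open Morphism h (suc M) length-h apart synchronised public
  open Extension h (suc M) length-h apart synchronised public

  record Short : Set where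
    constructor checked
    field holds : forAllSquareFree 5 (λ u → squareFreeᵇ (hom u)) [] ≡ true

  record ShortEnd (β : ℕ) : Set where
    constructor checked
    field holds : forAllSquareFree 4 (λ u → every λ d → endsIn d u ∨ squareFreeᵇ (hom u ++ take β (h d))) [] ≡ true

  record ClosedBetween (cut : ℕ) : Set where
    constructor checked
    field holds : every (λ a → every λ b → (a == b) ∨ closedAlong (reverse (take cut (h a))) (drop cut (h a) ++ take cut (h b)) (drop cut (h b))) ≡ true

  module _ (shortᵇ : Short) where

    short : ∀ u → length u ≤ 5 → SquareFree u → SquareFree (hom u)
    short u len sf = squareFreeᵇ-sound (hom u) (forAllSquareFree⇒ 5 (λ u → squareFreeᵇ (hom u)) (Short.holds shortᵇ) u len sf)

  module _ (β : ℕ)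
    (shortEndᵇ : ShortEnd β) where

    shortEnd : ∀ u d → length u ≤ 4 → SquareFree u → AdjacentDistinct (u ++ d ∷ []) → SquareFree (hom u ++ take β (h d))
    shortEnd u d len sf ad = squareFreeᵇ-sound (hom u ++ take β (h d)) (∨-resolve (not-last u ad)
      (every-true (λ d → endsIn d u ∨ squareFreeᵇ (hom u ++ take β (h d)))
        (forAllSquareFree⇒ 4 (λ u → every λ d → endsIn d u ∨ squareFreeᵇ (hom u ++ take β (h d))) (ShortEnd.holds shortEndᵇ) u len sf) d))
      where
      not-last : ∀ u → AdjacentDistinct (u ++ d ∷ []) → endsIn d u ≡ false
      not-last []      ad = refl
      not-last (x ∷ u) ad = ≢⇒==-false (lastOf-≢ u (λ {i} → ad {i}))

  module _ (cut : ℕ) (closedBetweenᵇ : ClosedBetween cut) where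

    closedBetween : ∀ {a b} → a ≢ b → closedAlong (reverse (take cut (h a))) (drop cut (h a) ++ take cut (h b)) (drop cut (h b)) ≡ true
    closedBetween {a} {b} a≢b = ∨-resolve (≢⇒==-false a≢b)
      (every-true (λ b → (a == b) ∨ closedAlong (reverse (take cut (h a))) (drop cut (h a) ++ take cut (h b)) (drop cut (h b)))
        (every-true (λ a → every λ b → (a == b) ∨ closedAlong (reverse (take cut (h a))) (drop cut (h a) ++ take cut (h b)) (drop cut (h b))) (ClosedBetween.holds closedBetweenᵇ) a) b)

-- The morphism and its end words

-- Addition modulo 3.
rot : Γ → Γ → Γ
rot 𝕒 x = x
rot 𝕓 𝕒 = 𝕓
rot 𝕓 𝕓 = 𝕔
rot 𝕓 𝕔 = 𝕒
rot 𝕔 𝕒 = 𝕔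
rot 𝕔 𝕓 = 𝕒
rot 𝕔 𝕔 = 𝕓

base : Word Γ
base =
  𝕒 ∷ 𝕓 ∷ 𝕔 ∷ 𝕒 ∷ 𝕔 ∷ 𝕓 ∷ 𝕒 ∷ 𝕔 ∷ 𝕒 ∷ 𝕓 ∷ 𝕔 ∷ 𝕓 ∷ 𝕒 ∷ 𝕔 ∷ 𝕓 ∷ 𝕔 ∷ 𝕒 ∷ 𝕔 ∷
  𝕓 ∷ 𝕒 ∷ 𝕓 ∷ 𝕔 ∷ 𝕓 ∷ 𝕒 ∷ 𝕔 ∷ 𝕓 ∷ 𝕔 ∷ 𝕒 ∷ 𝕓 ∷ 𝕒 ∷ 𝕔 ∷ 𝕓 ∷ 𝕒 ∷ 𝕓 ∷ 𝕔 ∷ 𝕒 ∷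
  𝕓 ∷ 𝕒 ∷ 𝕔 ∷ 𝕓 ∷ 𝕔 ∷ 𝕒 ∷ 𝕓 ∷ 𝕔 ∷ 𝕓 ∷ 𝕒 ∷ 𝕔 ∷ 𝕒 ∷ 𝕓 ∷ 𝕔 ∷ 𝕒 ∷ 𝕔 ∷ 𝕓 ∷ 𝕒 ∷ []

h : Γ → Word Γ
h y = map (rot y) base

length-h : ∀ y → length (h y) ≡ 54
length-h y = length-map (rot y) base

rot-injective : ∀ a b x → rot a x ≡ rot b x → a ≡ b
rot-injective a b x eq = ==⇒≡ a b (∨-resolve {not (rot a x == rot b x)}
  (cong not (trans (cong (_== rot b x) eq) (==-refl (rot b x))))
  (every₃-true (λ a b x → not (rot a x == rot b x) ∨ (a == b)) refl a b x))

apart : ∀ {a b r} → r < 54 → h a ! r ≡ h b ! r → a ≡ b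
apart {a} {b} {r} r< eq with x , base!r ← !-just base r< = rot-injective a b x (just-injective
  (trans (sym (trans (!-map (rot a) base r) (cong (Maybe.map (rot a)) base!r)))
    (trans eq (trans (!-map (rot b) base r) (cong (Maybe.map (rot b)) base!r)))))

-- An end word consists of a factor of a block and of an outer part, given by its length and code.
record LeftCode : Set where
  constructor leftCode
  field outerLength outerCode innerLength markerLength : ℕ

record RightCode : Set where
  constructor rightCode
  field
    difference : Γ
    innerLength outerLength outerCode markerLength : ℕ

sizeˡ : LeftCode → ℕ
sizeˡ l = LeftCode.outerLength l + LeftCode.innerLength l

sizeʳ : RightCode → ℕ
sizeʳ r = RightCode.innerLength r + RightCode.outerLength r

occurs-take-drop : ∀ n k (w : Word Γ) → Occurs (take n (drop k w)) w k
occurs-take-drop n k w {j} j< = begin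
  w ! (k + j)                                       ≡⟨ !-drop k w j ⟨
  drop k w ! j                                      ≡⟨ cong (_! j) (take++drop≡id n (drop k w)) ⟨
  (take n (drop k w) ++ drop n (drop k w)) ! j      ≡⟨ !-++ˡ (take n (drop k w)) j< ⟩
  take n (drop k w) ! j                             ∎
  where open ≡-Reasoning

≡ᵇ-true : ∀ m n → (m ≡ᵇ n) ≡ true → m ≡ n
≡ᵇ-true m n eq = ≡ᵇ⇒≡ m n (Equivalence.from T-≡ eq)

≤ᵇ-true : ∀ m n → (m ≤ᵇ n) ≡ true → m ≤ n
≤ᵇ-true m n eq = ≤ᵇ⇒≤ m n (Equivalence.from T-≡ eq)

allTrue : List Bool → Bool
allTrue []           = true
allTrue (false ∷ bs) = false
allTrue (true ∷ bs)  = allTrue bs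

allTrue-sound : ∀ bs → allTrue bs ≡ true → All (_≡ true) bs
allTrue-sound []          _  = []
allTrue-sound (true ∷ bs) ok = refl ∷ allTrue-sound bs ok

every₂-true : ∀ (f : Γ → Γ → Bool) → every (λ a → every (f a)) ≡ true → ∀ a b → f a b ≡ true
every₂-true f ok a b = every-true (f a) (every-true (λ a → every (f a)) ok a) b

module Ends (h : Γ → Word Γ) (L cut β : ℕ) where

  avoidedᵇ : Word Γ → Bool
  avoidedᵇ f = every λ a → every λ b → (a == b) ∨ avoidsᵇ f (h a ++ h b)

  avoidedᵇ-sound : ∀ f → avoidedᵇ f ≡ true → ∀ {a b} → a ≢ b → Avoids f (h a ++ h b)
  avoidedᵇ-sound f ok {a} {b} a≢b = avoidsᵇ-sound f (h a ++ h b)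
    (∨-resolve (≢⇒==-false a≢b) (every₂-true (λ a b → (a == b) ∨ avoidsᵇ f (h a ++ h b)) ok a b))

  module Left (outer inner marker : Word Γ) (start : ℕ) where

    leftChecks : List Bool
    leftChecks =
      (suc start ≡ᵇ length outer) ∷
      (length marker ≤ᵇ suc L) ∷
      avoidedᵇ marker ∷
      ((start + length marker) + (start + length marker) ≤ᵇ length (outer ++ inner) + (L + L)) ∷
      every (λ y → (𝕒 == y) ∨ squareFreeᵇ ((outer ++ inner) ++ (h 𝕒 ++ h y))) ∷
      closedAlong [] ((outer ++ inner) ++ take cut (h 𝕒)) (drop cut (h 𝕒)) ∷ []

    leftEnd : ∀ {lost} → h 𝕓 ≡ lost ++ inner → Occurs marker ((outer ++ inner) ++ h 𝕒) start →
              All (_≡ true) leftChecks → LeftEnd h L cut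
    leftEnd {lost} suffix occ cs = record
      { outer = outer ; inner = inner ; lost = lost ; inner-suffix = suffix ; marker = marker ; start = start
      ; start≡ = ≡ᵇ-true _ _ (All.head cs)
      ; marker-≤ = ≤ᵇ-true _ _ (All.head (All.tail cs))
      ; marker-occurs = occ
      ; marker-avoided = avoidedᵇ-sound marker (All.head (All.tail (All.tail cs)))
      ; marker-early = ≤ᵇ-true _ _ (All.head (All.tail (All.tail (All.tail cs))))
      ; locally-squareFree = λ {y} 𝕒≢y → squareFreeᵇ-sound _ (∨-resolve (≢⇒==-false 𝕒≢y)
          (every-true (λ y → (𝕒 == y) ∨ squareFreeᵇ ((outer ++ inner) ++ (h 𝕒 ++ h y))) (All.head (All.tail (All.tail (All.tail (All.tail cs))))) y))
      ; locally-closed = (All.head (All.tail (All.tail (All.tail (All.tail (All.tail cs)))))) }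

  module Right (y next : Γ) (inner outer marker : Word Γ) (start : ℕ) where

    rightChecks : List Bool
    rightChecks =
      not (y == next) ∷
      (start + length marker ≡ᵇ suc (L + length inner)) ∷
      (length marker ≤ᵇ suc L) ∷
      avoidedᵇ marker ∷
      (length (inner ++ outer) ≤ᵇ suc start + suc start) ∷
      every (λ x → (x == y) ∨ squareFreeᵇ ((h x ++ h y) ++ (inner ++ outer))) ∷
      closedAlong (reverse (take cut (h y))) (drop cut (h y) ++ (inner ++ outer)) [] ∷ []

    rightEnd : ∀ {lost} → take β (h next) ≡ inner ++ lost → Occurs marker (h y ++ (inner ++ outer)) start →
               All (_≡ true) rightChecks → RightEnd h L cut β y
    rightEnd {lost} prefix occ cs = record
      { next = next ; next≢ = λ { refl → contradiction (trans (sym (cong not (==-refl y))) (All.head cs)) λ () }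
      ; outer = outer ; inner = inner ; lost = lost ; inner-prefix = prefix ; marker = marker ; start = start
      ; start≡ = ≡ᵇ-true _ _ (All.head (All.tail cs))
      ; marker-≤ = ≤ᵇ-true _ _ (All.head (All.tail (All.tail cs)))
      ; marker-occurs = occ
      ; marker-avoided = avoidedᵇ-sound marker (All.head (All.tail (All.tail (All.tail cs))))
      ; marker-late = ≤ᵇ-true _ _ (All.head (All.tail (All.tail (All.tail (All.tail cs)))))
      ; locally-squareFree = λ {x} x≢y → squareFreeᵇ-sound _ (∨-resolve (≢⇒==-false x≢y)
          (every-true (λ x → (x == y) ∨ squareFreeᵇ ((h x ++ h y) ++ (inner ++ outer))) (All.head (All.tail (All.tail (All.tail (All.tail (All.tail cs)))))) x))
      ; locally-closed = (All.head (All.tail (All.tail (All.tail (All.tail (All.tail (All.tail cs))))))) }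

  module LeftOf (c : LeftCode) where

    open LeftCode c

    outer inner marker : Word Γ
    outer  = decode outerLength outerCode []
    inner  = drop (L ∸ innerLength) (h 𝕓)
    marker = take markerLength (drop (outerLength ∸ 1) ((outer ++ inner) ++ h 𝕒))

    checks : List Bool
    checks = (length (outer ++ inner) ≡ᵇ sizeˡ c) ∷ Left.leftChecks outer inner marker (outerLength ∸ 1)

    validᵇ : Bool
    validᵇ = allTrue checks

    end : validᵇ ≡ true → LeftEnd h L cut
    end ok = Left.leftEnd outer inner marker (outerLength ∸ 1) (sym (take++drop≡id (L ∸ innerLength) (h 𝕓)))
      (occurs-take-drop markerLength (outerLength ∸ 1) ((outer ++ inner) ++ h 𝕒)) (All.tail (allTrue-sound checks ok))

    length-end : ∀ ok → length (LeftEnd.word (end ok)) ≡ sizeˡ c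
    length-end ok = ≡ᵇ-true _ _ (All.head (allTrue-sound checks ok))

  module RightOf (c : RightCode) where

    open RightCode c

    start : ℕ
    -- The marker ends with the first letter of `outer`, which stands right after the
    -- `L + innerLength` letters of `h y` and `inner`.
    start = suc (L + innerLength) ∸ markerLength

    module _ (y : Γ) where

      inner outer marker : Word Γ
      -- A code describes the end for `𝕒`, and rotation by `y` gives the others. A `difference`
      -- other than `𝕒` makes the next letter differ from `y`.
      inner  = take innerLength (take β (h (rot y difference)))
      outer  = map (rot y) (decode outerLength outerCode [])
      marker = take markerLength (drop start (h y ++ (inner ++ outer)))

      checks : List Bool
      checks = (length (inner ++ outer) ≡ᵇ sizeʳ c) ∷ Right.rightChecks y (rot y difference) inner outer marker start

    validᵇ : Bool
    validᵇ = every λ y → allTrue (checks y)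

    private
      valid : validᵇ ≡ true → ∀ y → All (_≡ true) (checks y)
      valid ok y = allTrue-sound (checks y) (every-true (λ y → allTrue (checks y)) ok y)

    end : validᵇ ≡ true → ∀ y → RightEnd h L cut β y
    end ok y = Right.rightEnd y (rot y difference) (inner y) (outer y) (marker y) start (sym (take++drop≡id innerLength (take β (h (rot y difference)))))
      (occurs-take-drop markerLength start (h y ++ (inner y ++ outer y))) (All.tail (valid ok y))

    length-end : ∀ ok y → length (RightEnd.word (end ok y)) ≡ sizeʳ c
    length-end ok y = ≡ᵇ-true _ _ (All.head (valid ok y))

  crossedᵇ : LeftCode → RightCode → Bool
  crossedᵇ l r = every λ y → avoidsᵇ (LeftOf.marker l) (h y ++ (RightOf.inner r y ++ RightOf.outer r y))

  crossedᵇ-sound : ∀ l r okˡ okʳ → crossedᵇ l r ≡ true →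
                   ∀ y → Avoids (LeftEnd.marker (LeftOf.end l okˡ)) (h y ++ RightEnd.word (RightOf.end r okʳ y))
  crossedᵇ-sound l r okˡ okʳ ok y = avoidsᵇ-sound (LeftOf.marker l) (h y ++ (RightOf.inner r y ++ RightOf.outer r y))
    (every-true (λ y → avoidsᵇ (LeftOf.marker l) (h y ++ (RightOf.inner r y ++ RightOf.outer r y))) ok y)

  record AllLeft (ls : List LeftCode) : Set where
    constructor checked
    field holds : all LeftOf.validᵇ ls ≡ true

  record AllRight (rs : List RightCode) : Set where
    constructor checked
    field holds : all RightOf.validᵇ rs ≡ true

  record AllCrossed (ls : List LeftCode) (rs : List RightCode) : Set where
    constructor checked
    field holds : all (λ l → all (crossedᵇ l) rs) ls ≡ true

leftCodes : List LeftCode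
leftCodes =
  leftCode 24 213546150209 7 34 ∷
  leftCode 28 9657712698942 6 33 ∷
  leftCode 47 20103913406998382028222 6 33 ∷
  leftCode 49 64208123493743354100312 6 33 ∷
  leftCode 49 45581518703460223064499 17 36 ∷
  leftCode 50 284881654793645861832158 24 26 ∷ []

rightCodes : List RightCode
rightCodes =
  rightCode 𝕓 7 17 94723036 27 ∷
  rightCode 𝕓 6 49 47847438743681632415424 5 ∷
  rightCode 𝕓 6 50 143495214578417597432542 5 ∷
  rightCode 𝕔 17 43 46919827004894509543 19 ∷
  rightCode 𝕓 6 55 34880782843176118599528056 5 ∷
  rightCode 𝕓 7 55 127926381159745830754805854 27 ∷
  rightCode 𝕓 6 59 2824416308555703688704286147 5 ∷
  rightCode 𝕓 6 60 8476015315023003829968726420 5 ∷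
  rightCode 𝕔 36 34 7155861867931318 19 ∷
  rightCode 𝕓 6 65 2059671725020758103029693691261 5 ∷
  rightCode 𝕓 25 47 16037671575327422294179 11 ∷
  rightCode 𝕔 36 40 5216623301721929559 19 ∷ []

all-true : ∀ {A : Set} (p : A → Bool) xs → all p xs ≡ true → ∀ {x} → x ∈ xs → p x ≡ true
all-true p (x ∷ xs) ok (here refl) = ∧-conicalˡ (p x) _ ok
all-true p (x ∷ xs) ok (there x∈)  = all-true p xs (∧-conicalʳ (p x) _ ok) x∈

any-true : ∀ {A : Set} (p : A → Bool) xs → any p xs ≡ true → ∃[ x ] x ∈ xs × p x ≡ true
any-true p (x ∷ xs) ok with p x in eq
... | true  = x , here refl , eq
... | false with y , y∈ , py ← any-true p xs ok = y , there y∈ , py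

different : ∀ (a : Γ) → ∃[ c ] a ≢ c
different 𝕒 = 𝕓 , λ ()
different 𝕓 = 𝕒 , λ ()
different 𝕔 = 𝕒 , λ ()

module Lengths (h : Γ → Word Γ) (M : ℕ) (length-h : ∀ y → length (h y) ≡ suc M)
  (apart : ∀ {a b r} → r < suc M → h a ! r ≡ h b ! r → a ≡ b)
  (synchronisedᵇ : every (λ a → every λ b → every λ c → (b == c) ∨ avoidsᵇ (h a) (drop 1 (h b ++ take M (h c)))) ≡ true)
  where

  open Family h M length-h apart synchronisedᵇ public
  open Assembly h (suc M) length-h apart synchronised

  module _ (shortᵇ : Short)
    {β : ℕ} (β<L : β < suc M)
    (shortEndᵇ : ShortEnd β)
    {cut : ℕ}
    (closedBetweenᵇ : ClosedBetween cut)
    {pre post : Word Γ} {c : Γ} (h𝕒 : h 𝕒 ≡ 𝕒 ∷ pre ++ 𝕓 ∷ 𝕒 ∷ c ∷ post)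
    where

    open Ends h (suc M) cut β

    squareFree-image : ∀ U → SquareFree U → SquareFree (hom U)
    squareFree-image []      sf = squareFreeᵇ-sound [] refl
    squareFree-image (y ∷ v) sf with d , ne ← different (lastOf y v) = squareFree-++⁻ˡ (hom (y ∷ v))
      (squareFree-hom (short shortᵇ) β<L (shortEnd β shortEndᵇ) (y ∷ v) d sf
        (λ {i} → adjacentDistinct-∷ʳ v (λ {i} → squareFree⇒adjacentDistinct sf {i}) ne {i}))

    -- As `h 𝕒` begins with `𝕒`, each iterate is a prefix of the next; this provides square-free
    -- words of unbounded length.
    iterate : ℕ → Word Γ
    iterate zero    = 𝕒 ∷ []
    iterate (suc n) = hom (iterate n)

    squareFree-iterate : ∀ n → SquareFree (iterate n)
    squareFree-iterate zero    = squareFreeᵇ-sound (𝕒 ∷ []) refl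
    squareFree-iterate (suc n) = squareFree-image (iterate n) (squareFree-iterate n)

    iterate-suc : ∀ n {r} → iterate n ≡ 𝕒 ∷ r → iterate (suc n) ≡ 𝕒 ∷ pre ++ 𝕓 ∷ 𝕒 ∷ c ∷ post ++ hom r
    iterate-suc n {r} eq = trans (cong hom eq) (trans (cong (_++ hom r) h𝕒) (cong (𝕒 ∷_) (++-assoc pre (𝕓 ∷ 𝕒 ∷ c ∷ post) (hom r))))

    length-hom-≥ : ∀ r → length r ≤ length (hom r)
    length-hom-≥ r = ≤-trans (m≤m*n (length r) (suc M)) (≤-reflexive (sym (length-hom r)))

    iterate-shape : ∀ n → ∃[ r ] iterate n ≡ 𝕒 ∷ r × n ≤ length r
    iterate-shape zero    = [] , refl , z≤n
    iterate-shape (suc n) with r , eq , n≤r ← iterate-shape n = _ , iterate-suc n eq , (begin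
      suc n                                              ≤⟨ s≤s (≤-trans n≤r (length-hom-≥ r)) ⟩
      suc (length (hom r))                               ≤⟨ s≤s (m≤n+m _ (length (𝕒 ∷ c ∷ post))) ⟩
      suc (length (𝕒 ∷ c ∷ post) + length (hom r))       ≡⟨ cong suc (length-++ (𝕒 ∷ c ∷ post)) ⟨
      length (𝕓 ∷ 𝕒 ∷ c ∷ post ++ hom r)                 ≤⟨ m≤n+m _ (length pre) ⟩
      length pre + length (𝕓 ∷ 𝕒 ∷ c ∷ post ++ hom r)    ≡⟨ length-++ pre ⟨
      length (pre ++ 𝕓 ∷ 𝕒 ∷ c ∷ post ++ hom r)          ∎)
      where open ≤-Reasoning

    -- The leading block `h 𝕒` of an iterate contains `𝕓`, `𝕒`, `c`, the start that the assembly
    -- demands of the preimage, and enough letters follow in a later iterate.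
    squareFree-ofLength : ∀ k → ∃[ v ] length v ≡ k × SquareFree (𝕓 ∷ 𝕒 ∷ c ∷ v)
    squareFree-ofLength k with r , eq , k≤r ← iterate-shape k = take k (post ++ hom r) ,
      trans (length-take k (post ++ hom r)) (m≤n⇒m⊓n≡m (≤-trans k≤r (≤-trans (length-hom-≥ r)
        (≤-trans (m≤n+m _ (length post)) (≤-reflexive (sym (length-++ post))))))) ,
      squareFree-++⁻ˡ (𝕓 ∷ 𝕒 ∷ c ∷ take k (post ++ hom r))
        (subst (λ t → SquareFree (𝕓 ∷ 𝕒 ∷ c ∷ t)) (sym (take++drop≡id k (post ++ hom r)))
          (squareFree-++⁻ʳ (𝕒 ∷ pre) (subst SquareFree (iterate-suc k eq) (squareFree-iterate (suc k)))))

    module _ {ls rs} (leftsᵇ : AllLeft ls) (rightsᵇ : AllRight rs) (crossedsᵇ : AllCrossed ls rs) where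

      family : ∀ {l r} → l ∈ ls → r ∈ rs → ∀ k → HasExtremal (sizeˡ l + (2 + k) * suc M + sizeʳ r)
      family {l} {r} l∈ r∈ k with v , length-v , sf ← squareFree-ofLength k =
        extremalWord short′ β<L shortEnd′ closed′ left right crossed sf ,
        extremalWord-extremal short′ β<L shortEnd′ closed′ left right crossed sf ,
        trans (length-extremalWord short′ β<L shortEnd′ closed′ left right crossed sf)
          (cong₂ _+_ (cong₂ _+_ (LeftOf.length-end l okˡ) (cong (λ n → (2 + n) * suc M) length-v))
            (RightOf.length-end r okʳ (lastOf c v)))
        where
        short′ = short shortᵇ
        shortEnd′ = shortEnd β shortEndᵇ
        closed′ : ∀ {a b} → a ≢ b → closedAlong (reverse (take cut (h a))) (drop cut (h a) ++ take cut (h b)) (drop cut (h b)) ≡ true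
        closed′ = closedBetween cut closedBetweenᵇ
        okˡ : LeftOf.validᵇ l ≡ true
        okˡ = all-true LeftOf.validᵇ ls (AllLeft.holds leftsᵇ) l∈
        okʳ : RightOf.validᵇ r ≡ true
        okʳ = all-true RightOf.validᵇ rs (AllRight.holds rightsᵇ) r∈
        left : LeftEnd h (suc M) cut
        left = LeftOf.end l okˡ
        right : ∀ y → RightEnd h (suc M) cut β y
        right = RightOf.end r okʳ
        crossed : ∀ y → Avoids (LeftEnd.marker left) (h y ++ RightEnd.word (right y))
        crossed = crossedᵇ-sound l r okˡ okʳ (all-true (crossedᵇ l) rs (all-true (λ l → all (crossedᵇ l) rs) ls (AllCrossed.holds crossedsᵇ) l∈) r∈)

synchronisedᵇ : every (λ a → every λ b → every λ c → (b == c) ∨ avoidsᵇ (h a) (drop 1 (h b ++ take 53 (h c)))) ≡ true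
synchronisedᵇ = refl

open Lengths h 53 length-h apart synchronisedᵇ using (Short; ShortEnd; ClosedBetween)
-- The cut 27 is half a block, and 36 is the largest inner length among `rightCodes`.
open Ends h (suc 53) 27 36 using (AllLeft; AllRight; AllCrossed)

shortᵇ : Short
shortᵇ = record { holds = refl }

shortEndᵇ : ShortEnd 36
shortEndᵇ = record { holds = refl }

closedBetweenᵇ : ClosedBetween 27
closedBetweenᵇ = record { holds = refl }

leftsᵇ : AllLeft leftCodes
leftsᵇ = record { holds = refl }

rightsᵇ : AllRight rightCodes
rightsᵇ = record { holds = refl }

crossedsᵇ : AllCrossed leftCodes rightCodes
crossedsᵇ = record { holds = refl }

longWords : ∀ {l r} → l ∈ leftCodes → r ∈ rightCodes → ∀ k → HasExtremal (sizeˡ l + (2 + k) * 54 + sizeʳ r)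
longWords = Lengths.family h 53 length-h apart synchronisedᵇ shortᵇ {36} (<ᵇ⇒< 36 54 _) shortEndᵇ {27} closedBetweenᵇ
  -- The letters 5, 6, 7 of `h 𝕒`, counted from 0, are `𝕓`, `𝕒`, `𝕔`.
  {pre = take 4 (drop 1 (h 𝕒))} {post = drop 8 (h 𝕒)} refl {leftCodes} {rightCodes} leftsᵇ rightsᵇ crossedsᵇ

residueᵇ : ℕ → LeftCode → RightCode → Bool
residueᵇ ρ l r = ((sizeˡ l + sizeʳ r) % 54 ≡ᵇ ρ) ∧ (sizeˡ l + sizeʳ r ≤ᵇ 142)

residues : all (λ ρ → any (λ l → any (residueᵇ ρ l) rightCodes) leftCodes) (upTo 54) ≡ true
residues = refl

-- For a pair of ends whose total length `t` has the residue of `n`, the rest is a whole number of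
-- blocks. Since `t` is at most 142 and `n` at least 250, at least 108 = 2 * 54 letters remain, the
-- two blocks that the assembly needs.
longLengths : ∀ n → 250 ≤ n → HasExtremal n
longLengths n 250≤n
  with l , l∈ , ok ← any-true (λ l → any (residueᵇ (n % 54) l) rightCodes) leftCodes
         (all-true (λ ρ → any (λ l → any (residueᵇ ρ l) rightCodes) leftCodes) (upTo 54) residues (∈-upTo⁺ (m%n<n n 54)))
  with r , r∈ , ok ← any-true (residueᵇ (n % 54) l) rightCodes ok = subst HasExtremal size≡ (longWords l∈ r∈ (k ∸ 2))
  where
  open ≡-Reasoning
  t k : ℕ
  t = sizeˡ l + sizeʳ r
  k = n / 54 ∸ t / 54
  t%≡ : t % 54 ≡ n % 54
  t%≡ = ≡ᵇ-true _ _ (∧-conicalˡ (t % 54 ≡ᵇ n % 54) _ ok)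
  t≤ : t ≤ 142
  t≤ = ≤ᵇ-true _ _ (∧-conicalʳ (t % 54 ≡ᵇ n % 54) _ ok)
  n≡ : n ≡ t + k * 54
  n≡ = begin
    n                                     ≡⟨ m≡m%n+[m/n]*n n 54 ⟩
    n % 54 + n / 54 * 54                  ≡⟨ cong₂ (λ a b → a + b * 54) (sym t%≡) (sym (m+[n∸m]≡n (/-monoˡ-≤ 54 (≤-trans t≤ (≤-trans (m≤m+n 142 108) 250≤n))))) ⟩
    t % 54 + (t / 54 + k) * 54            ≡⟨ cong (t % 54 +_) (*-distribʳ-+ 54 (t / 54) k) ⟩
    t % 54 + (t / 54 * 54 + k * 54)       ≡⟨ +-assoc (t % 54) _ _ ⟨
    t % 54 + t / 54 * 54 + k * 54         ≡⟨ cong (_+ k * 54) (m≡m%n+[m/n]*n t 54) ⟨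
    t + k * 54                            ∎
  2≤k : 2 ≤ k
  -- With at most one block, `n` would be at most 142 + 54 = 196.
  2≤k = ≰⇒> λ k≤1 → contradiction (≤-trans 250≤n (≤-trans (≤-reflexive n≡) (+-mono-≤ t≤ (*-monoˡ-≤ 54 k≤1)))) (<⇒≱ (<ᵇ⇒< 196 250 _))
  size≡ : sizeˡ l + (2 + (k ∸ 2)) * 54 + sizeʳ r ≡ n
  size≡ = begin
    sizeˡ l + (2 + (k ∸ 2)) * 54 + sizeʳ r   ≡⟨ cong (λ j → sizeˡ l + j * 54 + sizeʳ r) (m+[n∸m]≡n 2≤k) ⟩
    sizeˡ l + k * 54 + sizeʳ r               ≡⟨ +-assoc (sizeˡ l) (k * 54) (sizeʳ r) ⟩
    sizeˡ l + (k * 54 + sizeʳ r)             ≡⟨ cong (sizeˡ l +_) (+-comm (k * 54) (sizeʳ r)) ⟩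
    sizeˡ l + (sizeʳ r + k * 54)             ≡⟨ +-assoc (sizeˡ l) (sizeʳ r) (k * 54) ⟨
    t + k * 54                               ≡⟨ n≡ ⟨
    n                                        ∎

-- Explicit words

exceptionalWords : List ℕ
exceptionalWords =
  161390761313 ∷
  5132504493999607750 ∷
  11401510140275919233082 ∷
  102554751447747851010918 ∷
  161063387811022605871852448782 ∷
  1056737135826069459800963041429580 ∷
  3218276767264689174527417094041694 ∷
  782489943456676445502384372201326763 ∷
  6933382957116125253106325825205238502 ∷
  63345341631786445694950471112929833929 ∷
  760171494654545415369366164895296717298 ∷
  1684812058579303348922394519764063414224 ∷
  4964213937888912498943892033473422929566 ∷ []

mediumWords : List ℕ
mediumWords =
  45489068656243916561828944067246194700582 ∷
  138536262148716956734856681428277034440338 ∷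
  409401625536620281555887457023536585937198 ∷
  1246826359346856982184991057905884397173008 ∷
  3684683972112936424093430496377076224993628 ∷
  11054051916338809272280297848660935784429071 ∷
  33161523255079831812447884725011947869121950 ∷
  100992935103434655742162081100692923983788632 ∷
  298459401741147850351554864983335085796539180 ∷
  908936415957731953137394861794877206370721074 ∷
  2686134615670330653163993784820402519724730053 ∷
  8058403847010991959491996393801402609553086138 ∷
  24175211541031908559328818499712317406496226531 ∷
  72524270120742305609163616019470811343368253842 ∷
  217572810362226916827490849174818458952033900664 ∷
  652718431086680750482472544175166904869288279664 ∷
  1958155283491263171453081754498117003645514907894 ∷
  5874576404471013138469654510418095620949548369693 ∷
  17623397222956591057985884310854826606423232053850 ∷
  52870191668869773173957652932570839348976805609737 ∷
  158610578754063422367240829057372313393051965930653 ∷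
  475831736262190267101722484703696673882432578082802 ∷
  1427522066286456192648189047082791325198878050427115 ∷
  4282566198859368577944567137662276675204279842573080 ∷
  12847698596578105733833701412975207594358384880625404 ∷
  200402613404737465795632171240775897775836550539638547 ∷
  220470394771810103945147304068991231566265082613464689 ∷
  1803623520642637192160689541167095118667781394513310954 ∷
  1984233552946290935506325736620921025256571008099095381 ∷
  9365796065270006399827631233936100684031055972853042765 ∷
  17858096719019214460582076890181954808970865517343017411 ∷
  146093505172053612565015852834534704226516078008655032614 ∷
  252876493762290172795346043316274912073730557706904582616 ∷
  758629481286870518386038129948824425391572082883795693449 ∷
  1446506260097846091984111461996651519009965359040933966255 ∷
  4339517502721669113921444684314204893941854675134831957320 ∷
  35500721756809027853298852238789727968067633709149189221290 ∷
  106502165270427083559896556716375799662216244032470681868726 ∷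
  117166972573485066075879006476483805549192428748586578263123 ∷
  351500917720455198227637019429450596409291759838113262695645 ∷
  2875558462301531256117207031341947300002010992261315192761050 ∷
  8626675386904593768351621094025841993893526565645196340663700 ∷
  25880026160713781305054863282077711692568720819939902735964162 ∷
  77640078482141343915164589846233135066163914920804977339325801 ∷
  134388936721525251720531496606044400493148956714959806072669983 ∷
  256244244457553141656709393158320818019560051905825516153700156 ∷
  1209500430493727265484783469454399173917384932365098725240861046 ∷
  6288846357053448857128331777545274577656358682293648645884112857 ∷
  6918594600353934824731153615274661881117416224021330875256391323 ∷
  20755783801061804474193460845823579502281127298975518673112149939 ∷
  169798851640443119142464957993722414044859729826990479651865414329 ∷
  186801999214276431001293645242607045044491986916316181107238561486 ∷
  1528189664763988072282184621943395831703692384904053963666307004804 ∷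
  1681217992928487879011642807183459889657153800532885362947037379206 ∷
  7935532324469344588845664343090319057543210252047296847597855696843 ∷
  23806596973408033766536993029270947414159858234606676843027418541943 ∷
  45392899172922166385061098869817057949691157288411765909204268895850 ∷
  136178657427207518199943067381860251062229457843164300505521894524040 ∷
  408535972281622554599829202145580753150387411350780420408061573688369 ∷
  3342150796838841914081137768190206647537080908566813765289239937269490 ∷
  5785003064538152205268489306112838162497462859763290114355387115750331 ∷
  11030474499020086431569847025363460428803349574979011132651869303131534 ∷
  90238071514648731680190719741141833442414333986385113234550562100088433 ∷
  270714214543946195040572159223406738450498539597699685408188948959966185 ∷
  297822723793302842303275488364128991876470028502564408345878981191467281 ∷
  893468171379908526909826465092386975620895538828701316893671481974863563 ∷
  7309283792686547266095448299031981850175999552113342086537130561492450784 ∷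
  8041215909785643008614418481491324775244307751323397517471945977176380172 ∷
  24123647729356929025843255444474447093852365950435533730297780881631240383 ∷
  72370943188070787077529766333423343657186902276850043994026029320359892237 ∷
  592051987207610328553731312221590543439206193479008191443377693509238433526 ∷
  1024795937873740048706697075109970941971938066618804415823402602948144979893 ∷
  5328467884868492956983581809994684122941124007556740526140576486643734894491 ∷
  15985403654605478870950745429983059381413168444134484078602273199687582895262 ∷
  47956210963816436612852236289949178130666613851519637145581799119371989550437 ∷
  83008470967772943945242463083907709871844507009022039092437963456537825743470 ∷
  158275206155436655816495028811720744574511379419787958297706623510183762452872 ∷
  1294817696023043788547010379828618518497041461387457303307823174777475211075986 ∷
  1424476855398929902348455259305489680146407975743503815912995835850462308688133 ∷
  6723686148389608459564639509796524499620988837724037352019751566342049573913275 ∷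
  12820291698590369121136097333749407121195497343366316501535582677147587198112525 ∷
  38460875095771107363408292001248230684672956715561645137241180719927171647573441 ∷
  181539526006519428408245266764506161445699863138655382392712876416011091164175000 ∷
  943922100400798921850770566895128308326651294567595277607222657617433053701586246 ∷
  1038443627585819898812023884033699805152116789558881131088010689248328002387022158 ∷
  8495298903607190296656935102055627058313198643955150087437373009630546565965205095 ∷
  14704701606528073701067866607924987819057735927673030621464681611567120045420938973 ∷
  44114104819584221103203599823774979129464016434595565320422815870733814185170403260 ∷
  84113933834451411803773934606729880507379756336933317903714252411044304878810330011 ∷
  252341875793822429665723166864555463817892818396606731566626225797309299369198447793 ∷
  2064357633576547242087635229799517375170107270480411792966283296394987398193059082745 ∷
  2271076882144401866991508501780570046572091910206149871157545935893519931885261029447 ∷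
  18579218702188925178788717068195522634386556062335476450801210092399789240738068753352 ∷
  55737656106566775536366151204586969129595652855117323907046356138895168059845441601947 ∷
  61319075817898850408770729548075391257446481575566046521254013681887390680848163210552 ∷
  501638904959100979827295360841282722166336066726907657512924276256662337339742385536733 ∷
  1504916714877302939481886082523837333385311041049173822447567270583553837095078569082983 ∷
  2604893775491628671923069365994089812143643810174588198008796576235595914907169815832110 ∷
  13544250433895726455336974742714536000521420974380754584961727061513226794604209817562318 ∷
  14900531036971564246803141193778378130736914995684088944745274100213678845862964246083949 ∷
  44701593110914692740409423581335123593182776212070401627128639377740936984416176715532129 ∷
  210996395814821922425768618645521274783635148624141644038712522675081611788656819100543764 ∷
  1097084285145553842882294954159877416042235098924841121381899891982570984788726048299393098 ∷
  1898967562333397301831917567809690018722315596094401606694080792622486126509820168552644832 ∷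
  3620829041984090111973163310088145011047804873177702531793904046325730376609155083961548934 ∷
  29621275698929953757821963762316690589714386194934070671006203822104438340332045013597349666 ∷
  88863827096789861273465891286950070699069231662912651464412238036602521471213308798350686845 ∷
  153816372549005181448385322992584891516507563283646530142220544204721426699150837333799485747 ∷
  293287152400711299069826228117139745894872197327005244995979028018036277126755301508238063820 ∷
  1384347352941046633035467906933265083519399558394938075296192942743034473292484814596714999556 ∷
  2639585148710938619767089547822956291486982438645057601072716967679682064886139298242546877238 ∷
  7918753114819205074885308159162773139161549257639635437033268149308245074319253303665273239643 ∷
  37377378529408259091957633487198157264096615673320819816525807253396673289484158376470952396598 ∷
  71268778033372845673967773432464958252453943950462274534022900555561338323847101083077367051867 ∷
  583035569582038279815209712733683610826774145186310967598182398784774711480341654507946168351946 ∷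
  641419002300355611065709960892184624272085495554160470806206134275453752249689106690956526187639 ∷
  5247320126238344518336887414603478453962258094485756834461314334917786165179192699660418998961800 ∷
  15741960378715033555010662243809457492322901920030396125150924767188917483381987024234492660918025 ∷
  27248108947938620878037114812167456638912341524266168647917947040343635630447150658535367122784123 ∷
  141677643408435301995095960194293918256980968551115434530455487079179182624995582383656161365480699 ∷
  155864817558986413488967520496800863698116775419660994405908090640703188865258122266601962722665394 ∷
  1275098790675917717955863641748566056878209795569576601716064444079844585769056258941177854665598293 ∷
  3825296372027753153867590925245698171717289654314221986933955178597701091859085838955520296452875745 ∷
  6621290474349084873363018899356691964862923176681763267995791450576439531136815075825530171519575257 ∷
  12625050222277899492606369160240843558311362412034659120395472082471515137266276068874747230840569025 ∷
  103283002044749335154424954981640266409339144323926558547332438099545171291831627829718544486406148651 ∷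
  309849006134248005463274864944901551909100461999451980941691408841391198487569452372467780711161030959 ∷
  340876456356909853239716966241388450725027375159685200129127844687219828296541190183903196569107255225 ∷
  1022629068004509858901115901979508328223220355374807388752033238680192726118568360307109916709027388579 ∷
  8365923165624696147508421353512341901545712473985203485424559975593172292910014673611620738172149703747 ∷
  25097769496874088442525264060537025704637137421955610456277004116152687077498430592282783577212918859460 ∷
  75293308490622265327575792181610536001846357752913894009617121075819928635123825654629911310402199332194 ∷
  130326860406613037562404300996037714434265762925676633688496697586660923560776589033183441731788900576563 ∷
  248498863525095895712971164181021043416140409671544880397249746312744194671442545428331218819254287927479 ∷
  2032919329246801163844546388903499082075608131178404463348273556613045214794149119638362287411169576416586 ∷
  6098757987740403491533639166710876091205066055529640349026283351917821348685718330346717862952324988990434 ∷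
  10556475692935656042554748380679059200933715781466204423732839874246034043985658396652199012504641599271017 ∷
  31669427078806968127664245142037177610488450803513420310540047984840993239340305170080464589587599486358797 ∷
  60385223836598302658251992895987987273252938764527001498418810710826700284575775701163542989605295938273359 ∷
  181155671509794907974755978687964340648640246930853962653825350600042584528779610424436962563829330445639848 ∷
  1481998191020918048442674317510650830413609935085003235685731379982941119704502053394172055288288682205835818 ∷
  2565223593383364418340803856505011386449564515084587045153743886772120452386564718776518017330810505318217297 ∷
  13337983719188262435984068857595857473723062129312507320744863656893389920504232482717663282966676973675091694 ∷
  14673609392293387545955234273725111592539860001399170974959853398603449346831148444379392695925566777038125242 ∷
  44020828176880162637865702821175334778039025152085160927731600810063695853462031913444538538354536766236467600 ∷
  207783111064052517885605112376905922302414725721437438618889473727069442782751337466342545863579991704145845814 ∷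
  623349333192157553656815337130717766907244177164314155812590516031830246158317295864662982694792068488293547932 ∷
  3241130043762747771944128732395793366114564928030902076444694528022692228793745990773327708088343671497203527429 ∷
  9723390131288243315832386197187984102358336246978580016136203063823389088291251543147702838661824311396625676964 ∷
  16830431996188253948734014102529372796188533409541237359823754751303098294424720770053697181967484053480331444967 ∷
  87510511181594189842491475774685790942384596052479680265145861966545519156287090256312693969836315081454910198934 ∷
  262531533544782569527474427324057378846774312611403248764571160796451985028873278998203744392326470393646164622061 ∷
  787594600634347708582423281972172127965460362234576733786700965249091796349649004620620500146157737685654864779735 ∷
  1363264991691248569847455142304879197415481086501856508712395202672972142367721443122383043701212706542484643106041 ∷
  4089794975073745709542365426914639268678429046383204071590639208323987443556965180804813631544632407192173890498406 ∷
  12269384925221237128627096280743917806035287139149612214771917624971962330671398242228682648669186180971996839460108 ∷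
  36808154775663711385881288842231753418105861417375477939020413602329170580636051178150160824817331683600778801816775 ∷
  191385487954146493185528857519251091086719132349279390457608884941467344893690302696100328811357378626101212953012552 ∷
  210550256524344334611869882756894169805976346819352323906769843467338208134252217868068459061138933332279499848992667 ∷
  993820178942920207418794798740257342288858258271118589396528536794015537230504120382061827665219831265724970153235786 ∷
  1894952308719099011506828944812043565569883842704048648711913018163340343299049680555626763827762233480339130607398653 ∷
  15502224524285865948027837459058263808070604036908617919929794009787647368011980056786520220714677754239778791974364430 ∷
  46506673572857597844083512377174792490569529156172251308897487421609079791909814754658411415456135796303712761216348156 ∷ []

exceptionalLengths : All HasExtremal lengths
exceptionalLengths = tabulates-sound lengths exceptionalWords refl

-- The 163 lengths from 87 to 249, up to where `longLengths` takes over.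
mediumLengths : All HasExtremal (applyUpTo (87 +_) 163)
mediumLengths = tabulates-sound (applyUpTo (87 +_) 163) mediumWords refl

-- From 87 on every length occurs, so 86 is the last one to search; it is split as 2 + 84 because
-- the search starts from a word of two letters.
exhausted : Exhaust.Exhausted (2 + 84)
exhausted = record { holds = refl }

inRange : ∀ {P : ℕ → Set} a b m → a + m ≡ b → All P (applyUpTo (a +_) m) → ∀ {n} → a ≤ n → n < b → P n
inRange {P} a b m refl ps {n} a≤n n<b = subst P (m+[n∸m]≡n a≤n) (All.lookup ps (∈-applyUpTo⁺ (a +_)
  (+-cancelˡ-< a (n ∸ a) m (subst (_< a + m) (sym (m+[n∸m]≡n a≤n)) n<b))))

fromEightySeven : ∀ n → 87 ≤ n → HasExtremal n
fromEightySeven n 87≤n with n <? 250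
... | yes n<250 = inRange 87 250 163 refl mediumLengths 87≤n n<250
... | no n≮250  = longLengths n (≮⇒≥ n≮250)

theorem1 : (n : ℕ) → (∃[ w ] (ExtremalSquareFree {Γ} w × length w ≡ n)) ⇔ ExceptionalLength n
theorem1 n = mk⇔ only if
  where
  only : HasExtremal n → ExceptionalLength n
  only (w , ex , refl) with length w ≤? 86
  ... | yes w≤86 = allowed⇒exceptional (length w) (necessity 84 exhausted w ex w≤86)
  ... | no w≰86  = inj₂ (inj₂ (inj₂ (inj₂ (inj₂ (inj₂ (inj₂ (inj₂ (inj₂ (inj₂ (inj₂ (inj₂ (inj₂ (≰⇒> w≰86)))))))))))))

  if : ExceptionalLength n → HasExtremal n
  if (inj₁ refl) = All.head exceptionalLengths
  if (inj₂ (inj₁ refl)) = All.head (All.tail exceptionalLengths)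
  if (inj₂ (inj₂ (inj₁ refl))) = All.head (All.tail (All.tail exceptionalLengths))
  if (inj₂ (inj₂ (inj₂ (inj₁ refl)))) = All.head (All.tail (All.tail (All.tail exceptionalLengths)))
  if (inj₂ (inj₂ (inj₂ (inj₂ (inj₁ refl))))) = All.head (All.tail (All.tail (All.tail (All.tail exceptionalLengths))))
  if (inj₂ (inj₂ (inj₂ (inj₂ (inj₂ (inj₁ refl)))))) = All.head (All.tail (All.tail (All.tail (All.tail (All.tail exceptionalLengths)))))
  if (inj₂ (inj₂ (inj₂ (inj₂ (inj₂ (inj₂ (inj₁ refl))))))) = All.head (All.tail (All.tail (All.tail (All.tail (All.tail (All.tail exceptionalLengths))))))
  if (inj₂ (inj₂ (inj₂ (inj₂ (inj₂ (inj₂ (inj₂ (inj₁ refl)))))))) = All.head (All.tail (All.tail (All.tail (All.tail (All.tail (All.tail (All.tail exceptionalLengths)))))))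
  if (inj₂ (inj₂ (inj₂ (inj₂ (inj₂ (inj₂ (inj₂ (inj₂ (inj₁ refl))))))))) = All.head (All.tail (All.tail (All.tail (All.tail (All.tail (All.tail (All.tail (All.tail exceptionalLengths))))))))
  if (inj₂ (inj₂ (inj₂ (inj₂ (inj₂ (inj₂ (inj₂ (inj₂ (inj₂ (inj₁ refl)))))))))) = All.head (All.tail (All.tail (All.tail (All.tail (All.tail (All.tail (All.tail (All.tail (All.tail exceptionalLengths)))))))))
  if (inj₂ (inj₂ (inj₂ (inj₂ (inj₂ (inj₂ (inj₂ (inj₂ (inj₂ (inj₂ (inj₁ refl))))))))))) = All.head (All.tail (All.tail (All.tail (All.tail (All.tail (All.tail (All.tail (All.tail (All.tail (All.tail exceptionalLengths))))))))))
  if (inj₂ (inj₂ (inj₂ (inj₂ (inj₂ (inj₂ (inj₂ (inj₂ (inj₂ (inj₂ (inj₂ (inj₁ refl)))))))))))) = All.head (All.tail (All.tail (All.tail (All.tail (All.tail (All.tail (All.tail (All.tail (All.tail (All.tail (All.tail exceptionalLengths)))))))))))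
  if (inj₂ (inj₂ (inj₂ (inj₂ (inj₂ (inj₂ (inj₂ (inj₂ (inj₂ (inj₂ (inj₂ (inj₂ (inj₁ refl))))))))))))) = All.head (All.tail (All.tail (All.tail (All.tail (All.tail (All.tail (All.tail (All.tail (All.tail (All.tail (All.tail (All.tail exceptionalLengths))))))))))))
  if (inj₂ (inj₂ (inj₂ (inj₂ (inj₂ (inj₂ (inj₂ (inj₂ (inj₂ (inj₂ (inj₂ (inj₂ (inj₂ 87≤n))))))))))))) = fromEightySeven n 87≤n
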